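{- Let $r\in\mathbb{N}$, let $\mathbf{e}=(e_1,\ldots,e_r)\in\mathbb{Z}^r$, and suppose the Jordan totient quotient $J_{\mathbf e}$ has weight $w=\sum_{i=1}^r ie_i=0$. Then $\mathfrak{S}_{\mathbf e}>0$ and, for $x\ge 2$, \[ \sum_{n\le x}J_{\mathbf e}(n)=\mathfrak{S}_{\mathbf e}\,x+O_{\mathbf e}\big((\log x)^{|e_1|}\big). \]
   Context: Throughout, $p$ denotes a prime. For an integer $k\ge1$, the $k$-th Jordan totient is $J_k(n)=n^k\prod_{p\mid n}(1-p^{ -k})$. For $\mathbf e=(e_1,\ldots,e_r)\in\mathbb{Z}^r$ the Jordan totient quotient is $J_{\mathbf e}(n)=\prod_{i=1}^r J_i(n)^{e_i}=n^w\prod_{p\mid n}\prod_{i=1}^r(1-p^{ -i})^{e_i}$, where $w=\sum_i ie_i$ is its weight. Define $\mathfrak{S}_{\mathbf e}=\prod_p\left(1+\frac{J_{\mathbf e}(p)p^{ -w}-1}{p}\right)$. -}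

module Defs where

open import Data.Fin.Base using (toℕ)
open import Data.Integer.Base as ℤ using (ℤ; +_; -[1+_]; 0ℤ)
import Data.Integer.Properties as ℤ
open import Data.List.Base using (List; filter; foldr; map; upTo)
import Data.Maybe.Base as Maybe
open import Data.Nat.Base as ℕ using (ℕ; zero; suc)
open import Data.Nat.Divisibility using (_∣?_)
open import Data.Nat.Primality using (prime?)
import Data.Nat.Properties as ℕ
open import Data.Product.Base using (_×_; _,_; proj₁; proj₂; ∃-syntax)
open import Data.Rational.Base as ℚ using (ℚ; 0ℚ; 1ℚ; ½; mkℚ)
import Data.Rational.Properties as ℚ
open import Data.Rational.Unnormalised.Base using (mkℚᵘ; *≡*; *≤*)
import Data.Rational.Unnormalised.Properties as ℚᵘ
open import Data.Sum.Base using (inj₁; inj₂)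
open import Data.Vec.Functional using (Vector)
open import Relation.Binary.PropositionalEquality
  using (_≡_; refl; sym; trans; cong; cong₂; subst; subst₂)
open import Relation.Nullary.Decidable using (yes; no)
open import Relation.Nullary.Negation using (contradiction)
open import Algebra.Definitions.RawMonoid ℤ.+-0-rawMonoid using () renaming (sum to sumℤ)
open import Algebra.Definitions.RawSemiring ℚ.+-*-rawSemiring using ()
  renaming (product to productℚ; _^_ to _^ℚ_)
open import Tactic.RingSolver using (solve-∀)
import Tactic.RingSolver.Core.AlmostCommutativeRing as ACR
open import Level using (0ℓ)

ι : ℕ → ℚ
ι n = + n ℚ./ 1

infix 9 _⁻¹

-- Total inverse, with 0 ⁻¹ = 0.
_⁻¹ : ℚ → ℚ
p ⁻¹ with p ℚ.≟ 0ℚ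
... | yes _  = 0ℚ
... | no p≢0 = (ℚ.1/ p) {{ℚ.≢-nonZero p≢0}}

infixr 8 _^ℤ_

_^ℤ_ : ℚ → ℤ → ℚ
p ^ℤ (+ n)    = p ^ℚ n
p ^ℤ -[1+ n ] = (p ^ℚ suc n) ⁻¹

∑₁ : ℕ → (ℕ → ℚ) → ℚ
∑₁ zero    f = 0ℚ
∑₁ (suc n) f = ∑₁ n f ℚ.+ f (suc n)

∏ : List ℕ → (ℕ → ℚ) → ℚ
∏ ns f = foldr ℚ._*_ 1ℚ (map f ns)

primesUpTo : ℕ → List ℕ
primesUpTo n = filter prime? (upTo (suc n))

primeDivisors : ℕ → List ℕ
primeDivisors n = filter (_∣? n) (primesUpTo n)

jordan : ℕ → ℕ → ℚ
jordan k n = ι n ^ℚ k ℚ.* ∏ (primeDivisors n) λ p → 1ℚ ℚ.- ι p ^ℤ (ℤ.- (+ k))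

-- A vector e : Vector ℤ r stands for (e₁ , … , e_r), so e i is the exponent
-- of the Jordan totient of order suc (toℕ i).

weight : ∀ {r} → Vector ℤ r → ℤ
weight e = sumℤ λ i → + suc (toℕ i) ℤ.* e i

J : ∀ {r} → Vector ℤ r → ℕ → ℚ
J e n = productℚ λ i → jordan (suc (toℕ i)) n ^ℤ e i

eulerFactor : ∀ {r} → Vector ℤ r → ℕ → ℚ
eulerFactor e p = 1ℚ ℚ.+ (J e p ℚ.* ι p ^ℤ (ℤ.- weight e) ℚ.- 1ℚ) ℚ.* ι p ⁻¹

module Rational where
  open import Data.Rational.Base using (_+_; _*_; -_; _-_; _≤_; _<_; _⊔_; ∣_∣)
  open ℚ.≤-Reasoning

  ring : ACR.AlmostCommutativeRing 0ℓ 0ℓ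
  ring = ACR.fromCommutativeRing ℚ.+-*-commutativeRing isZero
    where
    isZero : ∀ p → Maybe.Maybe (0ℚ ≡ p)
    isZero p with 0ℚ ℚ.≟ p
    ... | yes eq = Maybe.just eq
    ... | no  _  = Maybe.nothing

  *-monoʳ : ∀ {r p q} → 0ℚ ≤ r → p ≤ q → p * r ≤ q * r
  *-monoʳ {r} 0≤r = ℚ.*-monoʳ-≤-nonNeg r {{ℚ.nonNegative 0≤r}}

  *-monoˡ : ∀ {r p q} → 0ℚ ≤ r → p ≤ q → r * p ≤ r * q
  *-monoˡ {r} 0≤r = ℚ.*-monoˡ-≤-nonNeg r {{ℚ.nonNegative 0≤r}}

  *-mono : ∀ {p q r s} → 0ℚ ≤ p → 0ℚ ≤ s → p ≤ q → r ≤ s → p * r ≤ q * s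
  *-mono 0≤p 0≤s p≤q r≤s = ℚ.≤-trans (*-monoˡ 0≤p r≤s) (*-monoʳ 0≤s p≤q)

  *-nonNeg : ∀ {p q} → 0ℚ ≤ p → 0ℚ ≤ q → 0ℚ ≤ p * q
  *-nonNeg {p} {q} 0≤p 0≤q = subst (_≤ p * q) (ℚ.*-zeroʳ p) (*-monoˡ 0≤p 0≤q)

  *-pos : ∀ {p q} → 0ℚ < p → 0ℚ < q → 0ℚ < p * q
  *-pos {p} {q} 0<p 0<q =
    subst (_< p * q) (ℚ.*-zeroʳ p) (ℚ.*-monoʳ-<-pos p {{ℚ.positive 0<p}} 0<q)

  p≤p+q : ∀ {p q} → 0ℚ ≤ q → p ≤ p + q
  p≤p+q {p} {q} 0≤q = subst (_≤ p + q) (ℚ.+-identityʳ p) (ℚ.+-monoʳ-≤ p 0≤q)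

  0≤1 : 0ℚ ≤ 1ℚ
  0≤1 = ℚ.≤ᵇ⇒≤ _

  half : ∀ p → ½ * p + ½ * p ≡ p
  half p = trans (sym (ℚ.*-distribʳ-+ p ½ ½)) (ℚ.*-identityˡ p)

  half-pos : ∀ {p} → 0ℚ < p → 0ℚ < ½ * p
  half-pos = *-pos (ℚ.positive⁻¹ ½)

  p≤∣p∣ : ∀ p → p ≤ ∣ p ∣
  p≤∣p∣ p with ℚ.≤-total 0ℚ p
  ... | inj₁ 0≤p = ℚ.≤-reflexive (sym (ℚ.0≤p⇒∣p∣≡p 0≤p))
  ... | inj₂ p≤0 = ℚ.≤-trans p≤0 (ℚ.0≤∣p∣ p)

  -p≤∣p∣ : ∀ p → - p ≤ ∣ p ∣
  -p≤∣p∣ p = subst (- p ≤_) (ℚ.∣-p∣≡∣p∣ p) (p≤∣p∣ (- p))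

  ∣∣≤ : ∀ {p q} → p ≤ q → - p ≤ q → ∣ p ∣ ≤ q
  ∣∣≤ {p} p≤q -p≤q with ℚ.∣p∣≡p∨∣p∣≡-p p
  ... | inj₁ eq = subst (_≤ _) (sym eq) p≤q
  ... | inj₂ eq = subst (_≤ _) (sym eq) -p≤q

  ∣p-q∣≡∣q-p∣ : ∀ p q → ∣ p - q ∣ ≡ ∣ q - p ∣
  ∣p-q∣≡∣q-p∣ p q = trans (cong ∣_∣ (lem p q)) (ℚ.∣-p∣≡∣p∣ (q - p))
    where
    lem : ∀ p q → p - q ≡ - (q - p)
    lem = solve-∀ ring

  triangle : ∀ p q r → ∣ p - r ∣ ≤ ∣ p - q ∣ + ∣ q - r ∣
  triangle p q r = subst (λ s → ∣ s ∣ ≤ ∣ p - q ∣ + ∣ q - r ∣) (lem p q r) (ℚ.∣p+q∣≤∣p∣+∣q∣ (p - q) (q - r))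
    where
    lem : ∀ p q r → (p - q) + (q - r) ≡ p - r
    lem = solve-∀ ring

  p≤q+∣p-q∣ : ∀ p q → p ≤ q + ∣ p - q ∣
  p≤q+∣p-q∣ p q = subst (_≤ q + ∣ p - q ∣) (lem p q) (ℚ.+-monoʳ-≤ q (p≤∣p∣ (p - q)))
    where
    lem : ∀ p q → q + (p - q) ≡ p
    lem = solve-∀ ring

  p≤q+r⇒p-q≤r : ∀ {p q r} → p ≤ q + r → p - q ≤ r
  p≤q+r⇒p-q≤r {p} {q} {r} p≤q+r = subst (_ ≤_) (lem q r) (ℚ.+-monoˡ-≤ (- q) p≤q+r)
    where
    lem : ∀ q r → (q + r) - q ≡ r
    lem = solve-∀ ring

  -[p-q]≡q-p : ∀ p q → - (p - q) ≡ q - p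
  -[p-q]≡q-p = solve-∀ ring

  ∣p-q∣≤ : ∀ {p q r} → p ≤ q + r → q ≤ p + r → ∣ p - q ∣ ≤ r
  ∣p-q∣≤ {p} {q} p≤q+r q≤p+r = ∣∣≤ (p≤q+r⇒p-q≤r p≤q+r)
    (subst (_≤ _) (sym (-[p-q]≡q-p p q)) (p≤q+r⇒p-q≤r q≤p+r))

  ∣∣-lipschitz : ∀ p q → ∣ ∣ p ∣ - ∣ q ∣ ∣ ≤ ∣ p - q ∣
  ∣∣-lipschitz p q = ∣p-q∣≤ (bound p q)
      (subst (λ d → ∣ q ∣ ≤ ∣ p ∣ + d) (∣p-q∣≡∣q-p∣ q p) (bound q p))
    where
    lem : ∀ p q → q + (p - q) ≡ p
    lem = solve-∀ ring
    bound : ∀ p q → ∣ p ∣ ≤ ∣ q ∣ + ∣ p - q ∣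
    bound p q = subst (λ s → ∣ s ∣ ≤ ∣ q ∣ + ∣ p - q ∣) (lem p q) (ℚ.∣p+q∣≤∣p∣+∣q∣ q (p - q))

  ⊔-lipschitz : ∀ r p q → ∣ (r ⊔ p) - (r ⊔ q) ∣ ≤ ∣ p - q ∣
  ⊔-lipschitz r p q = ∣p-q∣≤ (bound p q)
      (subst (λ d → r ⊔ q ≤ (r ⊔ p) + d) (∣p-q∣≡∣q-p∣ q p) (bound q p))
    where
    bound : ∀ p q → r ⊔ p ≤ (r ⊔ q) + ∣ p - q ∣
    bound p q = ℚ.⊔-lub
      (ℚ.≤-trans (ℚ.p≤p⊔q r q) (p≤p+q (ℚ.0≤∣p∣ (p - q))))
      (ℚ.≤-trans (p≤q+∣p-q∣ p q) (ℚ.+-monoˡ-≤ ∣ p - q ∣ (ℚ.p≤q⊔p r q)))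

  ⁻¹-inverseʳ : ∀ {p} → 0ℚ < p → p * p ⁻¹ ≡ 1ℚ
  ⁻¹-inverseʳ {p} 0<p with p ℚ.≟ 0ℚ
  ... | yes p≡0 = contradiction (sym p≡0) (ℚ.<⇒≢ 0<p)
  ... | no p≢0  = ℚ.*-inverseʳ p {{ℚ.≢-nonZero p≢0}}

  ⁻¹-pos : ∀ {p} → 0ℚ < p → 0ℚ < p ⁻¹
  ⁻¹-pos {p} 0<p with p ℚ.≟ 0ℚ
  ... | yes p≡0 = contradiction (sym p≡0) (ℚ.<⇒≢ 0<p)
  ... | no p≢0  = ℚ.positive⁻¹ _ {{ℚ.1/pos⇒pos p {{ℚ.positive 0<p}}}}

  ⁻¹≤1 : ∀ {p} → 1ℚ ≤ p → p ⁻¹ ≤ 1ℚ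
  ⁻¹≤1 {p} 1≤p = subst₂ _≤_ (ℚ.*-identityˡ (p ⁻¹)) (⁻¹-inverseʳ 0<p)
                   (*-monoʳ (ℚ.<⇒≤ (⁻¹-pos 0<p)) 1≤p)
    where
    0<p : 0ℚ < p
    0<p = ℚ.<-≤-trans (ℚ.positive⁻¹ 1ℚ) 1≤p

  ι-hom-+ : ∀ m n → ι (m ℕ.+ n) ≡ ι m + ι n
  ι-hom-+ m n = ℚ.toℚᵘ-injective
    (ℚᵘ.≃-trans (ℚ.toℚᵘ-fromℚᵘ (mkℚᵘ (+ (m ℕ.+ n)) 0))
    (ℚᵘ.≃-sym (ℚᵘ.≃-trans (ℚ.toℚᵘ-homo-+ (ι m) (ι n))
    (ℚᵘ.≃-trans (ℚᵘ.+-cong (ℚ.toℚᵘ-fromℚᵘ (mkℚᵘ (+ m) 0)) (ℚ.toℚᵘ-fromℚᵘ (mkℚᵘ (+ n) 0)))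
    (*≡* (cong (ℤ._* + 1) (cong₂ ℤ._+_ (ℤ.*-identityʳ (+ m)) (ℤ.*-identityʳ (+ n)))))))))

  ι-suc : ∀ n → ι (suc n) ≡ ι n + 1ℚ
  ι-suc n = trans (ι-hom-+ 1 n) (ℚ.+-comm 1ℚ (ι n))

  ι-hom-* : ∀ m n → ι (m ℕ.* n) ≡ ι m * ι n
  ι-hom-* zero    n = sym (ℚ.*-zeroˡ (ι n))
  ι-hom-* (suc m) n = begin-equality
    ι (n ℕ.+ m ℕ.* n)       ≡⟨ ι-hom-+ n (m ℕ.* n) ⟩
    ι n + ι (m ℕ.* n)       ≡⟨ cong (λ q → ι n + q) (ι-hom-* m n) ⟩
    ι n + ι m * ι n         ≡⟨ lem (ι m) (ι n) ⟩
    (ι m + 1ℚ) * ι n        ≡⟨ cong (_* ι n) (sym (ι-suc m)) ⟩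
    ι (suc m) * ι n         ∎
    where
    lem : ∀ p q → q + p * q ≡ (p + 1ℚ) * q
    lem = solve-∀ ring

  0≤ι : ∀ n → 0ℚ ≤ ι n
  0≤ι zero    = ℚ.≤-refl
  0≤ι (suc n) = ℚ.≤-trans (0≤ι n) (subst (ι n ≤_) (sym (ι-suc n)) (p≤p+q 0≤1))

  ι-mono : ∀ {m n} → m ℕ.≤ n → ι m ≤ ι n
  ι-mono {m} m≤n with ℕ.m≤n⇒∃[o]m+o≡n m≤n
  ... | o , refl = subst (ι m ≤_) (sym (ι-hom-+ m o)) (p≤p+q (0≤ι o))

  1≤ι-suc : ∀ n → 1ℚ ≤ ι (suc n)
  1≤ι-suc n = ι-mono (ℕ.s≤s (ℕ.z≤n {n}))

  0<ι-suc : ∀ n → 0ℚ < ι (suc n)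
  0<ι-suc n = ℚ.<-≤-trans (ℚ.positive⁻¹ 1ℚ) (1≤ι-suc n)

  archimedean : ∀ p → ∃[ n ] p ≤ ι n
  archimedean p@(mkℚ a d _) = ℤ.∣ a ∣ , ℚ.toℚᵘ-cancel-≤
      (ℚᵘ.≤-respʳ-≃ (ℚᵘ.≃-sym (ℚ.toℚᵘ-fromℚᵘ (mkℚᵘ (+ ℤ.∣ a ∣) 0)))
        (*≤* (subst (ℤ._≤ + ℤ.∣ a ∣ ℤ.* + suc d) (sym (ℤ.*-identityʳ a)) (bound a))))
    where
    bound : ∀ a → a ℤ.≤ + ℤ.∣ a ∣ ℤ.* + suc d
    bound (+ n)    = subst (+ n ℤ.≤_) (ℤ.pos-* n (suc d)) (ℤ.+≤+ (ℕ.m≤m*n n (suc d)))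
    bound -[1+ n ] = ℤ.≤-trans ℤ.-≤+ (ℤ.≤-reflexive (ℤ.pos-* (suc n) (suc d)))

  vanishes : ∀ {c ε} → 0ℚ ≤ c → 0ℚ < ε →
             ∃[ N ] (∀ n → N ℕ.≤ n → c * ι (suc n) ⁻¹ ≤ ε)
  vanishes {c} {ε} 0≤c 0<ε = N , λ n N≤n →
      let u = ι (suc n) ⁻¹
          0≤u = ℚ.<⇒≤ (⁻¹-pos (0<ι-suc n)) in begin
        c * u                ≡⟨ cong (_* u) (trans (sym (ℚ.*-identityʳ c)) (cong (c *_) (sym (⁻¹-inverseʳ 0<ε)))) ⟩
        c * (ε * ε ⁻¹) * u   ≡⟨ lem c ε (ε ⁻¹) u ⟩
        (c * ε ⁻¹) * (ε * u) ≤⟨ *-monoʳ (*-nonNeg (ℚ.<⇒≤ 0<ε) 0≤u) (ℚ.≤-trans c/ε≤N (ι-mono (ℕ.m≤n⇒m≤1+n N≤n))) ⟩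
        ι (suc n) * (ε * u)  ≡⟨ lem′ (ι (suc n)) ε u ⟩
        ε * (ι (suc n) * u)  ≡⟨ cong (ε *_) (⁻¹-inverseʳ (0<ι-suc n)) ⟩
        ε * 1ℚ               ≡⟨ ℚ.*-identityʳ ε ⟩
        ε                    ∎
    where
    N : ℕ
    N = proj₁ (archimedean (c * ε ⁻¹))
    c/ε≤N : c * ε ⁻¹ ≤ ι N
    c/ε≤N = proj₂ (archimedean (c * ε ⁻¹))
    lem : ∀ c e i u → c * (e * i) * u ≡ (c * i) * (e * u)
    lem = solve-∀ ring
    lem′ : ∀ n e u → n * (e * u) ≡ e * (n * u)
    lem′ = solve-∀ ring

record ℝ : Set where
  constructor mkℝ
  field
    seq    : ℕ → ℚ
    cauchy : ∀ ε → 0ℚ ℚ.< ε →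
             ∃[ N ] (∀ m n → N ℕ.≤ m → N ℕ.≤ n → ℚ.∣ seq m ℚ.- seq n ∣ ℚ.≤ ε)

open ℝ

fromℚ : ℚ → ℝ
fromℚ q = mkℝ (λ _ → q) λ ε 0<ε → 0 , λ _ _ _ _ →
  subst (λ d → ℚ.∣ d ∣ ℚ.≤ ε) (sym (ℚ.+-inverseʳ q)) (ℚ.<⇒≤ 0<ε)

fromℕ : ℕ → ℝ
fromℕ n = fromℚ (ι n)

infix 4 _≤_ _<_

_≤_ : ℝ → ℝ → Set
x ≤ y = ∀ ε → 0ℚ ℚ.< ε → ∃[ N ] (∀ n → N ℕ.≤ n → seq x n ℚ.≤ seq y n ℚ.+ ε)

_<_ : ℝ → ℝ → Set
x < y = ∃[ ε ] 0ℚ ℚ.< ε × ∃[ N ] (∀ n → N ℕ.≤ n → seq x n ℚ.+ ε ℚ.≤ seq y n)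

module Real where
  open import Data.Rational.Base using (_+_; _*_; -_; _-_; _⊔_; ∣_∣) renaming (_≤_ to _≤ℚ_; _<_ to _<ℚ_)
  open ℚ.≤-Reasoning
  open Rational

  eventuallyBounded : ∀ x → ∃[ B ] 1ℚ ≤ℚ B × ∃[ N ] (∀ n → N ℕ.≤ n → ∣ seq x n ∣ ≤ℚ B)
  eventuallyBounded x with cauchy x 1ℚ (ℚ.positive⁻¹ 1ℚ)
  ... | N , close = 1ℚ + ∣ seq x N ∣ , p≤p+q (ℚ.0≤∣p∣ (seq x N)) , N , λ n N≤n → begin
        ∣ seq x n ∣                           ≡⟨ cong ∣_∣ (lem (seq x n) (seq x N)) ⟩
        ∣ (seq x n - seq x N) + seq x N ∣     ≤⟨ ℚ.∣p+q∣≤∣p∣+∣q∣ (seq x n - seq x N) (seq x N) ⟩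
        ∣ seq x n - seq x N ∣ + ∣ seq x N ∣   ≤⟨ ℚ.+-monoˡ-≤ ∣ seq x N ∣ (close n N N≤n ℕ.≤-refl) ⟩
        1ℚ + ∣ seq x N ∣                      ∎
    where
    lem : ∀ p q → p ≡ (p - q) + q
    lem = solve-∀ ring

  +-cauchy : ∀ x y ε → 0ℚ <ℚ ε → ∃[ N ] (∀ m n → N ℕ.≤ m → N ℕ.≤ n →
             ∣ (seq x m + seq y m) - (seq x n + seq y n) ∣ ≤ℚ ε)
  +-cauchy x y ε 0<ε with cauchy x (½ * ε) (half-pos 0<ε) | cauchy y (½ * ε) (half-pos 0<ε)
  ... | M , closeˣ | N , closeʸ = M ℕ.⊔ N , λ m n m≥ n≥ →
        let a = seq x m ; b = seq y m ; c = seq x n ; d = seq y n in begin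
        ∣ (a + b) - (c + d) ∣   ≡⟨ cong ∣_∣ (lem a b c d) ⟩
        ∣ (a - c) + (b - d) ∣   ≤⟨ ℚ.∣p+q∣≤∣p∣+∣q∣ (a - c) (b - d) ⟩
        ∣ a - c ∣ + ∣ b - d ∣   ≤⟨ ℚ.+-mono-≤ (closeˣ m n (ℕ.m⊔n≤o⇒m≤o M N m≥) (ℕ.m⊔n≤o⇒m≤o M N n≥))
                                              (closeʸ m n (ℕ.m⊔n≤o⇒n≤o M N m≥) (ℕ.m⊔n≤o⇒n≤o M N n≥)) ⟩
        ½ * ε + ½ * ε           ≡⟨ half ε ⟩
        ε                       ∎
    where
    lem : ∀ a b c d → (a + b) - (c + d) ≡ (a - c) + (b - d)
    lem = solve-∀ ring

  neg-cauchy : ∀ x ε → 0ℚ <ℚ ε → ∃[ N ] (∀ m n → N ℕ.≤ m → N ℕ.≤ n →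
               ∣ - seq x m - - seq x n ∣ ≤ℚ ε)
  neg-cauchy x ε 0<ε with cauchy x ε 0<ε
  ... | N , close = N , λ m n m≥ n≥ →
        subst (_≤ℚ ε) (trans (sym (ℚ.∣-p∣≡∣p∣ _)) (cong ∣_∣ (lem (seq x m) (seq x n)))) (close m n m≥ n≥)
    where
    lem : ∀ p q → - (p - q) ≡ - p - - q
    lem = solve-∀ ring

  abs-cauchy : ∀ x ε → 0ℚ <ℚ ε → ∃[ N ] (∀ m n → N ℕ.≤ m → N ℕ.≤ n →
               ∣ ∣ seq x m ∣ - ∣ seq x n ∣ ∣ ≤ℚ ε)
  abs-cauchy x ε 0<ε with cauchy x ε 0<ε
  ... | N , close = N , λ m n m≥ n≥ →
        ℚ.≤-trans (∣∣-lipschitz (seq x m) (seq x n)) (close m n m≥ n≥)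

  *-close : ∀ {a b c d A B δ} → ∣ a ∣ ≤ℚ A → ∣ d ∣ ≤ℚ B → ∣ a - c ∣ ≤ℚ δ → ∣ b - d ∣ ≤ℚ δ →
            ∣ a * b - c * d ∣ ≤ℚ (A + B) * δ
  *-close {a} {b} {c} {d} {A} {B} {δ} a≤A d≤B ac≤δ bd≤δ = begin
      ∣ a * b - c * d ∣                     ≡⟨ cong ∣_∣ (lem a b c d) ⟩
      ∣ a * (b - d) + d * (a - c) ∣         ≤⟨ ℚ.∣p+q∣≤∣p∣+∣q∣ (a * (b - d)) (d * (a - c)) ⟩
      ∣ a * (b - d) ∣ + ∣ d * (a - c) ∣     ≡⟨ cong₂ _+_ (ℚ.∣p*q∣≡∣p∣*∣q∣ a (b - d)) (ℚ.∣p*q∣≡∣p∣*∣q∣ d (a - c)) ⟩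
      ∣ a ∣ * ∣ b - d ∣ + ∣ d ∣ * ∣ a - c ∣ ≤⟨ ℚ.+-mono-≤ {∣ a ∣ * ∣ b - d ∣} {A * δ} {∣ d ∣ * ∣ a - c ∣} {B * δ}
          (*-mono {∣ a ∣} {A} {∣ b - d ∣} {δ} (ℚ.0≤∣p∣ a) 0≤δ a≤A bd≤δ)
          (*-mono {∣ d ∣} {B} {∣ a - c ∣} {δ} (ℚ.0≤∣p∣ d) 0≤δ d≤B ac≤δ) ⟩
      A * δ + B * δ                         ≡⟨ sym (ℚ.*-distribʳ-+ δ A B) ⟩
      (A + B) * δ                           ∎
    where
    0≤δ : 0ℚ ≤ℚ δ
    0≤δ = ℚ.≤-trans (ℚ.0≤∣p∣ (a - c)) ac≤δ
    lem : ∀ a b c d → a * b - c * d ≡ a * (b - d) + d * (a - c)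
    lem = solve-∀ ring

  divide : ∀ C {ε} → 0ℚ <ℚ C → 0ℚ <ℚ ε → ∃[ δ ] 0ℚ <ℚ δ × C * δ ≡ ε
  divide C {ε} 0<C 0<ε = ε * C ⁻¹ , *-pos {ε} {C ⁻¹} 0<ε (⁻¹-pos 0<C) , (begin-equality
    C * (ε * C ⁻¹)   ≡⟨ lem C ε (C ⁻¹) ⟩
    ε * (C * C ⁻¹)   ≡⟨ cong (ε *_) (⁻¹-inverseʳ 0<C) ⟩
    ε * 1ℚ           ≡⟨ ℚ.*-identityʳ ε ⟩
    ε                ∎)
    where
    lem : ∀ c e u → c * (e * u) ≡ e * (c * u)
    lem = solve-∀ ring

  *-cauchy : ∀ x y ε → 0ℚ <ℚ ε → ∃[ N ] (∀ m n → N ℕ.≤ m → N ℕ.≤ n →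
             ∣ seq x m * seq y m - seq x n * seq y n ∣ ≤ℚ ε)
  *-cauchy x y ε 0<ε =
    let A , 1≤A , K , boundˣ = eventuallyBounded x
        B , 1≤B , L , boundʸ = eventuallyBounded y
        0<A+B = ℚ.<-≤-trans (ℚ.positive⁻¹ (1ℚ + 1ℚ)) (ℚ.+-mono-≤ {1ℚ} {A} {1ℚ} {B} 1≤A 1≤B)
        δ , 0<δ , [A+B]δ≡ε = divide (A + B) 0<A+B 0<ε
        M , closeˣ = cauchy x δ 0<δ
        N , closeʸ = cauchy y δ 0<δ
    in (K ℕ.⊔ L) ℕ.⊔ (M ℕ.⊔ N) , λ m n m≥ n≥ →
      let m≥KL = ℕ.m⊔n≤o⇒m≤o (K ℕ.⊔ L) (M ℕ.⊔ N) m≥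
          n≥KL = ℕ.m⊔n≤o⇒m≤o (K ℕ.⊔ L) (M ℕ.⊔ N) n≥
          m≥MN = ℕ.m⊔n≤o⇒n≤o (K ℕ.⊔ L) (M ℕ.⊔ N) m≥
          n≥MN = ℕ.m⊔n≤o⇒n≤o (K ℕ.⊔ L) (M ℕ.⊔ N) n≥
      in subst (∣ seq x m * seq y m - seq x n * seq y n ∣ ≤ℚ_) [A+B]δ≡ε
           (*-close {seq x m} {seq y m} {seq x n} {seq y n} {A} {B} {δ}
             (boundˣ m (ℕ.m⊔n≤o⇒m≤o K L m≥KL)) (boundʸ n (ℕ.m⊔n≤o⇒n≤o K L n≥KL))
             (closeˣ m n (ℕ.m⊔n≤o⇒m≤o M N m≥MN) (ℕ.m⊔n≤o⇒m≤o M N n≥MN))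
             (closeʸ m n (ℕ.m⊔n≤o⇒n≤o M N m≥MN) (ℕ.m⊔n≤o⇒n≤o M N n≥MN)))

riemannTerm : ℚ → ℕ → ℚ
riemannTerm h k = h ℚ.* (1ℚ ℚ.+ ι k ℚ.* h) ⁻¹

-- Right-endpoint Riemann sum with n equal parts for the integral of
-- 1/(1+u) over [0,t].
riemann : ℕ → ℚ → ℚ
riemann n t = ∑₁ n (riemannTerm (t ℚ.* ι n ⁻¹))

module Log where
  open import Data.Rational.Base using (_+_; _*_; -_; _-_; _⊔_; ∣_∣) renaming (_≤_ to _≤ℚ_; _<_ to _<ℚ_)
  open ℚ.≤-Reasoning
  open Rational
  open Real

  ∑₁-cong : ∀ n {f g} → (∀ k → f k ≡ g k) → ∑₁ n f ≡ ∑₁ n g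
  ∑₁-cong zero    f≡g = refl
  ∑₁-cong (suc n) f≡g = cong₂ _+_ (∑₁-cong n f≡g) (f≡g (suc n))

  ∑₁-const : ∀ n c → ∑₁ n (λ _ → c) ≡ ι n * c
  ∑₁-const zero    c = sym (ℚ.*-zeroˡ c)
  ∑₁-const (suc n) c = begin-equality
    ∑₁ n (λ _ → c) + c   ≡⟨ cong (_+ c) (∑₁-const n c) ⟩
    ι n * c + c          ≡⟨ lem (ι n) c ⟩
    (ι n + 1ℚ) * c       ≡⟨ cong (_* c) (sym (ι-suc n)) ⟩
    ι (suc n) * c        ∎
    where
    lem : ∀ p c → p * c + c ≡ (p + 1ℚ) * c
    lem = solve-∀ ring

  ∑₁-close : ∀ n {f g c} → (∀ k → k ℕ.< n → ∣ f (suc k) - g (suc k) ∣ ≤ℚ c) → ∣ ∑₁ n f - ∑₁ n g ∣ ≤ℚ ι n * c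
  ∑₁-close zero    {c = c} _     = ℚ.≤-reflexive (sym (ℚ.*-zeroˡ c))
  ∑₁-close (suc n) {f} {g} {c} close = begin
    ∣ (∑₁ n f + f (suc n)) - (∑₁ n g + g (suc n)) ∣   ≡⟨ cong ∣_∣ (lem (∑₁ n f) (f (suc n)) (∑₁ n g) (g (suc n))) ⟩
    ∣ (∑₁ n f - ∑₁ n g) + (f (suc n) - g (suc n)) ∣   ≤⟨ ℚ.∣p+q∣≤∣p∣+∣q∣ (∑₁ n f - ∑₁ n g) (f (suc n) - g (suc n)) ⟩
    ∣ ∑₁ n f - ∑₁ n g ∣ + ∣ f (suc n) - g (suc n) ∣   ≤⟨ ℚ.+-mono-≤ (∑₁-close n λ k k<n → close k (ℕ.m<n⇒m<1+n k<n)) (close n ℕ.≤-refl) ⟩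
    ι n * c + c                                       ≡⟨ lem′ (ι n) c ⟩
    (ι n + 1ℚ) * c                                    ≡⟨ cong (_* c) (sym (ι-suc n)) ⟩
    ι (suc n) * c                                     ∎
    where
    lem : ∀ a b c d → (a + b) - (c + d) ≡ (a - c) + (b - d)
    lem = solve-∀ ring
    lem′ : ∀ p c → p * c + c ≡ (p + 1ℚ) * c
    lem′ = solve-∀ ring

  ∑₁-+ : ∀ m n f → ∑₁ (n ℕ.+ m) f ≡ ∑₁ m f + ∑₁ n (λ i → f (i ℕ.+ m))
  ∑₁-+ m zero    f = sym (ℚ.+-identityʳ (∑₁ m f))
  ∑₁-+ m (suc n) f = trans (cong (_+ f (suc n ℕ.+ m)) (∑₁-+ m n f))
    (ℚ.+-assoc (∑₁ m f) (∑₁ n (λ i → f (i ℕ.+ m))) (f (suc n ℕ.+ m)))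

  -- A sum over n blocks of length m; block k + 1 is k·m + 1, …, k·m + m.
  ∑₁-* : ∀ m n f → ∑₁ (n ℕ.* m) f ≡ ∑₁ n (λ k → ∑₁ m (λ i → f (i ℕ.+ ℕ.pred k ℕ.* m)))
  ∑₁-* m zero    f = refl
  ∑₁-* m (suc n) f = trans (∑₁-+ (n ℕ.* m) m f) (cong (_+ ∑₁ m (λ i → f (i ℕ.+ n ℕ.* m))) (∑₁-* m n f))

  -- a/A − b/B = (a B − b A)/(A B)
  quotient-close : ∀ {A B a b} → 1ℚ ≤ℚ A → 1ℚ ≤ℚ B →
                   ∣ a * A ⁻¹ - b * B ⁻¹ ∣ ≤ℚ ∣ a * B - b * A ∣
  quotient-close {A} {B} {a} {b} 1≤A 1≤B = begin
      ∣ a * U - b * V ∣                       ≡⟨ cong ∣_∣ (one (a * U) (b * V)) ⟩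
      ∣ a * U * 1ℚ - b * V * 1ℚ ∣             ≡⟨ cong₂ (λ s t → ∣ a * U * s - b * V * t ∣) (sym (⁻¹-inverseʳ 0<B)) (sym (⁻¹-inverseʳ 0<A)) ⟩
      ∣ a * U * (B * V) - b * V * (A * U) ∣   ≡⟨ cong ∣_∣ (lem a b A B U V) ⟩
      ∣ (a * B - b * A) * (U * V) ∣           ≡⟨ ℚ.∣p*q∣≡∣p∣*∣q∣ (a * B - b * A) (U * V) ⟩
      ∣ a * B - b * A ∣ * ∣ U * V ∣           ≡⟨ cong (∣ a * B - b * A ∣ *_) (ℚ.0≤p⇒∣p∣≡p {U * V} (*-nonNeg {U} {V} 0≤U 0≤V)) ⟩
      ∣ a * B - b * A ∣ * (U * V)             ≤⟨ *-monoˡ {∣ a * B - b * A ∣} {U * V} {1ℚ} (ℚ.0≤∣p∣ (a * B - b * A)) (*-mono {U} {1ℚ} {V} {1ℚ} 0≤U 0≤1 (⁻¹≤1 1≤A) (⁻¹≤1 1≤B)) ⟩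
      ∣ a * B - b * A ∣ * 1ℚ                  ≡⟨ ℚ.*-identityʳ _ ⟩
      ∣ a * B - b * A ∣                       ∎
    where
    U V : ℚ
    U = A ⁻¹
    V = B ⁻¹
    0<A : 0ℚ <ℚ A
    0<A = ℚ.<-≤-trans (ℚ.positive⁻¹ 1ℚ) 1≤A
    0<B : 0ℚ <ℚ B
    0<B = ℚ.<-≤-trans (ℚ.positive⁻¹ 1ℚ) 1≤B
    0≤U : 0ℚ ≤ℚ U
    0≤U = ℚ.<⇒≤ (⁻¹-pos 0<A)
    0≤V : 0ℚ ≤ℚ V
    0≤V = ℚ.<⇒≤ (⁻¹-pos 0<B)
    lem : ∀ a b A B U V → a * U * (B * V) - b * V * (A * U) ≡ (a * B - b * A) * (U * V)
    lem = solve-∀ ring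
    one : ∀ p q → p - q ≡ p * 1ℚ - q * 1ℚ
    one = solve-∀ ring

  1≤1+ι* : ∀ k {h} → 0ℚ ≤ℚ h → 1ℚ ≤ℚ 1ℚ + ι k * h
  1≤1+ι* k {h} 0≤h = p≤p+q {1ℚ} {ι k * h} (*-nonNeg {ι k} {h} (0≤ι k) 0≤h)

  scale : ∀ n t → ι (suc n) * (t * ι (suc n) ⁻¹) ≡ t
  scale n t = begin-equality
    ι (suc n) * (t * ι (suc n) ⁻¹)  ≡⟨ lem (ι (suc n)) t (ι (suc n) ⁻¹) ⟩
    t * (ι (suc n) * ι (suc n) ⁻¹)  ≡⟨ cong (t *_) (⁻¹-inverseʳ (0<ι-suc n)) ⟩
    t * 1ℚ                          ≡⟨ ℚ.*-identityʳ t ⟩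
    t                               ∎
    where
    lem : ∀ n t u → n * (t * u) ≡ t * (n * u)
    lem = solve-∀ ring

  step-nonNeg : ∀ n {t} → 0ℚ ≤ℚ t → 0ℚ ≤ℚ t * ι (suc n) ⁻¹
  step-nonNeg n {t} 0≤t = *-nonNeg {t} {ι (suc n) ⁻¹} 0≤t (ℚ.<⇒≤ (⁻¹-pos (0<ι-suc n)))

  riemann-lipschitz : ∀ n {s t} → 0ℚ ≤ℚ s → 0ℚ ≤ℚ t →
                      ∣ riemann (suc n) s - riemann (suc n) t ∣ ≤ℚ ∣ s - t ∣
  riemann-lipschitz n {s} {t} 0≤s 0≤t = begin
      ∣ riemann (suc n) s - riemann (suc n) t ∣   ≤⟨ ∑₁-close (suc n) {riemannTerm g} {riemannTerm h} {∣ g - h ∣} (λ k _ → term (suc k)) ⟩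
      ι (suc n) * ∣ g - h ∣                       ≡⟨ cong (_* ∣ g - h ∣) (sym (ℚ.0≤p⇒∣p∣≡p (0≤ι (suc n)))) ⟩
      ∣ ι (suc n) ∣ * ∣ g - h ∣                   ≡⟨ sym (ℚ.∣p*q∣≡∣p∣*∣q∣ (ι (suc n)) (g - h)) ⟩
      ∣ ι (suc n) * (g - h) ∣                     ≡⟨ cong ∣_∣ (lem′ (ι (suc n)) g h) ⟩
      ∣ ι (suc n) * g - ι (suc n) * h ∣           ≡⟨ cong₂ (λ p q → ∣ p - q ∣) (scale n s) (scale n t) ⟩
      ∣ s - t ∣                                   ∎
    where
    g h : ℚ
    g = s * ι (suc n) ⁻¹
    h = t * ι (suc n) ⁻¹
    lem : ∀ k g h → g * (1ℚ + k * h) - h * (1ℚ + k * g) ≡ g - h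
    lem = solve-∀ ring
    lem′ : ∀ n g h → n * (g - h) ≡ n * g - n * h
    lem′ = solve-∀ ring
    term : ∀ k → ∣ riemannTerm g k - riemannTerm h k ∣ ≤ℚ ∣ g - h ∣
    term k = subst (λ d → ∣ riemannTerm g k - riemannTerm h k ∣ ≤ℚ ∣ d ∣) (lem (ι k) g h)
      (quotient-close {1ℚ + ι k * g} {1ℚ + ι k * h} {g} {h} (1≤1+ι* k (step-nonNeg n 0≤s)) (1≤1+ι* k (step-nonNeg n 0≤t)))

  riemann-refine : ∀ m n {t} → 0ℚ ≤ℚ t →
                   ∣ riemann (suc n ℕ.* suc m) t - riemann (suc n) t ∣ ≤ℚ (t * t) * ι (suc n) ⁻¹
  riemann-refine m′ n′ {t} 0≤t = begin
      ∣ riemann (n ℕ.* m) t - riemann n t ∣   ≡⟨ cong (λ p → ∣ p - riemann n t ∣) (∑₁-* m n fine) ⟩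
      ∣ ∑₁ n blocks - riemann n t ∣           ≤⟨ ∑₁-close n {blocks} {coarse} {ι m * (ι m * (d * d))} blockClose ⟩
      ι n * (ι m * (ι m * (d * d)))           ≡⟨ lem₁ (ι n) (ι m) d ⟩
      ι n * ((ι m * d) * (ι m * d))           ≡⟨ cong (λ p → ι n * (p * p)) (sym h≡md) ⟩
      ι n * (h * h)                           ≡⟨ lem₂ (ι n) t (ι n ⁻¹) ⟩
      (ι n * h) * (t * ι n ⁻¹)                ≡⟨ cong (_* (t * ι n ⁻¹)) (scale n′ t) ⟩
      t * (t * ι n ⁻¹)                        ≡⟨ sym (ℚ.*-assoc t t (ι n ⁻¹)) ⟩
      (t * t) * ι n ⁻¹                        ∎
    where
    m n : ℕ
    m = suc m′
    n = suc n′
    h d : ℚ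
    h = t * ι n ⁻¹
    d = t * ι (n ℕ.* m) ⁻¹
    0≤d : 0ℚ ≤ℚ d
    0≤d = step-nonNeg (m′ ℕ.+ n′ ℕ.* m) 0≤t
    0≤h : 0ℚ ≤ℚ h
    0≤h = step-nonNeg n′ 0≤t
    fine coarse blocks : ℕ → ℚ
    fine   = riemannTerm d
    coarse = riemannTerm h
    blocks k = ∑₁ m (λ i → fine (i ℕ.+ ℕ.pred k ℕ.* m))
    lem₁ : ∀ n m d → n * (m * (m * (d * d))) ≡ n * ((m * d) * (m * d))
    lem₁ = solve-∀ ring
    lem₂ : ∀ n t u → n * ((t * u) * (t * u)) ≡ (n * (t * u)) * (t * u)
    lem₂ = solve-∀ ring
    h≡md : h ≡ ι m * d
    h≡md = begin-equality
      t * ι n ⁻¹                          ≡⟨ cong (_* ι n ⁻¹) (sym (scale (m′ ℕ.+ n′ ℕ.* m) t)) ⟩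
      ι (n ℕ.* m) * d * ι n ⁻¹            ≡⟨ cong (λ p → p * d * ι n ⁻¹) (ι-hom-* n m) ⟩
      ι n * ι m * d * ι n ⁻¹              ≡⟨ lem (ι n) (ι m) d (ι n ⁻¹) ⟩
      ι m * d * (ι n * ι n ⁻¹)            ≡⟨ cong (ι m * d *_) (⁻¹-inverseʳ (0<ι-suc n′)) ⟩
      ι m * d * 1ℚ                        ≡⟨ ℚ.*-identityʳ (ι m * d) ⟩
      ι m * d                             ∎
      where
      lem : ∀ n m d u → n * m * d * u ≡ m * d * (n * u)
      lem = solve-∀ ring
    coarse-split : ∀ k → coarse k ≡ ∑₁ m (λ _ → d * (1ℚ + ι k * h) ⁻¹)
    coarse-split k = begin-equality
      h * (1ℚ + ι k * h) ⁻¹               ≡⟨ cong (_* (1ℚ + ι k * h) ⁻¹) h≡md ⟩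
      ι m * d * (1ℚ + ι k * h) ⁻¹         ≡⟨ ℚ.*-assoc (ι m) d ((1ℚ + ι k * h) ⁻¹) ⟩
      ι m * (d * (1ℚ + ι k * h) ⁻¹)       ≡⟨ sym (∑₁-const m (d * (1ℚ + ι k * h) ⁻¹)) ⟩
      ∑₁ m (λ _ → d * (1ℚ + ι k * h) ⁻¹)  ∎
    ∣ι-ι∣≤ : ∀ i → i ℕ.≤ m → ∣ ι m - ι i ∣ ≤ℚ ι m
    ∣ι-ι∣≤ i i≤m = ∣p-q∣≤ {ι m} {ι i} {ι m}
      (subst (ι m ≤ℚ_) (ℚ.+-comm (ι m) (ι i)) (p≤p+q {ι m} {ι i} (0≤ι i)))
      (ℚ.≤-trans {ι i} {ι m} {ι m + ι m} (ι-mono i≤m) (p≤p+q {ι m} {ι m} (0≤ι m)))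
    term : ∀ k i → i ℕ.≤ m →
           ∣ fine (i ℕ.+ k ℕ.* m) - d * (1ℚ + ι (suc k) * h) ⁻¹ ∣ ≤ℚ ι m * (d * d)
    term k i i≤m = begin
      ∣ fine j - d * (1ℚ + ι (suc k) * h) ⁻¹ ∣
        ≤⟨ quotient-close {1ℚ + ι j * d} {1ℚ + ι (suc k) * h} {d} {d} (1≤1+ι* j 0≤d) (1≤1+ι* (suc k) 0≤h) ⟩
      ∣ d * (1ℚ + ι (suc k) * h) - d * (1ℚ + ι j * d) ∣
        ≡⟨ cong₂ (λ p q → ∣ d * (1ℚ + p) - d * (1ℚ + q * d) ∣)
                 (cong₂ _*_ (ι-suc k) h≡md)
                 (trans (ι-hom-+ i (k ℕ.* m)) (cong (λ q → ι i + q) (ι-hom-* k m))) ⟩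
      ∣ d * (1ℚ + (ι k + 1ℚ) * (ι m * d)) - d * (1ℚ + (ι i + ι k * ι m) * d) ∣
        ≡⟨ cong ∣_∣ (lem d (ι k) (ι m) (ι i)) ⟩
      ∣ (ι m - ι i) * (d * d) ∣
        ≡⟨ ℚ.∣p*q∣≡∣p∣*∣q∣ (ι m - ι i) (d * d) ⟩
      ∣ ι m - ι i ∣ * ∣ d * d ∣
        ≡⟨ cong (∣ ι m - ι i ∣ *_) (ℚ.0≤p⇒∣p∣≡p {d * d} (*-nonNeg {d} {d} 0≤d 0≤d)) ⟩
      ∣ ι m - ι i ∣ * (d * d)
        ≤⟨ *-monoʳ {d * d} {∣ ι m - ι i ∣} {ι m} (*-nonNeg {d} {d} 0≤d 0≤d) (∣ι-ι∣≤ i i≤m) ⟩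
      ι m * (d * d) ∎
      where
      j : ℕ
      j = i ℕ.+ k ℕ.* m
      lem : ∀ d k m i → d * (1ℚ + (k + 1ℚ) * (m * d)) - d * (1ℚ + (i + k * m) * d) ≡ (m - i) * (d * d)
      lem = solve-∀ ring
    blockClose : ∀ k → k ℕ.< n → ∣ blocks (suc k) - coarse (suc k) ∣ ≤ℚ ι m * (ι m * (d * d))
    blockClose k _ = subst (λ c → ∣ blocks (suc k) - c ∣ ≤ℚ ι m * (ι m * (d * d))) (sym (coarse-split (suc k)))
      (∑₁-close m {λ i → fine (i ℕ.+ k ℕ.* m)} {λ _ → d * (1ℚ + ι (suc k) * h) ⁻¹} {ι m * (d * d)} (λ i i<m → term k (suc i) i<m))

  riemann-close : ∀ m n {t} → 0ℚ ≤ℚ t →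
                  ∣ riemann (suc m) t - riemann (suc n) t ∣ ≤ℚ
                  (t * t) * ι (suc m) ⁻¹ + (t * t) * ι (suc n) ⁻¹
  riemann-close m n {t} 0≤t = begin
    ∣ riemann (suc m) t - riemann (suc n) t ∣
      ≤⟨ triangle (riemann (suc m) t) (riemann (suc m ℕ.* suc n) t) (riemann (suc n) t) ⟩
    ∣ riemann (suc m) t - riemann (suc m ℕ.* suc n) t ∣ + ∣ riemann (suc m ℕ.* suc n) t - riemann (suc n) t ∣
      ≤⟨ ℚ.+-mono-≤
           {∣ riemann (suc m) t - riemann (suc m ℕ.* suc n) t ∣} {(t * t) * ι (suc m) ⁻¹}
           {∣ riemann (suc m ℕ.* suc n) t - riemann (suc n) t ∣} {(t * t) * ι (suc n) ⁻¹}
           (subst (_≤ℚ (t * t) * ι (suc m) ⁻¹) (∣p-q∣≡∣q-p∣ (riemann (suc m ℕ.* suc n) t) (riemann (suc m) t)) (riemann-refine n m 0≤t))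
           (subst (λ N → ∣ riemann N t - riemann (suc n) t ∣ ≤ℚ (t * t) * ι (suc n) ⁻¹) (ℕ.*-comm (suc n) (suc m)) (riemann-refine m n 0≤t)) ⟩
    (t * t) * ι (suc m) ⁻¹ + (t * t) * ι (suc n) ⁻¹ ∎

  excess : ℚ → ℚ
  excess q = (1ℚ ⊔ q) - 1ℚ

  0≤excess : ∀ q → 0ℚ ≤ℚ excess q
  0≤excess q = ℚ.+-monoˡ-≤ (- 1ℚ) (ℚ.p≤p⊔q 1ℚ q)

  excess-lipschitz : ∀ p q → ∣ excess p - excess q ∣ ≤ℚ ∣ p - q ∣
  excess-lipschitz p q = subst (λ d → ∣ d ∣ ≤ℚ ∣ p - q ∣) (lem (1ℚ ⊔ p) (1ℚ ⊔ q)) (⊔-lipschitz 1ℚ p q)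
    where
    lem : ∀ p q → p - q ≡ (p - 1ℚ) - (q - 1ℚ)
    lem = solve-∀ ring

  excess≤ : ∀ {q B} → 1ℚ ≤ℚ B → ∣ q ∣ ≤ℚ B → excess q ≤ℚ B
  excess≤ {q} {B} 1≤B ∣q∣≤B = p≤q+r⇒p-q≤r {1ℚ ⊔ q} {1ℚ} {B}
    (subst (1ℚ ⊔ q ≤ℚ_) (ℚ.+-comm B 1ℚ)
      (ℚ.≤-trans (ℚ.⊔-lub 1≤B (ℚ.≤-trans (p≤∣p∣ q) ∣q∣≤B)) (p≤p+q {B} {1ℚ} 0≤1)))

  small-square : ∀ k {t B ε} → 0ℚ ≤ℚ t → t ≤ℚ B → (B * B) * ι (suc k) ⁻¹ ≤ℚ ε →
                 (t * t) * ι (suc k) ⁻¹ ≤ℚ ε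
  small-square k {t} {B} 0≤t t≤B = ℚ.≤-trans
    (*-monoʳ {ι (suc k) ⁻¹} {t * t} {B * B} (ℚ.<⇒≤ (⁻¹-pos (0<ι-suc k)))
      (*-mono {t} {B} {t} {B} 0≤t (ℚ.≤-trans 0≤t t≤B) t≤B t≤B))

  log-close : ∀ m n {p q B ε} → 1ℚ ≤ℚ B → ∣ q ∣ ≤ℚ B → ∣ p - q ∣ ≤ℚ ½ * ε →
              (B * B) * ι (suc m) ⁻¹ ≤ℚ ½ * (½ * ε) → (B * B) * ι (suc n) ⁻¹ ≤ℚ ½ * (½ * ε) →
              ∣ riemann (suc m) (excess p) - riemann (suc n) (excess q) ∣ ≤ℚ ε
  log-close m n {p} {q} {B} {ε} 1≤B q≤B pq m-small n-small = begin
      ∣ riemann (suc m) s - riemann (suc n) t ∣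
        ≤⟨ triangle (riemann (suc m) s) (riemann (suc m) t) (riemann (suc n) t) ⟩
      ∣ riemann (suc m) s - riemann (suc m) t ∣ + ∣ riemann (suc m) t - riemann (suc n) t ∣
        ≤⟨ ℚ.+-mono-≤
             {∣ riemann (suc m) s - riemann (suc m) t ∣} {½ * ε}
             {∣ riemann (suc m) t - riemann (suc n) t ∣} {½ * (½ * ε) + ½ * (½ * ε)}
             (ℚ.≤-trans (riemann-lipschitz m {s} {t} (0≤excess p) 0≤t)
               (ℚ.≤-trans (excess-lipschitz p q) pq))
             (ℚ.≤-trans (riemann-close m n {t} 0≤t)
               (ℚ.+-mono-≤
                 {(t * t) * ι (suc m) ⁻¹} {½ * (½ * ε)} {(t * t) * ι (suc n) ⁻¹} {½ * (½ * ε)}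
                 (small-square m {t} {B} 0≤t t≤B m-small)
                 (small-square n {t} {B} 0≤t t≤B n-small))) ⟩
      ½ * ε + (½ * (½ * ε) + ½ * (½ * ε))
        ≡⟨ cong (λ u → ½ * ε + u) (half (½ * ε)) ⟩
      ½ * ε + ½ * ε
        ≡⟨ half ε ⟩
      ε ∎
    where
    s t : ℚ
    s = excess p
    t = excess q
    0≤t : 0ℚ ≤ℚ t
    0≤t = 0≤excess q
    t≤B : t ≤ℚ B
    t≤B = excess≤ {q} {B} 1≤B q≤B

  log-cauchy : ∀ x ε → 0ℚ <ℚ ε → ∃[ N ] (∀ m n → N ℕ.≤ m → N ℕ.≤ n →
               ∣ riemann (suc m) (excess (seq x m)) - riemann (suc n) (excess (seq x n)) ∣ ≤ℚ ε)
  log-cauchy x ε 0<ε =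
    let B , 1≤B , K , bound = eventuallyBounded x
        0≤B = ℚ.≤-trans 0≤1 1≤B
        M , close = cauchy x (½ * ε) (half-pos 0<ε)
        N , small = vanishes {B * B} {½ * (½ * ε)} (*-nonNeg {B} {B} 0≤B 0≤B)
                      (half-pos {½ * ε} (half-pos 0<ε))
    in K ℕ.⊔ (M ℕ.⊔ N) , λ m n m≥ n≥ →
      let m≥MN = ℕ.m⊔n≤o⇒n≤o K (M ℕ.⊔ N) m≥
          n≥MN = ℕ.m⊔n≤o⇒n≤o K (M ℕ.⊔ N) n≥
      in log-close m n {seq x m} {seq x n} {B} {ε} 1≤B
           (bound n (ℕ.m⊔n≤o⇒m≤o K (M ℕ.⊔ N) n≥))
           (close m n (ℕ.m⊔n≤o⇒m≤o M N m≥MN) (ℕ.m⊔n≤o⇒m≤o M N n≥MN))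
           (small m (ℕ.m⊔n≤o⇒n≤o M N m≥MN))
           (small n (ℕ.m⊔n≤o⇒n≤o M N n≥MN))

infixl 6 _+_ _-_
infixl 7 _*_
infixr 8 _^_
infix  8 -_

_+_ : ℝ → ℝ → ℝ
x + y = mkℝ (λ n → seq x n ℚ.+ seq y n) (Real.+-cauchy x y)

-_ : ℝ → ℝ
- x = mkℝ (λ n → ℚ.- seq x n) (Real.neg-cauchy x)

_-_ : ℝ → ℝ → ℝ
x - y = x + (- y)

_*_ : ℝ → ℝ → ℝ
x * y = mkℝ (λ n → seq x n ℚ.* seq y n) (Real.*-cauchy x y)

_^_ : ℝ → ℕ → ℝ
x ^ zero  = fromℚ 1ℚ
x ^ suc n = x * x ^ n

∣_∣ : ℝ → ℝ
∣ x ∣ = mkℝ (λ n → ℚ.∣ seq x n ∣) (Real.abs-cauchy x)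

ConvergesTo : (ℕ → ℝ) → ℝ → Set
ConvergesTo a l = ∀ ε → 0ℚ ℚ.< ε → ∃[ N ] (∀ n → N ℕ.≤ n → ∣ a n - l ∣ ≤ fromℚ ε)

-- The floor of a real is not computable, hence a relation rather than a function.
IsFloor : ℝ → ℕ → Set
IsFloor x N = fromℕ N ≤ x × x < fromℕ (suc N)

-- log x = ∫₁ˣ du/u for x ≥ 1; the clamp makes it total, with value 0 for x ≤ 1.
log : ℝ → ℝ
log x = mkℝ (λ n → riemann (suc n) ((1ℚ ℚ.⊔ seq x n) ℚ.- 1ℚ)) (Log.log-cauchy x)

eulerProduct : ∀ {r} → Vector ℤ r → ℕ → ℚ
eulerProduct e n = ∏ (primesUpTo n) (eulerFactor e)

-- The infinite product is the limit of its partial products over p ≤ n.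
Is𝔖 : ∀ {r} → Vector ℤ r → ℝ → Set
Is𝔖 e = ConvergesTo λ n → fromℚ (eulerProduct e n)

{-# OPTIONS --safe #-}
module Submission where

-- Write J_e(n) = ∏_{p ∣ n} g(p), so J_e = 1 ⋆ ∏ (1 + h(p) p⁻ˢ) with h(p) = g(p) − 1,
-- |h(p)| ≤ |e₁|/p + K/p².  Adjoining one prime at a time, the error in
-- ∑_{n ≤ N/d} J_e(n) ≈ (N/d) ∏ (1 + h(p)/p) is at most ∑ |h(m)| min(1 , N/(d m)) over
-- squarefree m.  Replacing |h| by |e₁| convolved copies of 1/n and K copies of 1/n², each copy
-- of 1/n costs a factor 2 H_N and each copy of 1/n² a factor 2, uniformly in the set of primes.
-- No estimate for primes is needed.  The case N = 1 bounds the partial Euler products, and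
-- H_N ≪ log N.

open import Defs hiding (_≤_; _<_; _+_; _-_; _*_; -_; ∣_∣; _^_)
open import Data.Fin.Base using (Fin; toℕ)
import Data.Fin.Base as Fin
open import Data.Integer.Base as ℤ using (ℤ; 0ℤ; +_; -[1+_]) renaming (∣_∣ to ∣_∣ℤ)
import Data.Integer.Properties as ℤ
open import Data.List.Base using ([]; _∷_; _++_; filter; upTo)
import Data.List.Properties as List
open import Data.Nat.Base as ℕ using (ℕ; zero; suc)
open import Data.Nat.Divisibility using (_∣_; _∣?_; divides; quotient; ∣1⇒≡1; ∣⇒≤)
import Data.Nat.Divisibility as ℕ
import Data.Nat.DivMod as ℕ
open import Data.Nat.Primality using (Prime; prime?; prime⇒nonTrivial; euclidsLemma; prime⇒irreducible; ¬prime[1])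
import Data.Nat.Properties as ℕ
open import Data.Product.Base using (_×_; _,_; proj₁; proj₂; ∃-syntax)
open import Data.Rational.Base as ℚ using (ℚ; 0ℚ; 1ℚ; ½)
import Data.Rational.Properties as ℚ
open import Data.Sum.Base using (inj₁; inj₂; [_,_]′)
open import Algebra.Bundles using (CommutativeRing)
import Algebra.Properties.CommutativeSemiring.Exp as CommutativeSemiringExp
open import Algebra.Definitions.RawMonoid ℤ.+-0-rawMonoid using () renaming (sum to sumℤ)
open import Algebra.Definitions.RawSemiring ℚ.+-*-rawSemiring using ()
  renaming (product to productℚ; _^_ to _^ℚ_)
open import Data.Vec.Functional using (Vector; head)
open import Function.Base using (_∘_)
open import Relation.Binary.PropositionalEquality
  using (_≡_; _≢_; refl; sym; trans; cong; cong₂; subst; subst₂)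
open import Relation.Nullary.Decidable using (Dec; yes; no)
open import Relation.Nullary.Negation using (¬_; contradiction)
open import Tactic.RingSolver using (solve-∀)

-- No limit of the sieve is ever taken. The real 𝔖 is the sequence of partial products P(k) itself,
-- so the inequality between reals is checked index by index with P(k) in place of 𝔖, and the error
-- bound must not depend on k. The sieve up to k involves squarefree m far beyond N, so the floor
-- errors need both parts of min(1 , N/d): the bound 1 alone gives a total that in general grows
-- with k, the bound N/d alone a multiple of N. The parameter d is forced because adjoining q
-- replaces ⌊N/d⌋ by ⌊N/(d q)⌋. The cutoff min(1 , N/d) is chosen because convolution with 1/n or
-- 1/n² returns it up to a factor, so that repeated convolutions merely multiply factors. Only the
-- copies of 1/n cost a logarithm: the coefficient of 1/p must therefore be exactly |e₁|, while that
-- of 1/p² may be rounded up to any integer. The absolute value arises because 1 - 1/p and its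
-- inverse deviate from 1 by the same leading amount 1/p. Finally x ≥ 2 keeps H_N ≥ 3/2, which
-- leaves room to absorb the gap between H_N and log x.

-- Ordered-field arithmetic, inverses and reciprocals of naturals

module Arithmetic where
  open import Data.Rational.Base using (_+_; _*_; -_; _-_; _≤_; _<_)
  open Rational
  open ℚ.≤-Reasoning

  ≤-from : ∀ {p q} d → 0ℚ ≤ d → p + d ≡ q → p ≤ q
  ≤-from {p} d 0≤d refl = p≤p+q {p} {d} 0≤d

  0≤-from : ∀ {p q} → p ≤ q → 0ℚ ≤ q - p
  0≤-from {p} {q} p≤q = subst (_≤ q - p) (ℚ.+-inverseʳ p) (ℚ.+-monoˡ-≤ (- p) p≤q)

  +-nonNeg : ∀ {p q} → 0ℚ ≤ p → 0ℚ ≤ q → 0ℚ ≤ p + q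
  +-nonNeg {p} {q} 0≤p 0≤q = ℚ.≤-trans 0≤p (p≤p+q {p} {q} 0≤q)

  ⁻¹-nonNeg : ∀ {p} → 0ℚ < p → 0ℚ ≤ p ⁻¹
  ⁻¹-nonNeg 0<p = ℚ.<⇒≤ (⁻¹-pos 0<p)

  0<1 : 0ℚ < 1ℚ
  0<1 = ℚ.positive⁻¹ 1ℚ

  ⁻¹-unique : ∀ {p q} → p * q ≡ 1ℚ → q ≡ p ⁻¹
  ⁻¹-unique {p} {q} pq≡1 with p ℚ.≟ 0ℚ
  ... | yes refl = contradiction (trans (sym (ℚ.*-zeroˡ q)) pq≡1) λ ()
  ... | no p≢0   = begin-equality
    q                ≡⟨ sym (ℚ.*-identityʳ q) ⟩
    q * 1ℚ           ≡⟨ cong (q *_) (sym (ℚ.*-inverseʳ p)) ⟩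
    q * (p * ℚ.1/ p) ≡⟨ lem p q (ℚ.1/ p) ⟩
    p * q * ℚ.1/ p   ≡⟨ cong (_* ℚ.1/ p) pq≡1 ⟩
    1ℚ * ℚ.1/ p      ≡⟨ ℚ.*-identityˡ (ℚ.1/ p) ⟩
    ℚ.1/ p           ∎
    where
    instance
      p-nonZero : ℚ.NonZero p
      p-nonZero = ℚ.≢-nonZero p≢0
    lem : ∀ p q i → q * (p * i) ≡ p * q * i
    lem = solve-∀ ring

  ⁻¹-inverseʳ-≢0 : ∀ {p} → p ≢ 0ℚ → p * p ⁻¹ ≡ 1ℚ
  ⁻¹-inverseʳ-≢0 {p} p≢0 with p ℚ.≟ 0ℚ
  ... | yes p≡0 = contradiction p≡0 p≢0
  ... | no p≢0′ = ℚ.*-inverseʳ p {{ℚ.≢-nonZero p≢0′}}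

  -- The convention 0⁻¹ = 0 covers the degenerate cases; this makes integer powers multiplicative in
  -- the base.
  ⁻¹-distrib-* : ∀ p q → (p * q) ⁻¹ ≡ p ⁻¹ * q ⁻¹
  ⁻¹-distrib-* p q = cases (p ℚ.≟ 0ℚ) (q ℚ.≟ 0ℚ)
    where
    lem : ∀ p q i j → p * q * (i * j) ≡ (p * i) * (q * j)
    lem = solve-∀ ring
    cases : Dec (p ≡ 0ℚ) → Dec (q ≡ 0ℚ) → (p * q) ⁻¹ ≡ p ⁻¹ * q ⁻¹
    cases (yes refl) _          = trans (cong _⁻¹ (ℚ.*-zeroˡ q)) (sym (ℚ.*-zeroˡ (q ⁻¹)))
    cases (no _)     (yes refl) = trans (cong _⁻¹ (ℚ.*-zeroʳ p)) (sym (ℚ.*-zeroʳ (p ⁻¹)))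
    cases (no p≢0)   (no q≢0)   = sym (⁻¹-unique {p * q} {p ⁻¹ * q ⁻¹} (trans (lem p q (p ⁻¹) (q ⁻¹))
      (cong₂ _*_ (⁻¹-inverseʳ-≢0 p≢0) (⁻¹-inverseʳ-≢0 q≢0))))

  ⁻¹-antitone : ∀ {p q} → 0ℚ < p → p ≤ q → q ⁻¹ ≤ p ⁻¹
  ⁻¹-antitone {p} {q} 0<p p≤q = begin
    q ⁻¹                    ≡⟨ sym (ℚ.*-identityˡ (q ⁻¹)) ⟩
    1ℚ * q ⁻¹               ≡⟨ cong (_* q ⁻¹) (sym (⁻¹-inverseʳ 0<p)) ⟩
    p * p ⁻¹ * q ⁻¹         ≡⟨ ℚ.*-assoc p (p ⁻¹) (q ⁻¹) ⟩
    p * (p ⁻¹ * q ⁻¹)       ≤⟨ *-monoʳ {p ⁻¹ * q ⁻¹} {p} {q} (*-nonNeg {p ⁻¹} {q ⁻¹} (⁻¹-nonNeg 0<p) (⁻¹-nonNeg 0<q)) p≤q ⟩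
    q * (p ⁻¹ * q ⁻¹)       ≡⟨ lem q (p ⁻¹) (q ⁻¹) ⟩
    q * q ⁻¹ * p ⁻¹         ≡⟨ cong (_* p ⁻¹) (⁻¹-inverseʳ 0<q) ⟩
    1ℚ * p ⁻¹               ≡⟨ ℚ.*-identityˡ (p ⁻¹) ⟩
    p ⁻¹                    ∎
    where
    0<q : 0ℚ < q
    0<q = ℚ.<-≤-trans 0<p p≤q
    lem : ∀ q i j → q * (i * j) ≡ q * j * i
    lem = solve-∀ ring

  0<ι : ∀ n .{{_ : ℕ.NonZero n}} → 0ℚ < ι n
  0<ι (suc n) = 0<ι-suc n

  recip : ℕ → ℚ
  recip n = ι n ⁻¹

  recip-nonNeg : ∀ n → 0ℚ ≤ recip n
  recip-nonNeg zero    = ℚ.≤-refl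
  recip-nonNeg (suc n) = ⁻¹-nonNeg (0<ι-suc n)

  recip≤1 : ∀ n → recip n ≤ 1ℚ
  recip≤1 zero    = 0≤1
  recip≤1 (suc n) = ⁻¹≤1 (1≤ι-suc n)

  recip-inverse : ∀ n .{{_ : ℕ.NonZero n}} → ι n * recip n ≡ 1ℚ
  recip-inverse (suc n) = ⁻¹-inverseʳ (0<ι-suc n)

  recip-* : ∀ m n → recip (m ℕ.* n) ≡ recip m * recip n
  recip-* m n = trans (cong _⁻¹ (ι-hom-* m n)) (⁻¹-distrib-* (ι m) (ι n))

  recip-antitone : ∀ {m n} .{{_ : ℕ.NonZero m}} → m ℕ.≤ n → recip n ≤ recip m
  recip-antitone {m} m≤n = ⁻¹-antitone (0<ι m) (ι-mono m≤n)

  square-nonNeg : ∀ n → 0ℚ ≤ recip n * recip n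
  square-nonNeg n = *-nonNeg {recip n} {recip n} (recip-nonNeg n) (recip-nonNeg n)

  -- 1/(n+1)² ≤ 1/(n(n+1)) = 1/n − 1/(n+1)
  square-telescope : ∀ n .{{_ : ℕ.NonZero n}} →
                     recip (suc n) * recip (suc n) + recip (suc n) ≤ recip n
  square-telescope n = begin
    s * s + s            ≤⟨ ℚ.+-monoˡ-≤ s (*-monoʳ {s} {s} {r} (recip-nonNeg (suc n)) (recip-antitone {n} (ℕ.n≤1+n n))) ⟩
    r * s + s            ≡⟨ cong (λ u → r * s + u) (trans (sym (ℚ.*-identityˡ s)) (cong (_* s) (sym (recip-inverse n)))) ⟩
    r * s + ι n * r * s  ≡⟨ lem r s (ι n) ⟩
    r * ((ι n + 1ℚ) * s) ≡⟨ cong (λ u → r * (u * s)) (sym (ι-suc n)) ⟩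
    r * (ι (suc n) * s)  ≡⟨ cong (r *_) (recip-inverse (suc n)) ⟩
    r * 1ℚ               ≡⟨ ℚ.*-identityʳ r ⟩
    r                    ∎
    where
    r s : ℚ
    r = recip n
    s = recip (suc n)
    lem : ∀ r s n → r * s + n * r * s ≡ r * ((n + 1ℚ) * s)
    lem = solve-∀ ring

-- Finite sums, dilation by an integer, and sums of 1/n²

module Sums where
  open import Data.Rational.Base using (_+_; _*_; _≤_; _<_; ∣_∣)
  open Rational
  open Arithmetic
  open ℚ.≤-Reasoning

  ∑₁-mono : ∀ n {f g} → (∀ k → k ℕ.< n → f (suc k) ≤ g (suc k)) → ∑₁ n f ≤ ∑₁ n g
  ∑₁-mono zero    f≤g = ℚ.≤-refl
  ∑₁-mono (suc n) f≤g = ℚ.+-mono-≤ (∑₁-mono n λ k k<n → f≤g k (ℕ.m<n⇒m<1+n k<n)) (f≤g n ℕ.≤-refl)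

  ∑₁-ext : ∀ n {f g} → (∀ k → k ℕ.< n → f (suc k) ≡ g (suc k)) → ∑₁ n f ≡ ∑₁ n g
  ∑₁-ext zero    f≡g = refl
  ∑₁-ext (suc n) f≡g = cong₂ _+_ (∑₁-ext n λ k k<n → f≡g k (ℕ.m<n⇒m<1+n k<n)) (f≡g n ℕ.≤-refl)

  ∑₁-distrib-+ : ∀ n f g → ∑₁ n (λ k → f k + g k) ≡ ∑₁ n f + ∑₁ n g
  ∑₁-distrib-+ zero    f g = refl
  ∑₁-distrib-+ (suc n) f g = trans (cong (_+ (f (suc n) + g (suc n))) (∑₁-distrib-+ n f g))
    (lem (∑₁ n f) (∑₁ n g) (f (suc n)) (g (suc n)))
    where
    lem : ∀ a b c d → (a + b) + (c + d) ≡ (a + c) + (b + d)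
    lem = solve-∀ ring

  ∑₁-distribˡ-* : ∀ n c f → ∑₁ n (λ k → c * f k) ≡ c * ∑₁ n f
  ∑₁-distribˡ-* zero    c f = sym (ℚ.*-zeroʳ c)
  ∑₁-distribˡ-* (suc n) c f = trans (cong (_+ c * f (suc n)) (∑₁-distribˡ-* n c f))
    (sym (ℚ.*-distribˡ-+ c (∑₁ n f) (f (suc n))))

  ∑₁-extend : ∀ {m n f} → m ℕ.≤ n → (∀ k → 0ℚ ≤ f k) → ∑₁ m f ≤ ∑₁ n f
  ∑₁-extend {m} {n} {f} m≤n 0≤f with ℕ.m≤n⇒∃[o]m+o≡n m≤n
  ... | o , refl = subst (λ k → ∑₁ m f ≤ ∑₁ k f) (ℕ.+-comm o m) (go o)
    where
    go : ∀ o → ∑₁ m f ≤ ∑₁ (o ℕ.+ m) f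
    go zero    = ℚ.≤-refl
    go (suc o) = ℚ.≤-trans (go o) (p≤p+q {∑₁ (o ℕ.+ m) f} {f (suc (o ℕ.+ m))} (0≤f _))

  -- Multiplication by q⁻ˢ on the side of Dirichlet series.
  dilate : ℕ → (ℕ → ℚ) → ℕ → ℚ
  dilate q g n with q ∣? n
  ... | yes q∣n = g (quotient q∣n)
  ... | no  _   = 0ℚ

  dilate-* : ∀ q .{{_ : ℕ.NonZero q}} g m → dilate q g (m ℕ.* q) ≡ g m
  dilate-* q g m with q ∣? m ℕ.* q
  ... | yes (divides k eq) = cong g (sym (ℕ.*-cancelʳ-≡ m k q eq))
  ... | no q∤              = contradiction (divides m refl) q∤

  dilate-∤ : ∀ {q} g {n} → ¬ q ∣ n → dilate q g n ≡ 0ℚ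
  dilate-∤ {q} g {n} q∤n with q ∣? n
  ... | yes q∣n = contradiction q∣n q∤n
  ... | no _    = refl

  ∑₁-dilate : ∀ n q .{{_ : ℕ.NonZero q}} g → ∑₁ n (dilate q g) ≡ ∑₁ (n ℕ./ q) g
  ∑₁-dilate n q@(suc q′) g = trans (cong (λ k → ∑₁ k (dilate q g)) (ℕ.m≡m%n+[m/n]*n n q))
                                 (go (n ℕ.% q) (n ℕ./ q) (ℕ.m%n<n n q))
    where
    go : ∀ r m → r ℕ.< q → ∑₁ (r ℕ.+ m ℕ.* q) (dilate q g) ≡ ∑₁ m g
    go zero    zero    _   = refl
    -- The block ends at the multiple `suc m * q`, its only nonzero term; the q - 1 positions before
    -- it are left to the residue clause.
    go zero    (suc m) _   = cong₂ _+_ (go q′ m ℕ.≤-refl) (dilate-* q g (suc m))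
    go (suc r) m       r<q = trans (cong₂ _+_ (go r m (ℕ.<-trans (ℕ.n<1+n r) r<q)) (dilate-∤ g q∤)) (ℚ.+-identityʳ (∑₁ m g))
      where
      q∤ : ¬ q ∣ suc r ℕ.+ m ℕ.* q
      q∤ q∣ = ℕ.<⇒≱ r<q (∣⇒≤ (ℕ.∣m+n∣m⇒∣n (subst (q ∣_) (ℕ.+-comm (suc r) (m ℕ.* q)) q∣) (divides m refl)))

  -- The extra term 1/(n + 1) is the telescoped remainder that lets the induction close.
  ∑₁-squares : ∀ n → ∑₁ (suc n) (λ k → recip k * recip k) + recip (suc n) ≤ 1ℚ + 1ℚ
  ∑₁-squares zero    = ℚ.≤-refl
  ∑₁-squares (suc n) = begin
    s + t * t + t         ≡⟨ ℚ.+-assoc s (t * t) t ⟩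
    s + (t * t + t)       ≤⟨ ℚ.+-monoʳ-≤ s (square-telescope (suc n)) ⟩
    s + recip (suc n)     ≤⟨ ∑₁-squares n ⟩
    1ℚ + 1ℚ               ∎
    where
    s t : ℚ
    s = ∑₁ (suc n) (λ k → recip k * recip k)
    t = recip (suc (suc n))

  ∑₁-squares≤2 : ∀ n → ∑₁ n (λ k → recip k * recip k) ≤ 1ℚ + 1ℚ
  ∑₁-squares≤2 zero    = ℚ.<⇒≤ (ℚ.positive⁻¹ (1ℚ + 1ℚ))
  ∑₁-squares≤2 (suc n) = ℚ.≤-trans
    (p≤p+q {∑₁ (suc n) (λ k → recip k * recip k)} {recip (suc n)} (recip-nonNeg (suc n))) (∑₁-squares n)

  harmonic : ℕ → ℚ
  harmonic n = ∑₁ n recip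

-- The sieve recursion and the operators that majorise its error

module Sieve where
  open import Data.Nat.Base using (_!)
  open import Data.Rational.Base using (_+_; _*_; -_; _-_; _≤_; _<_; ∣_∣)
  open Rational
  open Arithmetic
  open Sums
  open ℚ.≤-Reasoning

  onPrimes : (ℕ → ℚ) → ℕ → ℚ
  onPrimes f n with prime? n
  ... | yes _ = f n
  ... | no _  = 0ℚ

  -- Dirichlet convolution of f with ∏ (1 + h(q) q⁻ˢ) over q ≤ k.
  sieve : (ℕ → ℚ) → ℕ → (ℕ → ℚ) → ℕ → ℚ
  sieve h zero    f n = f n
  sieve h (suc k) f n = sieve h k f n + h (suc k) * dilate (suc k) (sieve h k f) n

  partialProduct : (ℕ → ℚ) → ℕ → ℚ
  partialProduct h zero    = 1ℚ
  partialProduct h (suc k) = partialProduct h k * (1ℚ + h (suc k) * recip (suc k))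

  -- The operator φ ↦ ∑ u(n) φ(d n), n running over the products of distinct q ≤ k
  -- and u extended multiplicatively.
  spread : (ℕ → ℚ) → ℕ → (ℕ → ℚ) → ℕ → ℚ
  spread u zero    φ d = φ d
  spread u (suc k) φ d = spread u k φ d + u (suc k) * spread u k φ (d ℕ.* suc k)

  ∑₁-sieve : ∀ n h k f → ∑₁ n (sieve h (suc k) f) ≡
             ∑₁ n (sieve h k f) + h (suc k) * ∑₁ (n ℕ./ suc k) (sieve h k f)
  ∑₁-sieve n h k f = begin-equality
    ∑₁ n (sieve h (suc k) f)
      ≡⟨ ∑₁-distrib-+ n (sieve h k f) (λ m → h (suc k) * dilate (suc k) (sieve h k f) m) ⟩
    ∑₁ n (sieve h k f) + ∑₁ n (λ m → h (suc k) * dilate (suc k) (sieve h k f) m)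
      ≡⟨ cong (λ s → ∑₁ n (sieve h k f) + s) (∑₁-distribˡ-* n (h (suc k)) (dilate (suc k) (sieve h k f))) ⟩
    ∑₁ n (sieve h k f) + h (suc k) * ∑₁ n (dilate (suc k) (sieve h k f))
      ≡⟨ cong (λ s → ∑₁ n (sieve h k f) + h (suc k) * s) (∑₁-dilate n (suc k) (sieve h k f)) ⟩
    ∑₁ n (sieve h k f) + h (suc k) * ∑₁ (n ℕ./ suc k) (sieve h k f) ∎

  module _ (N : ℕ) (h : ℕ → ℚ) where

    discrepancy : ℕ → (d : ℕ) → .{{ℕ.NonZero d}} → ℚ
    discrepancy k d = ∑₁ (N ℕ./ d) (sieve h k (λ _ → 1ℚ)) - ι N * recip d * partialProduct h k

    -- Both the sum and the main term split in the same way when `suc k` is adjoined. Since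
    -- ⌊⌊N/d⌋/q⌋ = ⌊N/(d q)⌋, the second piece is again a discrepancy, at d q, so the family indexed
    -- by d is closed under the recursion.
    discrepancy-suc : ∀ k d .{{_ : ℕ.NonZero d}} → discrepancy (suc k) d ≡
      discrepancy k d + h (suc k) * discrepancy k (d ℕ.* suc k) {{ℕ.m*n≢0 d (suc k)}}
    discrepancy-suc k d = begin-equality
      ∑₁ (N ℕ./ d) (sieve h (suc k) (λ _ → 1ℚ)) - c
        ≡⟨ cong (_- c) (∑₁-sieve (N ℕ./ d) h k (λ _ → 1ℚ)) ⟩
      s + y * ∑₁ (N ℕ./ d ℕ./ suc k) (sieve h k (λ _ → 1ℚ)) - c
        ≡⟨ cong (λ n → s + y * ∑₁ n (sieve h k (λ _ → 1ℚ)) - c) (ℕ.m/n/o≡m/[n*o] N d (suc k)) ⟩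
      s + y * t - c
        ≡⟨ lem s y t (ι N) (recip d) (recip (suc k)) P ⟩
      s - ι N * recip d * P + y * (t - ι N * (recip d * recip (suc k)) * P)
        ≡⟨ cong (λ r → s - ι N * recip d * P + y * (t - ι N * r * P)) (sym (recip-* d (suc k))) ⟩
      s - ι N * recip d * P + y * (t - ι N * recip (d ℕ.* suc k) * P) ∎
      where
      instance
        d*q≢0 : ℕ.NonZero (d ℕ.* suc k)
        d*q≢0 = ℕ.m*n≢0 d (suc k)
      P y s t c : ℚ
      P = partialProduct h k
      y = h (suc k)
      s = ∑₁ (N ℕ./ d) (sieve h k (λ _ → 1ℚ))
      t = ∑₁ (N ℕ./ (d ℕ.* suc k)) (sieve h k (λ _ → 1ℚ))
      c = ι N * recip d * (P * (1ℚ + y * recip (suc k)))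
      lem : ∀ s y t n d k P → s + y * t - n * d * (P * (1ℚ + y * k)) ≡
            s - n * d * P + y * (t - n * (d * k) * P)
      lem = solve-∀ ring

    -- Absolute values turn the recursion for `discrepancy` into the one defining `spread`, so only
    -- the floor error at k = 0 has to be estimated.
    discrepancy≤spread : ∀ {φ} → (∀ d .{{_ : ℕ.NonZero d}} → ∣ discrepancy 0 d ∣ ≤ φ d) →
      ∀ k d .{{_ : ℕ.NonZero d}} → ∣ discrepancy k d ∣ ≤ spread (λ n → ∣ h n ∣) k φ d
    discrepancy≤spread bound zero    d = bound d
    discrepancy≤spread {φ} bound (suc k) d = begin
      ∣ discrepancy (suc k) d ∣       ≡⟨ cong ∣_∣ (discrepancy-suc k d) ⟩
      ∣ a + y * b ∣                   ≤⟨ ℚ.∣p+q∣≤∣p∣+∣q∣ a (y * b) ⟩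
      ∣ a ∣ + ∣ y * b ∣               ≡⟨ cong (λ s → ∣ a ∣ + s) (ℚ.∣p*q∣≡∣p∣*∣q∣ y b) ⟩
      ∣ a ∣ + ∣ y ∣ * ∣ b ∣           ≤⟨ ℚ.+-mono-≤ (discrepancy≤spread {φ} bound k d)
                                          (*-monoˡ {∣ y ∣} {∣ b ∣} (ℚ.0≤∣p∣ y) (discrepancy≤spread {φ} bound k (d ℕ.* suc k) {{ℕ.m*n≢0 d (suc k)}})) ⟩
      spread (λ n → ∣ h n ∣) (suc k) φ d ∎
      where
      a y b : ℚ
      a = discrepancy k d
      y = h (suc k)
      b = discrepancy k (d ℕ.* suc k) {{ℕ.m*n≢0 d (suc k)}}

  infix 4 _≼_
  -- Restricted to positive d because at d = 0 every dilation d n is 0 again: no decay is left, and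
  -- a factor uniform in k is not to be had there.
  _≼_ : (ℕ → ℚ) → (ℕ → ℚ) → Set
  φ ≼ ψ = ∀ d → .{{ℕ.NonZero d}} → φ d ≤ ψ d

  spread-nonNeg : ∀ {u φ} → (∀ n → 0ℚ ≤ u n) → (λ _ → 0ℚ) ≼ φ → ∀ k → (λ _ → 0ℚ) ≼ spread u k φ
  spread-nonNeg 0≤u 0≤φ zero    d = 0≤φ d
  spread-nonNeg {u} {φ} 0≤u 0≤φ (suc k) d = +-nonNeg {spread u k φ d} (spread-nonNeg {u} {φ} 0≤u 0≤φ k d)
    (*-nonNeg {u (suc k)} (0≤u (suc k)) (spread-nonNeg {u} {φ} 0≤u 0≤φ k (d ℕ.* suc k) {{ℕ.m*n≢0 d (suc k)}}))

  spread-mono : ∀ {u v φ ψ} → (∀ n → 0ℚ ≤ u n) → (∀ n → u n ≤ v n) → (λ _ → 0ℚ) ≼ ψ → φ ≼ ψ →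
                ∀ k → spread u k φ ≼ spread v k ψ
  spread-mono 0≤u u≤v 0≤ψ φ≤ψ zero    d = φ≤ψ d
  spread-mono {u} {v} {φ} {ψ} 0≤u u≤v 0≤ψ φ≤ψ (suc k) d = ℚ.+-mono-≤
    (spread-mono {u} {v} {φ} {ψ} 0≤u u≤v 0≤ψ φ≤ψ k d)
    (*-mono {u (suc k)} {v (suc k)} {spread u k φ e} {spread v k ψ e} (0≤u (suc k))
      (spread-nonNeg {v} {ψ} (λ n → ℚ.≤-trans (0≤u n) (u≤v n)) 0≤ψ k e {{e≢0}}) (u≤v (suc k))
      (spread-mono {u} {v} {φ} {ψ} 0≤u u≤v 0≤ψ φ≤ψ k e {{e≢0}}))
    where
    e : ℕ
    e = d ℕ.* suc k
    e≢0 : ℕ.NonZero e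
    e≢0 = ℕ.m*n≢0 d (suc k)

  spread-linear : ∀ u k φ c ψ d → spread u k (λ d → φ d + c * ψ d) d ≡ spread u k φ d + c * spread u k ψ d
  spread-linear u zero    φ c ψ d = refl
  spread-linear u (suc k) φ c ψ d = begin-equality
    spread u k χ d + u (suc k) * spread u k χ e   ≡⟨ cong₂ (λ s t → s + u (suc k) * t) (spread-linear u k φ c ψ d) (spread-linear u k φ c ψ e) ⟩
    (spread u k φ d + c * spread u k ψ d) + u (suc k) * (spread u k φ e + c * spread u k ψ e)
      ≡⟨ lem (spread u k φ d) c (spread u k ψ d) (u (suc k)) (spread u k φ e) (spread u k ψ e) ⟩
    (spread u k φ d + u (suc k) * spread u k φ e) + c * (spread u k ψ d + u (suc k) * spread u k ψ e) ∎
    where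
    χ : ℕ → ℚ
    χ d = φ d + c * ψ d
    e : ℕ
    e = d ℕ.* suc k
    lem : ∀ a c b u a′ b′ → (a + c * b) + u * (a′ + c * b′) ≡ (a + u * a′) + c * (b + u * b′)
    lem = solve-∀ ring

  spread-scale : ∀ u k c φ d → spread u k (λ d → c * φ d) d ≡ c * spread u k φ d
  spread-scale u zero    c φ d = refl
  spread-scale u (suc k) c φ d = trans
    (cong₂ (λ s t → s + u (suc k) * t) (spread-scale u k c φ d) (spread-scale u k c φ (d ℕ.* suc k)))
    (lem c (spread u k φ d) (u (suc k)) (spread u k φ (d ℕ.* suc k)))
    where
    lem : ∀ c a u b → c * a + u * (c * b) ≡ c * (a + u * b)
    lem = solve-∀ ring

  spread-shift : ∀ u k φ q d → spread u k (λ d → φ (d ℕ.* q)) d ≡ spread u k φ (d ℕ.* q)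
  spread-shift u zero    φ q d = refl
  spread-shift u (suc k) φ q d = cong₂ (λ s t → s + u (suc k) * t) (spread-shift u k φ q d)
    (trans (spread-shift u k φ q (d ℕ.* suc k)) (cong (spread u k φ) (swap d (suc k) q)))
    where
    swap : ∀ a b c → a ℕ.* b ℕ.* c ≡ a ℕ.* c ℕ.* b
    swap a b c = trans (ℕ.*-assoc a b c) (trans (cong (a ℕ.*_) (ℕ.*-comm b c)) (sym (ℕ.*-assoc a c b)))

  -- 1 + u + v ≤ (1 + u)(1 + v) in each factor
  spread-+ : ∀ {u v φ} → (∀ n → 0ℚ ≤ u n) → (∀ n → 0ℚ ≤ v n) → (λ _ → 0ℚ) ≼ φ →
             ∀ k → spread (λ n → u n + v n) k φ ≼ spread u k (spread v k φ)
  spread-+ 0≤u 0≤v 0≤φ zero    d = ℚ.≤-refl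
  spread-+ {u} {v} {φ} 0≤u 0≤v 0≤φ (suc k) d = begin
      spread w k φ d + (a + b) * spread w k φ e
        ≤⟨ ℚ.+-mono-≤ (spread-+ {u} {v} {φ} 0≤u 0≤v 0≤φ k d)
             (*-monoˡ {a + b} {spread w k φ e} (+-nonNeg {a} {b} (0≤u (suc k)) (0≤v (suc k))) (spread-+ {u} {v} {φ} 0≤u 0≤v 0≤φ k e {{e≢0}})) ⟩
      spread u k Φ d + (a + b) * spread u k Φ e
        ≡⟨ lem (spread u k Φ d) a b (spread u k Φ e) ⟩
      (spread u k Φ d + b * spread u k Φ e) + a * spread u k Φ e
        ≡⟨ cong (λ s → (spread u k Φ d + b * s) + a * spread u k Φ e) (sym (spread-shift u k Φ (suc k) d)) ⟩
      (spread u k Φ d + b * spread u k (λ d → Φ (d ℕ.* suc k)) d) + a * spread u k Φ e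
        ≡⟨ cong (_+ a * spread u k Φ e) (sym (spread-linear u k Φ b (λ d → Φ (d ℕ.* suc k)) d)) ⟩
      spread u k Φ⁺ d + a * spread u k Φ e
        ≤⟨ ℚ.+-monoʳ-≤ (spread u k Φ⁺ d) (*-monoˡ {a} {spread u k Φ e} {spread u k Φ⁺ e} (0≤u (suc k))
             (spread-mono {u} {u} {Φ} {Φ⁺} 0≤u (λ _ → ℚ.≤-refl) 0≤Φ⁺ Φ≤Φ⁺ k e {{e≢0}})) ⟩
      spread u k Φ⁺ d + a * spread u k Φ⁺ e ∎
    where
    w Φ Φ⁺ : ℕ → ℚ
    w n = u n + v n
    Φ = spread v k φ
    Φ⁺ = spread v (suc k) φ
    a b : ℚ
    a = u (suc k)
    b = v (suc k)
    e : ℕ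
    e = d ℕ.* suc k
    e≢0 : ℕ.NonZero e
    e≢0 = ℕ.m*n≢0 d (suc k)
    0≤Φ : (λ _ → 0ℚ) ≼ Φ
    0≤Φ = spread-nonNeg {v} {φ} 0≤v 0≤φ k
    0≤Φ⁺ : (λ _ → 0ℚ) ≼ Φ⁺
    0≤Φ⁺ = spread-nonNeg {v} {φ} 0≤v 0≤φ (suc k)
    Φ≤Φ⁺ : Φ ≼ Φ⁺
    Φ≤Φ⁺ d = p≤p+q {Φ d} {b * Φ (d ℕ.* suc k)} (*-nonNeg {b} (0≤v (suc k)) (0≤Φ (d ℕ.* suc k) {{ℕ.m*n≢0 d (suc k)}}))
    lem : ∀ s a b t → s + (a + b) * t ≡ (s + b * t) + a * t
    lem = solve-∀ ring

  -- An approximate eigenvector inequality: all operators `spread u k` send `φ` below `c` times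
  -- itself, with one `c` for every k. The output is again a multiple of `φ`, so such bounds can be
  -- iterated.
  record Amplifies (φ u : ℕ → ℚ) (c : ℚ) : Set where
    field
      weight-nonNeg : ∀ n → 0ℚ ≤ u n
      factor-nonNeg : 0ℚ ≤ c
      amplify       : ∀ k → spread u k φ ≼ λ d → c * φ d
  open Amplifies public

  module _ {φ : ℕ → ℚ} (0≤φ : (λ _ → 0ℚ) ≼ φ) where

    amplifies-0 : Amplifies φ (λ _ → 0ℚ) 1ℚ
    amplifies-0 .weight-nonNeg n = ℚ.≤-refl
    amplifies-0 .factor-nonNeg   = 0≤1
    amplifies-0 .amplify k d     = ℚ.≤-reflexive (trans (go k d) (sym (ℚ.*-identityˡ (φ d))))
      where
      go : ∀ k d → spread (λ _ → 0ℚ) k φ d ≡ φ d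
      go zero    d = refl
      go (suc k) d = trans (cong₂ _+_ (go k d) (ℚ.*-zeroˡ (spread (λ _ → 0ℚ) k φ (d ℕ.* suc k)))) (ℚ.+-identityʳ (φ d))

    -- By `spread-+` a sum of weights is dominated by the composition of two operators, and each of
    -- them contributes its own factor.
    amplifies-+ : ∀ {u v x y} → Amplifies φ u x → Amplifies φ v y → Amplifies φ (λ n → u n + v n) (x * y)
    amplifies-+ {u} {v} U V .weight-nonNeg n = +-nonNeg {u n} {v n} (weight-nonNeg U n) (weight-nonNeg V n)
    amplifies-+ {x = x} {y} U V .factor-nonNeg = *-nonNeg {x} {y} (factor-nonNeg U) (factor-nonNeg V)
    amplifies-+ {u} {v} {x} {y} U V .amplify k d = begin
      spread (λ n → u n + v n) k φ d   ≤⟨ spread-+ {u} {v} {φ} (weight-nonNeg U) (weight-nonNeg V) 0≤φ k d ⟩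
      spread u k (spread v k φ) d      ≤⟨ spread-mono {u} {u} {spread v k φ} {λ d → y * φ d} (weight-nonNeg U) (λ _ → ℚ.≤-refl)
                                            (λ d → *-nonNeg {y} {φ d} (factor-nonNeg V) (0≤φ d)) (amplify V k) k d ⟩
      spread u k (λ d → y * φ d) d     ≡⟨ spread-scale u k y φ d ⟩
      y * spread u k φ d               ≤⟨ *-monoˡ {y} {spread u k φ d} {x * φ d} (factor-nonNeg V) (amplify U k d) ⟩
      y * (x * φ d)                    ≡⟨ lem y x (φ d) ⟩
      x * y * φ d                      ∎
      where
      lem : ∀ y x f → y * (x * f) ≡ x * y * f
      lem = solve-∀ ring

    amplifies-≤ : ∀ {u v c} → (∀ n → 0ℚ ≤ u n) → (∀ n → u n ≤ v n) → Amplifies φ v c → Amplifies φ u c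
    amplifies-≤ 0≤u u≤v V .weight-nonNeg = 0≤u
    amplifies-≤ 0≤u u≤v V .factor-nonNeg = factor-nonNeg V
    amplifies-≤ {u} {v} 0≤u u≤v V .amplify k d =
      ℚ.≤-trans (spread-mono {u} {v} {φ} {φ} 0≤u u≤v 0≤φ (λ _ → ℚ.≤-refl) k d) (amplify V k d)

    -- An integer coefficient means that many added copies, hence a power of the factor. For the
    -- weight 1/n this power becomes the exponent of the logarithm.
    amplifies-ι* : ∀ {u c} n → Amplifies φ u c → Amplifies φ (λ m → ι n * u m) (c ^ℚ n)
    amplifies-ι* {u} zero    U = amplifies-≤ (λ m → ℚ.≤-reflexive (sym (ℚ.*-zeroˡ (u m)))) (λ m → ℚ.≤-reflexive (ℚ.*-zeroˡ (u m))) amplifies-0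
    amplifies-ι* {u} (suc n) U = amplifies-≤ (λ m → *-nonNeg {ι (suc n)} {u m} (0≤ι (suc n)) (weight-nonNeg U m))
      (λ m → ℚ.≤-reflexive (trans (cong (_* u m) (ι-suc n)) (lem (ι n) (u m)))) (amplifies-+ U (amplifies-ι* n U))
      where
      lem : ∀ n u → (n + 1ℚ) * u ≡ u + n * u
      lem = solve-∀ ring

  δ₁ : ℕ → ℚ
  δ₁ 1 = 1ℚ
  δ₁ _ = 0ℚ

  onPrimes-nonNeg : ∀ {f} → (∀ n → 0ℚ ≤ f n) → ∀ n → 0ℚ ≤ onPrimes f n
  onPrimes-nonNeg 0≤f n with prime? n
  ... | yes _ = 0≤f n
  ... | no _  = ℚ.≤-refl

  module _ (U : ℕ → ℚ) (0≤U : ∀ n → 0ℚ ≤ U n) (U1≡1 : U 1 ≡ 1ℚ)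
           (U-* : ∀ m n → U (m ℕ.* n) ≡ U m * U n) where

    private
      u : ℕ → ℚ
      u = onPrimes U

      -- U restricted to the products of distinct primes ≤ k
      w : ℕ → ℕ → ℚ
      w k = sieve u k δ₁

    -- `w k` lives on products of primes up to k, so by Euclid's lemma a larger prime divides
    -- nothing in its support.
    w-vanishes : ∀ k {p n} → Prime p → k ℕ.< p → p ∣ n → w k n ≡ 0ℚ
    w-vanishes zero {n = zero} pr _ p∣n = refl
    w-vanishes zero {n = 1}    pr _ p∣1 = contradiction (subst Prime (∣1⇒≡1 p∣1) pr) ¬prime[1]
    w-vanishes zero {n = suc (suc n)} pr _ p∣n = refl
    w-vanishes (suc k) {p} {n} pr k<p p∣n = cong₂ _+_ (w-vanishes k pr (ℕ.<-trans (ℕ.n<1+n k) k<p) p∣n)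
        (trans (cong (u (suc k) *_) quotient-vanishes) (ℚ.*-zeroʳ (u (suc k))))
      where
      quotient-vanishes : dilate (suc k) (w k) n ≡ 0ℚ
      quotient-vanishes with suc k ∣? n
      ... | no _ = refl
      ... | yes (divides m refl) with euclidsLemma m (suc k) pr p∣n
      ...   | inj₁ p∣m = w-vanishes k pr (ℕ.<-trans (ℕ.n<1+n k) k<p) p∣m
      ...   | inj₂ p∣q = contradiction (∣⇒≤ p∣q) (ℕ.<⇒≱ k<p)

    -- This is unique factorisation: if the new prime `suc k` divides n, then w k n vanishes, so at
    -- most one of the two terms of the recursion survives and no n is counted twice. For arbitrary
    -- q instead of primes, one n could arise from several products.
    w≤U : ∀ k → w k ≼ U
    w≤U zero 1             = ℚ.≤-reflexive (sym U1≡1)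
    w≤U zero (suc (suc n)) = 0≤U (suc (suc n))
    w≤U (suc k) n with prime? (suc k)
    ... | no _ = ℚ.≤-trans (ℚ.≤-reflexive (lem (w k n) (dilate (suc k) (w k) n))) (w≤U k n)
      where
      lem : ∀ a b → a + 0ℚ * b ≡ a
      lem = solve-∀ ring
    ... | yes pr with suc k ∣? n
    ...   | no _ = ℚ.≤-trans (ℚ.≤-reflexive (lem (w k n) (U (suc k)))) (w≤U k n)
      where
      lem : ∀ a b → a + b * 0ℚ ≡ a
      lem = solve-∀ ring
    ...   | yes (divides m eq) = begin
        w k n + U (suc k) * w k m   ≡⟨ cong (_+ U (suc k) * w k m) (w-vanishes k {n = n} pr ℕ.≤-refl (divides m eq)) ⟩
        0ℚ + U (suc k) * w k m      ≡⟨ ℚ.+-identityˡ (U (suc k) * w k m) ⟩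
        U (suc k) * w k m           ≤⟨ *-monoˡ {U (suc k)} {w k m} {U m} (0≤U (suc k)) (w≤U k m {{m≢0}}) ⟩
        U (suc k) * U m             ≡⟨ ℚ.*-comm (U (suc k)) (U m) ⟩
        U m * U (suc k)             ≡⟨ sym (U-* m (suc k)) ⟩
        U (m ℕ.* suc k)             ≡⟨ cong U (sym eq) ⟩
        U n                         ∎
      where
      m≢0 : ℕ.NonZero m
      m≢0 = ℕ.m*n≢0⇒m≢0 m {suc k} {{subst ℕ.NonZero eq (ℕ.≢-nonZero (ℕ.≢-nonZero⁻¹ n))}}

    w-nonNeg : ∀ k n → 0ℚ ≤ w k n
    w-nonNeg zero zero          = ℚ.≤-refl
    w-nonNeg zero 1             = 0≤1
    w-nonNeg zero (suc (suc n)) = ℚ.≤-refl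
    w-nonNeg (suc k) n = +-nonNeg {w k n} (w-nonNeg k n)
      (*-nonNeg {u (suc k)} (onPrimes-nonNeg {U} 0≤U (suc k)) quotient-nonNeg)
      where
      quotient-nonNeg : 0ℚ ≤ dilate (suc k) (w k) n
      quotient-nonNeg with suc k ∣? n
      ... | yes q∣n = w-nonNeg k (quotient q∣n)
      ... | no _    = ℚ.≤-refl

    -- Unfolds the nested recursion into one sum over the integers n that occur. A product of
    -- distinct integers up to k is at most k!, which fixes the range; passing to (k + 1)! only adds
    -- nonnegative terms.
    spread≤∑-w : ∀ {φ} → (∀ d → 0ℚ ≤ φ d) → ∀ k →
                 spread u k φ ≼ λ d → ∑₁ (k !) (λ n → w k n * φ (d ℕ.* n))
    spread≤∑-w {φ} 0≤φ zero d = ℚ.≤-reflexive (trans (cong φ (sym (ℕ.*-identityʳ d))) (lem (φ (d ℕ.* 1))))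
      where
      lem : ∀ a → a ≡ 0ℚ + 1ℚ * a
      lem = solve-∀ ring
    spread≤∑-w {φ} 0≤φ (suc k) d = begin
        spread u k φ d + u q * spread u k φ (d ℕ.* q)
          ≤⟨ ℚ.+-mono-≤ (spread≤∑-w {φ} 0≤φ k d) (*-monoˡ {u q} {spread u k φ (d ℕ.* q)} (onPrimes-nonNeg {U} 0≤U q) (spread≤∑-w {φ} 0≤φ k (d ℕ.* q) {{ℕ.m*n≢0 d q}})) ⟩
        ∑₁ (k !) F + u q * ∑₁ (k !) (λ m → w k m * φ (d ℕ.* q ℕ.* m))
          ≤⟨ ℚ.+-mono-≤ (∑₁-extend {k !} {q !} {F} (ℕ.m≤m+n (k !) (k ℕ.* k !)) (λ n → *-nonNeg {w k n} (w-nonNeg k n) (0≤φ (d ℕ.* n))))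
               (ℚ.≤-reflexive (cong (u q *_) (Log.∑₁-cong (k !) (λ m → cong (λ e → w k m * φ e) (reassoc m))))) ⟩
        ∑₁ (q !) F + u q * ∑₁ (k !) G
          ≡⟨ cong (λ n → ∑₁ (q !) F + u q * ∑₁ n G) (sym (trans (cong (ℕ._/ q) (ℕ.*-comm q (k !))) (ℕ.m*n/n≡m (k !) q))) ⟩
        ∑₁ (q !) F + u q * ∑₁ (q ! ℕ./ q) G
          ≡⟨ cong (λ s → ∑₁ (q !) F + u q * s) (sym (∑₁-dilate (q !) q G)) ⟩
        ∑₁ (q !) F + u q * ∑₁ (q !) (dilate q G)
          ≡⟨ cong (λ s → ∑₁ (q !) F + s) (sym (∑₁-distribˡ-* (q !) (u q) (dilate q G))) ⟩
        ∑₁ (q !) F + ∑₁ (q !) (λ n → u q * dilate q G n)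
          ≡⟨ sym (∑₁-distrib-+ (q !) F (λ n → u q * dilate q G n)) ⟩
        ∑₁ (q !) (λ n → F n + u q * dilate q G n)
          ≡⟨ Log.∑₁-cong (q !) (λ n → trans (cong (λ s → F n + u q * s) (dilate-G n)) (lem (w k n) (φ (d ℕ.* n)) (u q) (dilate q (w k) n))) ⟩
        ∑₁ (q !) (λ n → w q n * φ (d ℕ.* n)) ∎
      where
      q : ℕ
      q = suc k
      F G : ℕ → ℚ
      F n = w k n * φ (d ℕ.* n)
      G m = w k m * φ (d ℕ.* (m ℕ.* q))
      reassoc : ∀ m → d ℕ.* q ℕ.* m ≡ d ℕ.* (m ℕ.* q)
      reassoc m = trans (ℕ.*-assoc d q m) (cong (d ℕ.*_) (ℕ.*-comm q m))
      lem : ∀ a f u b → a * f + u * (b * f) ≡ (a + u * b) * f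
      lem = solve-∀ ring
      dilate-G : ∀ n → dilate q G n ≡ dilate q (w k) n * φ (d ℕ.* n)
      dilate-G n with q ∣? n
      ... | yes (divides m eq) = cong (λ e → w k m * φ (d ℕ.* e)) (sym eq)
      ... | no _               = sym (ℚ.*-zeroˡ (φ (d ℕ.* n)))

    -- Here the primes leave the estimate: squarefree products of primes are replaced by all n up to
    -- k!, and the remaining sums are elementary.
    spread≤∑ : ∀ {φ} → (∀ d → 0ℚ ≤ φ d) → ∀ k → spread u k φ ≼ λ d → ∑₁ (k !) (λ n → U n * φ (d ℕ.* n))
    spread≤∑ {φ} 0≤φ k d = ℚ.≤-trans (spread≤∑-w {φ} 0≤φ k d)
      (∑₁-mono (k !) λ n _ → *-monoʳ {φ (d ℕ.* suc n)} {w k (suc n)} {U (suc n)} (0≤φ (d ℕ.* suc n)) (w≤U k (suc n)))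

-- The cutoff min(1 , N/d) and the uniform bound for the sieve error

module SieveBound where
  open import Data.Nat.Base using (_!)
  open import Data.Rational.Base using (_+_; _*_; -_; _-_; _≤_; ∣_∣)
  open Rational
  open Arithmetic
  open Sums
  open Sieve
  open ℚ.≤-Reasoning

  2ℚ : ℚ
  2ℚ = 1ℚ + 1ℚ

  0≤2 : 0ℚ ≤ 2ℚ
  0≤2 = ℚ.<⇒≤ (ℚ.positive⁻¹ 2ℚ)

  1≤harmonic : ∀ n .{{_ : ℕ.NonZero n}} → 1ℚ ≤ harmonic n
  1≤harmonic (suc n) = ∑₁-extend {1} {suc n} {recip} (ℕ.s≤s ℕ.z≤n) recip-nonNeg

  ι≤⇒quotient≤ : ∀ {m n} d .{{_ : ℕ.NonZero d}} → m ℕ.≤ n ℕ.* d → ι m * recip d ≤ ι n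
  ι≤⇒quotient≤ {m} {n} d m≤nd = begin
    ι m * recip d           ≤⟨ *-monoʳ {recip d} {ι m} {ι (n ℕ.* d)} (recip-nonNeg d) (ι-mono m≤nd) ⟩
    ι (n ℕ.* d) * recip d   ≡⟨ cong (_* recip d) (ι-hom-* n d) ⟩
    ι n * ι d * recip d     ≡⟨ ℚ.*-assoc (ι n) (ι d) (recip d) ⟩
    ι n * (ι d * recip d)   ≡⟨ cong (ι n *_) (recip-inverse d) ⟩
    ι n * 1ℚ                ≡⟨ ℚ.*-identityʳ (ι n) ⟩
    ι n                     ∎

  ι≤⇒≤quotient : ∀ {m n} d .{{_ : ℕ.NonZero d}} → n ℕ.* d ℕ.≤ m → ι n ≤ ι m * recip d
  ι≤⇒≤quotient {m} {n} d nd≤m = begin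
    ι n                     ≡⟨ sym (ℚ.*-identityʳ (ι n)) ⟩
    ι n * 1ℚ                ≡⟨ cong (ι n *_) (sym (recip-inverse d)) ⟩
    ι n * (ι d * recip d)   ≡⟨ sym (ℚ.*-assoc (ι n) (ι d) (recip d)) ⟩
    ι n * ι d * recip d     ≡⟨ cong (_* recip d) (sym (ι-hom-* n d)) ⟩
    ι (n ℕ.* d) * recip d   ≤⟨ *-monoʳ {recip d} {ι (n ℕ.* d)} {ι m} (recip-nonNeg d) (ι-mono nd≤m) ⟩
    ι m * recip d           ∎

  module _ (N : ℕ) .{{_ : ℕ.NonZero N}} where

    -- min (1 , N/d)
    cutoff : ℕ → ℚ
    cutoff d = ι N * recip (N ℕ.⊔ d)

    cutoff-nonNeg : ∀ d → 0ℚ ≤ cutoff d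
    cutoff-nonNeg d = *-nonNeg {ι N} {recip (N ℕ.⊔ d)} (0≤ι N) (recip-nonNeg (N ℕ.⊔ d))

    cutoff-≤ : ∀ {d} → d ℕ.≤ N → cutoff d ≡ 1ℚ
    cutoff-≤ d≤N = trans (cong (λ e → ι N * recip e) (ℕ.m≥n⇒m⊔n≡m d≤N)) (recip-inverse N)

    cutoff-≥ : ∀ {d} → N ℕ.≤ d → cutoff d ≡ ι N * recip d
    cutoff-≥ N≤d = cong (λ e → ι N * recip e) (ℕ.m≤n⇒m⊔n≡n N≤d)

    cutoff-antitone : ∀ {d e} → d ℕ.≤ e → cutoff e ≤ cutoff d
    cutoff-antitone {d} {e} d≤e = *-monoˡ {ι N} {recip (N ℕ.⊔ e)} {recip (N ℕ.⊔ d)} (0≤ι N)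
      (recip-antitone {N ℕ.⊔ d} {N ℕ.⊔ e} {{N⊔d≢0}} (ℕ.⊔-monoʳ-≤ N d≤e))
      where
      N⊔d≢0 : ℕ.NonZero (N ℕ.⊔ d)
      N⊔d≢0 = ℕ.>-nonZero (ℕ.<-≤-trans (ℕ.>-nonZero⁻¹ N) (ℕ.m≤m⊔n N d))

    cutoff≤quotient : ∀ d .{{_ : ℕ.NonZero d}} → cutoff d ≤ ι N * recip d
    cutoff≤quotient d = *-monoˡ {ι N} {recip (N ℕ.⊔ d)} {recip d} (0≤ι N) (recip-antitone {d} (ℕ.m≤n⊔m N d))

    -- The discrepancy at k = 0 is ⌊N/d⌋ - N/d: at most 1 in size for d ≤ N, equal to -N/d for d > N
    -- where the floor is 0, and 0 for d = N.
    initial-discrepancy : ∀ h d .{{_ : ℕ.NonZero d}} → ∣ discrepancy N h 0 d ∣ ≤ cutoff d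
    initial-discrepancy h d with ℕ.≤-total d N
    ... | inj₁ d≤N = begin
          ∣ ∑₁ (N ℕ./ d) (λ _ → 1ℚ) - x * 1ℚ ∣   ≡⟨ cong₂ (λ p q → ∣ p - q ∣) (trans (Log.∑₁-const (N ℕ./ d) 1ℚ) (ℚ.*-identityʳ (ι (N ℕ./ d)))) (ℚ.*-identityʳ x) ⟩
          ∣ ι (N ℕ./ d) - x ∣                    ≤⟨ ∣p-q∣≤ {ι (N ℕ./ d)} {x} {1ℚ}
                                                     (ℚ.≤-trans (ι≤⇒≤quotient {N} {N ℕ./ d} d (ℕ.m/n*n≤m N d)) (p≤p+q {x} {1ℚ} 0≤1))
                                                     (ℚ.≤-trans (ι≤⇒quotient≤ {N} {suc (N ℕ./ d)} d N≤) (ℚ.≤-reflexive (ι-suc (N ℕ./ d)))) ⟩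
          1ℚ                                     ≡⟨ sym (cutoff-≤ d≤N) ⟩
          cutoff d                               ∎
      where
      x : ℚ
      x = ι N * recip d
      N≤ : N ℕ.≤ suc (N ℕ./ d) ℕ.* d
      N≤ = subst (ℕ._≤ suc (N ℕ./ d) ℕ.* d) (sym (ℕ.m≡m%n+[m/n]*n N d))
             (ℕ.+-monoˡ-≤ (N ℕ./ d ℕ.* d) (ℕ.<⇒≤ (ℕ.m%n<n N d)))
    ... | inj₂ N≤d with ℕ.m≤n⇒m<n∨m≡n N≤d
    ...   | inj₁ N<d = begin
          ∣ ∑₁ (N ℕ./ d) (λ _ → 1ℚ) - x * 1ℚ ∣   ≡⟨ cong (λ n → ∣ ∑₁ n (λ _ → 1ℚ) - x * 1ℚ ∣) (ℕ.m<n⇒m/n≡0 N<d) ⟩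
          ∣ 0ℚ - x * 1ℚ ∣                        ≡⟨ cong ∣_∣ (lem x) ⟩
          ∣ - x ∣                                ≡⟨ ℚ.∣-p∣≡∣p∣ x ⟩
          ∣ x ∣                                  ≡⟨ ℚ.0≤p⇒∣p∣≡p (*-nonNeg {ι N} {recip d} (0≤ι N) (recip-nonNeg d)) ⟩
          x                                      ≡⟨ sym (cutoff-≥ N≤d) ⟩
          cutoff d                               ∎
      where
      x : ℚ
      x = ι N * recip d
      lem : ∀ x → 0ℚ - x * 1ℚ ≡ - x
      lem = solve-∀ ring
    ...   | inj₂ refl = begin
          ∣ ∑₁ (N ℕ./ N) (λ _ → 1ℚ) - ι N * recip N * 1ℚ ∣   ≡⟨ cong₂ (λ n y → ∣ ∑₁ n (λ _ → 1ℚ) - y * 1ℚ ∣) (ℕ.n/n≡1 N) (recip-inverse N) ⟩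
          0ℚ                                                 ≤⟨ cutoff-nonNeg N ⟩
          cutoff N                                           ∎

    -- The terms are 1/n up to N and N/n² beyond it. The added N/(o + N) is the part of the
    -- telescoping tail not yet spent; at o = 0 it is the 1 on the right.
    ∑-recip*cutoff : ∀ o → ∑₁ (o ℕ.+ N) (λ n → recip n * cutoff n) + ι N * recip (o ℕ.+ N) ≤ harmonic N + 1ℚ
    ∑-recip*cutoff zero = ℚ.+-mono-≤ (∑₁-mono N {λ n → recip n * cutoff n} {recip} λ n n<N → ℚ.≤-reflexive
        (trans (cong (recip (suc n) *_) (cutoff-≤ n<N)) (ℚ.*-identityʳ (recip (suc n)))))
      (ℚ.≤-reflexive (recip-inverse N))
    ∑-recip*cutoff (suc o) = begin
      s + r * cutoff m⁺ + ι N * r          ≡⟨ cong (λ c → s + r * c + ι N * r) (cutoff-≥ (ℕ.m≤n+m N (suc o))) ⟩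
      s + r * (ι N * r) + ι N * r          ≡⟨ lem s r (ι N) ⟩
      s + ι N * (r * r + r)                ≤⟨ ℚ.+-monoʳ-≤ s (*-monoˡ {ι N} {r * r + r} {recip (o ℕ.+ N)} (0≤ι N) (square-telescope (o ℕ.+ N) {{o+N≢0}})) ⟩
      s + ι N * recip (o ℕ.+ N)            ≤⟨ ∑-recip*cutoff o ⟩
      harmonic N + 1ℚ                      ∎
      where
      m⁺ : ℕ
      m⁺ = suc (o ℕ.+ N)
      s r : ℚ
      s = ∑₁ (o ℕ.+ N) (λ n → recip n * cutoff n)
      r = recip m⁺
      o+N≢0 : ℕ.NonZero (o ℕ.+ N)
      o+N≢0 = ℕ.>-nonZero (ℕ.<-≤-trans (ℕ.>-nonZero⁻¹ N) (ℕ.m≤n+m N o))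
      lem : ∀ s r n → s + r * (n * r) + n * r ≡ s + n * (r * r + r)
      lem = solve-∀ ring

    -- For d ≤ N the cutoff at d is 1 and the cutoff at d n is at most that at n, so the total is at
    -- most H_N + 1 ≤ 2 H_N. For d ≥ N the cutoff at d n is at most N/(d n), so the sum is a
    -- convergent sum of 1/n² times the cutoff at d.
    ∑-recip*cutoff≤ : ∀ M d .{{_ : ℕ.NonZero d}} →
                      ∑₁ M (λ n → recip n * cutoff (d ℕ.* n)) ≤ 2ℚ * harmonic N * cutoff d
    ∑-recip*cutoff≤ M d with ℕ.≤-total d N
    ... | inj₁ d≤N = begin
          ∑₁ M (λ n → recip n * cutoff (d ℕ.* n))
            ≤⟨ ∑₁-mono M {λ n → recip n * cutoff (d ℕ.* n)} {G} (λ n _ → *-monoˡ {recip (suc n)} {cutoff (d ℕ.* suc n)} {cutoff (suc n)}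
                 (recip-nonNeg (suc n)) (cutoff-antitone (ℕ.m≤n*m (suc n) d))) ⟩
          ∑₁ M G
            ≤⟨ ∑₁-extend {M} {M ℕ.+ N} {G} (ℕ.m≤m+n M N) (λ n → *-nonNeg {recip n} {cutoff n} (recip-nonNeg n) (cutoff-nonNeg n)) ⟩
          ∑₁ (M ℕ.+ N) G
            ≤⟨ p≤p+q {∑₁ (M ℕ.+ N) G} {ι N * recip (M ℕ.+ N)} (*-nonNeg {ι N} {recip (M ℕ.+ N)} (0≤ι N) (recip-nonNeg (M ℕ.+ N))) ⟩
          ∑₁ (M ℕ.+ N) G + ι N * recip (M ℕ.+ N)
            ≤⟨ ∑-recip*cutoff M ⟩
          harmonic N + 1ℚ
            ≤⟨ ℚ.+-monoʳ-≤ (harmonic N) (1≤harmonic N) ⟩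
          harmonic N + harmonic N
            ≡⟨ lem (harmonic N) ⟩
          2ℚ * harmonic N * 1ℚ
            ≡⟨ cong (2ℚ * harmonic N *_) (sym (cutoff-≤ d≤N)) ⟩
          2ℚ * harmonic N * cutoff d ∎
      where
      G : ℕ → ℚ
      G n = recip n * cutoff n
      lem : ∀ x → x + x ≡ (1ℚ + 1ℚ) * x * 1ℚ
      lem = solve-∀ ring
    ... | inj₂ N≤d = begin
          ∑₁ M (λ n → recip n * cutoff (d ℕ.* n))
            ≤⟨ ∑₁-mono M {λ n → recip n * cutoff (d ℕ.* n)} {λ n → ι N * recip d * (recip n * recip n)} (λ n _ → term (suc n)) ⟩
          ∑₁ M (λ n → ι N * recip d * (recip n * recip n))
            ≡⟨ ∑₁-distribˡ-* M (ι N * recip d) (λ n → recip n * recip n) ⟩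
          ι N * recip d * ∑₁ M (λ n → recip n * recip n)
            ≡⟨ cong (_* ∑₁ M (λ n → recip n * recip n)) (sym (cutoff-≥ N≤d)) ⟩
          cutoff d * ∑₁ M (λ n → recip n * recip n)
            ≤⟨ *-monoˡ {cutoff d} {∑₁ M (λ n → recip n * recip n)} {2ℚ * harmonic N} (cutoff-nonNeg d)
                 (ℚ.≤-trans (∑₁-squares≤2 M) (*-monoˡ {2ℚ} {1ℚ} {harmonic N} 0≤2 (1≤harmonic N))) ⟩
          cutoff d * (2ℚ * harmonic N)
            ≡⟨ ℚ.*-comm (cutoff d) (2ℚ * harmonic N) ⟩
          2ℚ * harmonic N * cutoff d ∎
      where
      lem : ∀ n d r → r * (n * (d * r)) ≡ n * d * (r * r)
      lem = solve-∀ ring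
      term : ∀ n .{{_ : ℕ.NonZero n}} → recip n * cutoff (d ℕ.* n) ≤ ι N * recip d * (recip n * recip n)
      term n = begin
        recip n * cutoff (d ℕ.* n)              ≤⟨ *-monoˡ {recip n} {cutoff (d ℕ.* n)} {ι N * recip (d ℕ.* n)} (recip-nonNeg n) (cutoff≤quotient (d ℕ.* n) {{ℕ.m*n≢0 d n}}) ⟩
        recip n * (ι N * recip (d ℕ.* n))       ≡⟨ cong (λ r → recip n * (ι N * r)) (recip-* d n) ⟩
        recip n * (ι N * (recip d * recip n))   ≡⟨ lem (ι N) (recip d) (recip n) ⟩
        ι N * recip d * (recip n * recip n)     ∎

    ∑-square*cutoff≤ : ∀ M d .{{_ : ℕ.NonZero d}} →
                       ∑₁ M (λ n → recip n * recip n * cutoff (d ℕ.* n)) ≤ 2ℚ * cutoff d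
    ∑-square*cutoff≤ M d = begin
      ∑₁ M (λ n → recip n * recip n * cutoff (d ℕ.* n))
        ≤⟨ ∑₁-mono M {λ n → recip n * recip n * cutoff (d ℕ.* n)} {λ n → cutoff d * (recip n * recip n)} (λ n _ → term (suc n)) ⟩
      ∑₁ M (λ n → cutoff d * (recip n * recip n))
        ≡⟨ ∑₁-distribˡ-* M (cutoff d) (λ n → recip n * recip n) ⟩
      cutoff d * ∑₁ M (λ n → recip n * recip n)
        ≤⟨ *-monoˡ {cutoff d} {∑₁ M (λ n → recip n * recip n)} {2ℚ} (cutoff-nonNeg d) (∑₁-squares≤2 M) ⟩
      cutoff d * 2ℚ
        ≡⟨ ℚ.*-comm (cutoff d) 2ℚ ⟩
      2ℚ * cutoff d ∎
      where
      term : ∀ n .{{_ : ℕ.NonZero n}} → recip n * recip n * cutoff (d ℕ.* n) ≤ cutoff d * (recip n * recip n)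
      term n = ℚ.≤-trans (*-monoˡ {recip n * recip n} {cutoff (d ℕ.* n)} {cutoff d} (square-nonNeg n) (cutoff-antitone (ℕ.m≤m*n d n)))
                         (ℚ.≤-reflexive (ℚ.*-comm (recip n * recip n) (cutoff d)))

    amplifies-recip : Amplifies cutoff (onPrimes recip) (2ℚ * harmonic N)
    amplifies-recip .weight-nonNeg = onPrimes-nonNeg {recip} recip-nonNeg
    amplifies-recip .factor-nonNeg = *-nonNeg {2ℚ} {harmonic N} 0≤2 (ℚ.≤-trans 0≤1 (1≤harmonic N))
    amplifies-recip .amplify k d   = ℚ.≤-trans
      (spread≤∑ recip recip-nonNeg refl recip-* {cutoff} cutoff-nonNeg k d) (∑-recip*cutoff≤ (k !) d)

    amplifies-square : Amplifies cutoff (onPrimes (λ n → recip n * recip n)) 2ℚ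
    amplifies-square .weight-nonNeg = onPrimes-nonNeg {λ n → recip n * recip n} square-nonNeg
    amplifies-square .factor-nonNeg = 0≤2
    amplifies-square .amplify k d   = ℚ.≤-trans
      (spread≤∑ (λ n → recip n * recip n) square-nonNeg refl square-* {cutoff} cutoff-nonNeg k d) (∑-square*cutoff≤ (k !) d)
      where
      lem : ∀ a b → (a * b) * (a * b) ≡ (a * a) * (b * b)
      lem = solve-∀ ring
      square-* : ∀ m n →
                 recip (m ℕ.* n) * recip (m ℕ.* n) ≡ (recip m * recip m) * (recip n * recip n)
      square-* m n = trans (cong (λ r → r * r) (recip-* m n)) (lem (recip m) (recip n))

    discrepancy-bound : ∀ h a K →
      (∀ n → ∣ h n ∣ ≤ ι a * onPrimes recip n + ι K * onPrimes (λ n → recip n * recip n) n) →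
      ∀ k → ∣ discrepancy N h k 1 ∣ ≤ (2ℚ * harmonic N) ^ℚ a * 2ℚ ^ℚ K
    discrepancy-bound h a K h≤ k = begin
      ∣ discrepancy N h k 1 ∣           ≤⟨ discrepancy≤spread N h {cutoff} (initial-discrepancy h) k 1 ⟩
      spread (λ n → ∣ h n ∣) k cutoff 1 ≤⟨ amplify amplifies-h k 1 ⟩
      c * cutoff 1                      ≡⟨ cong (c *_) (cutoff-≤ (ℕ.>-nonZero⁻¹ N)) ⟩
      c * 1ℚ                            ≡⟨ ℚ.*-identityʳ c ⟩
      c                                 ∎
      where
      c : ℚ
      c = (2ℚ * harmonic N) ^ℚ a * 2ℚ ^ℚ K
      0≤φ : (λ _ → 0ℚ) ≼ cutoff
      0≤φ d = cutoff-nonNeg d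
      amplifies-h : Amplifies cutoff (λ n → ∣ h n ∣) c
      amplifies-h = amplifies-≤ 0≤φ (λ n → ℚ.0≤∣p∣ (h n)) h≤
        (amplifies-+ 0≤φ (amplifies-ι* 0≤φ a amplifies-recip) (amplifies-ι* 0≤φ K amplifies-square))

-- Integer powers and finite products of rationals

module Powers where
  open import Data.Rational.Base using (_+_; _*_; _<_)
  open Rational
  open Arithmetic
  open ℚ.≤-Reasoning
  open CommutativeSemiringExp (CommutativeRing.commutativeSemiring ℚ.+-*-commutativeRing) public
    using () renaming (^-distrib-* to ^ℚ-distrib-*; ^-homo-* to ^ℚ-homo-+)

  1^ℚ : ∀ n → 1ℚ ^ℚ n ≡ 1ℚ
  1^ℚ zero    = refl
  1^ℚ (suc n) = trans (ℚ.*-identityˡ (1ℚ ^ℚ n)) (1^ℚ n)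

  ⁻¹-^ℚ : ∀ p n → (p ^ℚ n) ⁻¹ ≡ p ⁻¹ ^ℚ n
  ⁻¹-^ℚ p zero    = refl
  ⁻¹-^ℚ p (suc n) = trans (⁻¹-distrib-* p (p ^ℚ n)) (cong (p ⁻¹ *_) (⁻¹-^ℚ p n))

  ^ℚ-pos : ∀ {p} → 0ℚ < p → ∀ n → 0ℚ < p ^ℚ n
  ^ℚ-pos 0<p zero    = 0<1
  ^ℚ-pos {p} 0<p (suc n) = *-pos {p} {p ^ℚ n} 0<p (^ℚ-pos 0<p n)

  ^ℤ-distrib-* : ∀ p q z → (p * q) ^ℤ z ≡ p ^ℤ z * q ^ℤ z
  ^ℤ-distrib-* p q (+ n)    = ^ℚ-distrib-* p q n
  ^ℤ-distrib-* p q -[1+ n ] = trans (cong _⁻¹ (^ℚ-distrib-* p q (suc n))) (⁻¹-distrib-* (p ^ℚ suc n) (q ^ℚ suc n))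

  1^ℤ : ∀ z → 1ℚ ^ℤ z ≡ 1ℚ
  1^ℤ (+ n)    = 1^ℚ n
  1^ℤ -[1+ n ] = cong _⁻¹ (1^ℚ (suc n))

  -- Positivity of p cancels one factor p · p⁻¹ per step. This settles the mixed-sign cases of the
  -- addition law for exponents.
  ^ℤ-⊖ : ∀ {p} → 0ℚ < p → ∀ m n → p ^ℤ (m ℤ.⊖ n) ≡ p ^ℚ m * p ⁻¹ ^ℚ n
  ^ℤ-⊖ {p} 0<p m zero = sym (ℚ.*-identityʳ (p ^ℚ m))
  ^ℤ-⊖ {p} 0<p zero (suc n) = trans (⁻¹-^ℚ p (suc n)) (sym (ℚ.*-identityˡ (p ⁻¹ ^ℚ suc n)))
  ^ℤ-⊖ {p} 0<p (suc m) (suc n) = begin-equality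
    p ^ℤ (suc m ℤ.⊖ suc n)                   ≡⟨ cong (p ^ℤ_) (ℤ.[1+m]⊖[1+n]≡m⊖n m n) ⟩
    p ^ℤ (m ℤ.⊖ n)                           ≡⟨ ^ℤ-⊖ 0<p m n ⟩
    p ^ℚ m * p ⁻¹ ^ℚ n                       ≡⟨ sym (ℚ.*-identityˡ (p ^ℚ m * p ⁻¹ ^ℚ n)) ⟩
    1ℚ * (p ^ℚ m * p ⁻¹ ^ℚ n)                ≡⟨ cong (_* (p ^ℚ m * p ⁻¹ ^ℚ n)) (sym (⁻¹-inverseʳ 0<p)) ⟩
    p * p ⁻¹ * (p ^ℚ m * p ⁻¹ ^ℚ n)          ≡⟨ lem p (p ⁻¹) (p ^ℚ m) (p ⁻¹ ^ℚ n) ⟩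
    p ^ℚ suc m * p ⁻¹ ^ℚ suc n               ∎
    where
    lem : ∀ p q a b → p * q * (a * b) ≡ (p * a) * (q * b)
    lem = solve-∀ ring

  ^ℤ-+ : ∀ {p} → 0ℚ < p → ∀ y z → p ^ℤ (y ℤ.+ z) ≡ p ^ℤ y * p ^ℤ z
  ^ℤ-+ {p} 0<p (+ m) (+ n)       = ^ℚ-homo-+ p m n
  ^ℤ-+ {p} 0<p (+ m) -[1+ n ]    = trans (^ℤ-⊖ 0<p m (suc n)) (cong (p ^ℚ m *_) (sym (⁻¹-^ℚ p (suc n))))
  ^ℤ-+ {p} 0<p -[1+ m ] (+ n)    = trans (^ℤ-⊖ 0<p n (suc m))
    (trans (cong (p ^ℚ n *_) (sym (⁻¹-^ℚ p (suc m)))) (ℚ.*-comm (p ^ℚ n) ((p ^ℚ suc m) ⁻¹)))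
  ^ℤ-+ {p} 0<p -[1+ m ] -[1+ n ] = begin-equality
    (p ^ℚ suc (suc (m ℕ.+ n))) ⁻¹         ≡⟨ cong (λ k → (p ^ℚ suc k) ⁻¹) (sym (ℕ.+-suc m n)) ⟩
    (p ^ℚ (suc m ℕ.+ suc n)) ⁻¹           ≡⟨ cong _⁻¹ (^ℚ-homo-+ p (suc m) (suc n)) ⟩
    (p ^ℚ suc m * p ^ℚ suc n) ⁻¹          ≡⟨ ⁻¹-distrib-* (p ^ℚ suc m) (p ^ℚ suc n) ⟩
    (p ^ℚ suc m) ⁻¹ * (p ^ℚ suc n) ⁻¹     ∎

  ^ℤ-* : ∀ {p} → 0ℚ < p → ∀ n z → (p ^ℚ n) ^ℤ z ≡ p ^ℤ (+ n ℤ.* z)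
  ^ℤ-* 0<p zero z = 1^ℤ z
  ^ℤ-* {p} 0<p (suc n) z = begin-equality
    (p * p ^ℚ n) ^ℤ z               ≡⟨ ^ℤ-distrib-* p (p ^ℚ n) z ⟩
    p ^ℤ z * (p ^ℚ n) ^ℤ z          ≡⟨ cong (p ^ℤ z *_) (^ℤ-* 0<p n z) ⟩
    p ^ℤ z * p ^ℤ (+ n ℤ.* z)       ≡⟨ sym (^ℤ-+ 0<p z (+ n ℤ.* z)) ⟩
    p ^ℤ (z ℤ.+ + n ℤ.* z)          ≡⟨ cong (p ^ℤ_) (sym (ℤ.suc-* (+ n) z)) ⟩
    p ^ℤ (+ suc n ℤ.* z)            ∎

  productℚ-cong : ∀ {r} {f g : Vector ℚ r} → (∀ i → f i ≡ g i) → productℚ f ≡ productℚ g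
  productℚ-cong {zero}  f≡g = refl
  productℚ-cong {suc r} f≡g = cong₂ _*_ (f≡g Fin.zero) (productℚ-cong (f≡g ∘ Fin.suc))

  productℚ-distrib-* : ∀ {r} (f g : Vector ℚ r) → productℚ (λ i → f i * g i) ≡ productℚ f * productℚ g
  productℚ-distrib-* {zero}  f g = refl
  productℚ-distrib-* {suc r} f g = trans
    (cong (f Fin.zero * g Fin.zero *_) (productℚ-distrib-* (f ∘ Fin.suc) (g ∘ Fin.suc)))
    (lem (f Fin.zero) (g Fin.zero) (productℚ (f ∘ Fin.suc)) (productℚ (g ∘ Fin.suc)))
    where
    lem : ∀ a b c d → a * b * (c * d) ≡ (a * c) * (b * d)
    lem = solve-∀ ring

  productℚ-1 : ∀ r → productℚ {r} (λ _ → 1ℚ) ≡ 1ℚ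
  productℚ-1 zero    = refl
  productℚ-1 (suc r) = cong (1ℚ *_) (productℚ-1 r)

  productℚ-^ℤ : ∀ {p} → 0ℚ < p → ∀ {r} (z : Vector ℤ r) → productℚ (λ i → p ^ℤ z i) ≡ p ^ℤ sumℤ z
  productℚ-^ℤ {p} 0<p {zero}  z = refl
  productℚ-^ℤ {p} 0<p {suc r} z = trans (cong (p ^ℤ z Fin.zero *_) (productℚ-^ℤ 0<p (z ∘ Fin.suc)))
    (sym (^ℤ-+ 0<p (z Fin.zero) (sumℤ (z ∘ Fin.suc))))

  ∏-^ℤ : ∀ ns f z → ∏ ns f ^ℤ z ≡ ∏ ns (λ n → f n ^ℤ z)
  ∏-^ℤ []       f z = 1^ℤ z
  ∏-^ℤ (n ∷ ns) f z = trans (^ℤ-distrib-* (f n) (∏ ns f) z) (cong (f n ^ℤ z *_) (∏-^ℤ ns f z))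

  productℚ-∏ : ∀ {r} ns (f : Fin r → ℕ → ℚ) →
               productℚ (λ i → ∏ ns (f i)) ≡ ∏ ns (λ n → productℚ (λ i → f i n))
  productℚ-∏ {r} []   f = productℚ-1 r
  productℚ-∏ (n ∷ ns) f = trans (productℚ-distrib-* (λ i → f i n) (λ i → ∏ ns (f i)))
    (cong (productℚ (λ i → f i n) *_) (productℚ-∏ ns f))

  ∏-++ : ∀ ms ns f → ∏ (ms ++ ns) f ≡ ∏ ms f * ∏ ns f
  ∏-++ []       ns f = sym (ℚ.*-identityˡ (∏ ns f))
  ∏-++ (m ∷ ms) ns f = trans (cong (f m *_) (∏-++ ms ns f)) (sym (ℚ.*-assoc (f m) (∏ ms f) (∏ ns f)))

-- The Jordan totient quotient as a sieve over its prime divisors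

module JordanQuotient where
  open import Data.Rational.Base using (_+_; _*_; -_; _-_; _≤_; _<_; ∣_∣)
  open Rational
  open Arithmetic
  open Sums
  open Sieve
  open Powers
  open ℚ.≤-Reasoning

  localFactor : ∀ {r} → Vector ℤ r → ℕ → ℚ
  localFactor e p = productℚ λ i → (1ℚ - ι p ^ℤ (ℤ.- (+ suc (toℕ i)))) ^ℤ e i

  -- Collecting the powers of n over all i gives n to the weight, which is 1; what remains depends
  -- only on the set of primes dividing n.
  J-product : ∀ {r} (e : Vector ℤ r) → weight e ≡ 0ℤ → ∀ n .{{_ : ℕ.NonZero n}} →
              J e n ≡ ∏ (primeDivisors n) (localFactor e)
  J-product {r} e w≡0 n = begin-equality
    J e n
      ≡⟨ productℚ-cong (λ i → trans (^ℤ-distrib-* (ι n ^ℚ suc (toℕ i)) (∏ (primeDivisors n) (t i)) (e i))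
           (cong₂ _*_ (^ℤ-* (0<ι n) (suc (toℕ i)) (e i)) (∏-^ℤ (primeDivisors n) (t i) (e i)))) ⟩
    productℚ (λ i → ι n ^ℤ (+ suc (toℕ i) ℤ.* e i) * ∏ (primeDivisors n) (T i))
      ≡⟨ productℚ-distrib-* (λ i → ι n ^ℤ (+ suc (toℕ i) ℤ.* e i)) (λ i → ∏ (primeDivisors n) (T i)) ⟩
    productℚ (λ i → ι n ^ℤ (+ suc (toℕ i) ℤ.* e i)) * productℚ (λ i → ∏ (primeDivisors n) (T i))
      ≡⟨ cong₂ _*_ (productℚ-^ℤ (0<ι n) (λ i → + suc (toℕ i) ℤ.* e i)) (productℚ-∏ (primeDivisors n) T) ⟩
    ι n ^ℤ weight e * ∏ (primeDivisors n) (localFactor e)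
      ≡⟨ cong (λ w → ι n ^ℤ w * ∏ (primeDivisors n) (localFactor e)) w≡0 ⟩
    1ℚ * ∏ (primeDivisors n) (localFactor e)
      ≡⟨ ℚ.*-identityˡ _ ⟩
    ∏ (primeDivisors n) (localFactor e) ∎
    where
    t T : Fin r → ℕ → ℚ
    t i p = 1ℚ - ι p ^ℤ (ℤ.- (+ suc (toℕ i)))
    T i p = t i p ^ℤ e i

  primesUpTo-suc : ∀ k → primesUpTo (suc k) ≡ primesUpTo k ++ filter prime? (suc k ∷ [])
  primesUpTo-suc k = trans (cong (filter prime?) (sym (List.upTo-∷ʳ (suc k))))
                           (List.filter-++ prime? (upTo (suc k)) (suc k ∷ []))

  prime∤1 : ∀ {p} → Prime p → ¬ p ∣ 1
  prime∤1 pr p∣1 = ¬prime[1] (subst Prime (∣1⇒≡1 p∣1) pr)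

  prime∤prime : ∀ {p q} → Prime p → Prime q → q ℕ.< p → ¬ q ∣ p
  prime∤prime pr qr q<p q∣p with prime⇒irreducible pr q∣p
  ... | inj₁ refl = ¬prime[1] qr
  ... | inj₂ refl = ℕ.<-irrefl refl q<p

  module _ (g : ℕ → ℚ) where

    perturbation : ℕ → ℚ
    perturbation = onPrimes (λ p → g p - 1ℚ)

    primeDivisorProduct : ℕ → ℕ → ℚ
    primeDivisorProduct k n = ∏ (filter (_∣? n) (primesUpTo k)) g

    private
      f : ℕ → ℕ → ℚ
      f k = sieve perturbation k (λ _ → 1ℚ)

    sieve-one : ∀ k → f k 1 ≡ 1ℚ
    sieve-one zero    = refl
    sieve-one (suc k) = cong₂ _+_ (sieve-one k) step
      where
      step : perturbation (suc k) * dilate (suc k) (f k) 1 ≡ 0ℚ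
      step with prime? (suc k)
      ... | no _   = ℚ.*-zeroˡ (dilate (suc k) (f k) 1)
      ... | yes pr = trans (cong ((g (suc k) - 1ℚ) *_) (dilate-∤ (f k) (prime∤1 pr))) (ℚ.*-zeroʳ (g (suc k) - 1ℚ))

    -- A prime above k is coprime to every q already adjoined, so it can be inserted or removed
    -- without changing the value.
    sieve-*-prime : ∀ k {p} → Prime p → k ℕ.< p → ∀ m → f k (m ℕ.* p) ≡ f k m
    sieve-*-prime zero    pr k<p m = refl
    sieve-*-prime (suc k) {p} pr k<p m = cong₂ _+_ (ih m) step
      where
      ih : ∀ m → f k (m ℕ.* p) ≡ f k m
      ih = sieve-*-prime k pr (ℕ.<-trans (ℕ.n<1+n k) k<p)
      dilate-step : Prime (suc k) → dilate (suc k) (f k) (m ℕ.* p) ≡ dilate (suc k) (f k) m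
      dilate-step qr with suc k ∣? m
      ... | yes (divides j refl) = trans (cong (dilate (suc k) (f k)) swap) (trans (dilate-* (suc k) (f k) (j ℕ.* p)) (ih j))
        where
        swap : j ℕ.* suc k ℕ.* p ≡ j ℕ.* p ℕ.* suc k
        swap = trans (ℕ.*-assoc j (suc k) p) (trans (cong (j ℕ.*_) (ℕ.*-comm (suc k) p)) (sym (ℕ.*-assoc j p (suc k))))
      ... | no q∤m = dilate-∤ (f k) λ q∣mp → [ q∤m , prime∤prime pr qr k<p ]′ (euclidsLemma m p qr q∣mp)
      step : perturbation (suc k) * dilate (suc k) (f k) (m ℕ.* p) ≡ perturbation (suc k) * dilate (suc k) (f k) m
      step with prime? (suc k)
      ... | no _   = trans (ℚ.*-zeroˡ (dilate (suc k) (f k) (m ℕ.* p))) (sym (ℚ.*-zeroˡ (dilate (suc k) (f k) m)))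
      ... | yes qr = cong ((g (suc k) - 1ℚ) *_) (dilate-step qr)

    primeDivisorProduct-suc : ∀ k n → primeDivisorProduct (suc k) n ≡
      primeDivisorProduct k n * ∏ (filter (_∣? n) (filter prime? (suc k ∷ []))) g
    primeDivisorProduct-suc k n = begin-equality
      ∏ (filter (_∣? n) (primesUpTo (suc k))) g
        ≡⟨ cong (λ ps → ∏ (filter (_∣? n) ps) g) (primesUpTo-suc k) ⟩
      ∏ (filter (_∣? n) (primesUpTo k ++ filter prime? (suc k ∷ []))) g
        ≡⟨ cong (λ ps → ∏ ps g) (List.filter-++ (_∣? n) (primesUpTo k) (filter prime? (suc k ∷ []))) ⟩
      ∏ (filter (_∣? n) (primesUpTo k) ++ filter (_∣? n) (filter prime? (suc k ∷ []))) g
        ≡⟨ ∏-++ (filter (_∣? n) (primesUpTo k)) (filter (_∣? n) (filter prime? (suc k ∷ []))) g ⟩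
      primeDivisorProduct k n * ∏ (filter (_∣? n) (filter prime? (suc k ∷ []))) g ∎

    -- When the prime q = k + 1 divides n, the recursion adds (g(q) - 1) times the value at n/q, and
    -- that value equals the one at n; the total is multiplied by g(q).
    sieve≡primeDivisorProduct : ∀ k n → f k n ≡ primeDivisorProduct k n
    sieve≡primeDivisorProduct zero    n = refl
    sieve≡primeDivisorProduct (suc k) n = trans step (sym (primeDivisorProduct-suc k n))
      where
      ih : f k n ≡ primeDivisorProduct k n
      ih = sieve≡primeDivisorProduct k n
      lem₀ : ∀ a b → a + 0ℚ * b ≡ a * 1ℚ
      lem₀ = solve-∀ ring
      lem₁ : ∀ a b → a + b * 0ℚ ≡ a * 1ℚ
      lem₁ = solve-∀ ring
      lem₂ : ∀ a b → a + (b - 1ℚ) * a ≡ a * (b * 1ℚ)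
      lem₂ = solve-∀ ring
      step : f (suc k) n ≡ primeDivisorProduct k n * ∏ (filter (_∣? n) (filter prime? (suc k ∷ []))) g
      step with prime? (suc k)
      ... | no _ = trans (lem₀ (f k n) (dilate (suc k) (f k) n)) (cong (_* 1ℚ) ih)
      ... | yes pr with suc k ∣? n
      ...   | no q∤n = trans (trans (lem₁ (f k n) (g (suc k) - 1ℚ)) (cong (_* 1ℚ) ih))
              (cong (λ ps → primeDivisorProduct k n * ∏ ps g) (sym (List.filter-reject (_∣? n) {xs = []} q∤n)))
      ...   | yes q∣n@(divides m eq) = begin-equality
              -- The cofactor m may still be divisible by `suc k`; the invariance used here holds
              -- for every m, so multiplicities do not matter.
              f k n + (g (suc k) - 1ℚ) * f k m       ≡⟨ cong (λ s → f k n + (g (suc k) - 1ℚ) * s) (sym (sieve-*-prime k pr ℕ.≤-refl m)) ⟩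
              f k n + (g (suc k) - 1ℚ) * f k (m ℕ.* suc k) ≡⟨ cong (λ j → f k n + (g (suc k) - 1ℚ) * f k j) (sym eq) ⟩
              f k n + (g (suc k) - 1ℚ) * f k n       ≡⟨ lem₂ (f k n) (g (suc k)) ⟩
              f k n * (g (suc k) * 1ℚ)               ≡⟨ cong (_* (g (suc k) * 1ℚ)) ih ⟩
              primeDivisorProduct k n * (g (suc k) * 1ℚ)
                ≡⟨ cong (λ ps → primeDivisorProduct k n * ∏ ps g) (sym (List.filter-accept (_∣? n) {xs = []} q∣n)) ⟩
              primeDivisorProduct k n * ∏ (filter (_∣? n) (suc k ∷ [])) g ∎

    -- No q > n divides a positive n. Thus any level k ≥ n already gives the exact value, which
    -- allows k to be tied to the index of a real approximant.
    sieve-stable : ∀ {k n} .{{_ : ℕ.NonZero n}} → n ℕ.≤ k → f k n ≡ f n n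
    sieve-stable {k} {n} n≤k with ℕ.m≤n⇒∃[o]m+o≡n n≤k
    ... | o , refl = trans (cong (λ j → f j n) (ℕ.+-comm n o)) (go o)
      where
      lem : ∀ a b → a + b * 0ℚ ≡ a
      lem = solve-∀ ring
      go : ∀ o → f (o ℕ.+ n) n ≡ f n n
      go zero    = refl
      go (suc o) = trans (cong (λ s → f (o ℕ.+ n) n + perturbation q * s) (dilate-∤ (f (o ℕ.+ n)) λ q∣n → ℕ.<⇒≱ (ℕ.s≤s (ℕ.m≤n+m n o)) (∣⇒≤ q∣n)))
          (trans (lem (f (o ℕ.+ n) n) (perturbation q)) (go o))
        where
        q : ℕ
        q = suc (o ℕ.+ n)

    primeDivisorProduct-prime : ∀ {p} → Prime p → primeDivisorProduct p p ≡ g p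
    primeDivisorProduct-prime {suc k} pr = begin-equality
      primeDivisorProduct (suc k) (suc k)   ≡⟨ sym (sieve≡primeDivisorProduct (suc k) (suc k)) ⟩
      f k (suc k) + perturbation (suc k) * dilate (suc k) (f k) (suc k)
        ≡⟨ cong₂ (λ s t → s + t * dilate (suc k) (f k) (suc k)) (one (f k) (sieve-*-prime k pr ℕ.≤-refl 1) (sieve-one k)) at-prime ⟩
      1ℚ + (g (suc k) - 1ℚ) * dilate (suc k) (f k) (suc k)
        ≡⟨ cong (λ s → 1ℚ + (g (suc k) - 1ℚ) * s) (one (dilate (suc k) (f k)) (dilate-* (suc k) (f k) 1) (sieve-one k)) ⟩
      1ℚ + (g (suc k) - 1ℚ) * 1ℚ
        ≡⟨ lem (g (suc k)) ⟩
      g (suc k) ∎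
      where
      lem : ∀ a → 1ℚ + (a - 1ℚ) * 1ℚ ≡ a
      lem = solve-∀ ring
      one : ∀ (F : ℕ → ℚ) {x y} → F (1 ℕ.* suc k) ≡ x → x ≡ y → F (suc k) ≡ y
      one F eq eq′ = trans (cong F (sym (ℕ.*-identityˡ (suc k)))) (trans eq eq′)
      at-prime : perturbation (suc k) ≡ g (suc k) - 1ℚ
      at-prime with prime? (suc k)
      ... | yes _  = refl
      ... | no ¬pr = contradiction pr ¬pr

  module _ {r} (e : Vector ℤ r) (w≡0 : weight e ≡ 0ℤ) where

    J-prime : ∀ {p} → Prime p → J e p ≡ localFactor e p
    J-prime {p@(suc _)} pr = trans (J-product e w≡0 p) (primeDivisorProduct-prime (localFactor e) pr)

    J≡sieve : ∀ {k n} .{{_ : ℕ.NonZero n}} → n ℕ.≤ k →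
              J e n ≡ sieve (perturbation (localFactor e)) k (λ _ → 1ℚ) n
    J≡sieve {k} {n} n≤k = trans (J-product e w≡0 n)
      (trans (sym (sieve≡primeDivisorProduct (localFactor e) n n)) (sym (sieve-stable (localFactor e) n≤k)))

    eulerFactor≡ : ∀ {p} → Prime p → eulerFactor e p ≡ 1ℚ + (localFactor e p - 1ℚ) * recip p
    eulerFactor≡ {p} pr = cong (λ s → 1ℚ + (s - 1ℚ) * recip p)
      (trans (cong₂ _*_ (J-prime pr) (cong (λ w → ι p ^ℤ (ℤ.- w)) w≡0)) (ℚ.*-identityʳ (localFactor e p)))

    eulerProduct≡ : ∀ k → eulerProduct e k ≡ partialProduct (perturbation (localFactor e)) k
    eulerProduct≡ zero    = refl
    eulerProduct≡ (suc k) = begin-equality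
      ∏ (primesUpTo (suc k)) (eulerFactor e)                                    ≡⟨ cong (λ ps → ∏ ps (eulerFactor e)) (primesUpTo-suc k) ⟩
      ∏ (primesUpTo k ++ filter prime? (suc k ∷ [])) (eulerFactor e)            ≡⟨ ∏-++ (primesUpTo k) (filter prime? (suc k ∷ [])) (eulerFactor e) ⟩
      eulerProduct e k * ∏ (filter prime? (suc k ∷ [])) (eulerFactor e)         ≡⟨ cong₂ _*_ (eulerProduct≡ k) step ⟩
      partialProduct (perturbation (localFactor e)) (suc k)                     ∎
      where
      step : ∏ (filter prime? (suc k ∷ [])) (eulerFactor e) ≡ 1ℚ + perturbation (localFactor e) (suc k) * recip (suc k)
      step with prime? (suc k)
      ... | no _   = sym (trans (cong (λ s → 1ℚ + s) (ℚ.*-zeroˡ (recip (suc k)))) (ℚ.+-identityʳ 1ℚ))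
      ... | yes pr = trans (ℚ.*-identityʳ (eulerFactor e (suc k))) (eulerFactor≡ pr)

-- Size of the local factors at a prime

module LocalFactors where
  open import Data.Rational.Base using (_+_; _*_; -_; _-_; _≤_; _<_; ∣_∣)
  open Rational
  open Arithmetic
  open Sieve
  open SieveBound using (2ℚ; 0≤2)
  open Powers
  open JordanQuotient
  open ℚ.≤-Reasoning

  -- X(p) = 1 + O(α/p + 1/p²), where the constant α of the leading term is exact.
  record Near (α : ℚ) (X : ℕ → ℚ) : Set where
    field
      α-nonNeg : 0ℚ ≤ α
      K        : ℚ
      K-nonNeg : 0ℚ ≤ K
      pos      : ∀ p → 2 ℕ.≤ p → 0ℚ < X p
      close    : ∀ p → 2 ℕ.≤ p → ∣ X p - 1ℚ ∣ ≤ α * recip p + K * (recip p * recip p)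
  open Near public

  recip≤½ : ∀ {p} → 2 ℕ.≤ p → recip p ≤ ½
  recip≤½ {p} 2≤p = recip-antitone {2} {p} 2≤p

  square≤recip : ∀ p → recip p * recip p ≤ recip p
  square≤recip p = subst (recip p * recip p ≤_) (ℚ.*-identityˡ (recip p))
    (*-monoʳ {recip p} {recip p} {1ℚ} (recip-nonNeg p) (recip≤1 p))

  near-1 : Near 0ℚ (λ _ → 1ℚ)
  near-1 .α-nonNeg    = ℚ.≤-refl
  near-1 .K           = 0ℚ
  near-1 .K-nonNeg    = ℚ.≤-refl
  near-1 .pos p _     = 0<1
  near-1 .close p _   = ℚ.≤-reflexive (lem (recip p))
    where
    lem : ∀ t → 0ℚ ≡ 0ℚ * t + 0ℚ * (t * t)
    lem = solve-∀ ring

  near-cong : ∀ {α β X Y} → α ≡ β → (∀ p → X p ≡ Y p) → Near α X → Near β Y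
  near-cong refl X≡Y NX .α-nonNeg     = α-nonNeg NX
  near-cong refl X≡Y NX .K            = K NX
  near-cong refl X≡Y NX .K-nonNeg     = K-nonNeg NX
  near-cong refl X≡Y NX .pos p 2≤p    = subst (0ℚ <_) (X≡Y p) (pos NX p 2≤p)
  near-cong {α} refl X≡Y NX .close p 2≤p  =
    subst (λ x → ∣ x - 1ℚ ∣ ≤ α * recip p + K NX * (recip p * recip p)) (X≡Y p) (close NX p 2≤p)

  -- The deviations add, and their product is of second order, so it goes into `K`; the leading
  -- constants add without loss.
  near-* : ∀ {α β X Y} → Near α X → Near β Y → Near (α + β) (λ p → X p * Y p)
  near-* {α} {β} NX NY .α-nonNeg = +-nonNeg {α} {β} (α-nonNeg NX) (α-nonNeg NY)
  near-* {α} {β} NX NY .K        = K NX + K NY + (α + K NX) * (β + K NY)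
  near-* {α} {β} NX NY .K-nonNeg = +-nonNeg {K NX + K NY} (+-nonNeg {K NX} (K-nonNeg NX) (K-nonNeg NY))
    (*-nonNeg {α + K NX} (+-nonNeg {α} (α-nonNeg NX) (K-nonNeg NX)) (+-nonNeg {β} (α-nonNeg NY) (K-nonNeg NY)))
  near-* {X = X} {Y} NX NY .pos p 2≤p = *-pos {X p} {Y p} (pos NX p 2≤p) (pos NY p 2≤p)
  near-* {α} {β} {X} {Y} NX NY .close p 2≤p = begin
    ∣ X p * Y p - 1ℚ ∣                            ≡⟨ cong ∣_∣ (lem₁ (X p) (Y p)) ⟩
    ∣ (x + y) + x * y ∣                           ≤⟨ ℚ.∣p+q∣≤∣p∣+∣q∣ (x + y) (x * y) ⟩
    ∣ x + y ∣ + ∣ x * y ∣                         ≤⟨ ℚ.+-mono-≤ (ℚ.∣p+q∣≤∣p∣+∣q∣ x y) (ℚ.≤-reflexive (ℚ.∣p*q∣≡∣p∣*∣q∣ x y)) ⟩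
    (∣ x ∣ + ∣ y ∣) + ∣ x ∣ * ∣ y ∣               ≤⟨ ℚ.+-mono-≤ (ℚ.+-mono-≤ x≤ y≤) (*-mono {∣ x ∣} {(α + K NX) * t} {∣ y ∣} {(β + K NY) * t} (ℚ.0≤∣p∣ x)
                                                       (ℚ.≤-trans (ℚ.0≤∣p∣ y) y≤′) x≤′ y≤′) ⟩
    (α * t + K NX * (t * t)) + (β * t + K NY * (t * t)) + (α + K NX) * t * ((β + K NY) * t)
      ≡⟨ lem₂ α β (K NX) (K NY) t ⟩
    (α + β) * t + (K NX + K NY + (α + K NX) * (β + K NY)) * (t * t) ∎
    where
    t x y : ℚ
    t = recip p
    x = X p - 1ℚ
    y = Y p - 1ℚ
    x≤ : ∣ x ∣ ≤ α * t + K NX * (t * t)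
    x≤ = close NX p 2≤p
    y≤ : ∣ y ∣ ≤ β * t + K NY * (t * t)
    y≤ = close NY p 2≤p
    linear : ∀ a k → 0ℚ ≤ k → a * t + k * (t * t) ≤ (a + k) * t
    linear a k 0≤k = ℚ.≤-trans (ℚ.+-monoʳ-≤ (a * t) (*-monoˡ {k} {t * t} {t} 0≤k (square≤recip p)))
      (ℚ.≤-reflexive (sym (ℚ.*-distribʳ-+ t a k)))
    x≤′ : ∣ x ∣ ≤ (α + K NX) * t
    x≤′ = ℚ.≤-trans x≤ (linear α (K NX) (K-nonNeg NX))
    y≤′ : ∣ y ∣ ≤ (β + K NY) * t
    y≤′ = ℚ.≤-trans y≤ (linear β (K NY) (K-nonNeg NY))
    lem₁ : ∀ x y → x * y - 1ℚ ≡ ((x - 1ℚ) + (y - 1ℚ)) + (x - 1ℚ) * (y - 1ℚ)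
    lem₁ = solve-∀ ring
    lem₂ : ∀ a b k l t → (a * t + k * (t * t)) + (b * t + l * (t * t)) + (a + k) * t * ((b + l) * t)
           ≡ (a + b) * t + (k + l + (a + k) * (b + l)) * (t * t)
    lem₂ = solve-∀ ring

  near-^ℚ : ∀ {α X} → Near α X → ∀ n → Near (ι n * α) (λ p → X p ^ℚ n)
  near-^ℚ {α} NX zero    = near-cong (sym (ℚ.*-zeroˡ α)) (λ _ → refl) near-1
  near-^ℚ {α} NX (suc n) = near-cong (trans (lem α (ι n)) (cong (_* α) (sym (ι-suc n)))) (λ _ → refl)
    (near-* NX (near-^ℚ NX n))
    where
    lem : ∀ a n → a + n * a ≡ (n + 1ℚ) * a
    lem = solve-∀ ring

  -- Both X and its inverse are assumed to have leading constant α, so the sign of the exponent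
  -- disappears; this is where |e₁| comes from.
  near-^ℤ : ∀ {α X} → Near α X → Near α (λ p → X p ⁻¹) → ∀ z → Near (ι ∣ z ∣ℤ * α) (λ p → X p ^ℤ z)
  near-^ℤ NX NX⁻¹ (+ n)            = near-^ℚ NX n
  near-^ℤ {X = X} NX NX⁻¹ -[1+ n ] = near-cong refl (λ p → sym (⁻¹-^ℚ (X p) (suc n))) (near-^ℚ NX⁻¹ (suc n))

  near-∏ : ∀ {r} {X : Fin r → ℕ → ℚ} → (∀ i → Near 0ℚ (X i)) → Near 0ℚ (λ p → productℚ (λ i → X i p))
  near-∏ {zero}  NX = near-1
  near-∏ {suc r} NX = near-* (NX Fin.zero) (near-∏ (NX ∘ Fin.suc))

  module _ {α K₀ : ℚ} {s : ℕ → ℚ} (0≤α : 0ℚ ≤ α) (0≤K₀ : 0ℚ ≤ K₀) (0≤s : ∀ p → 0ℚ ≤ s p) (s≤recip : ∀ p → s p ≤ recip p)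
           (s≤ : ∀ p → s p ≤ α * recip p + K₀ * (recip p * recip p)) where

    ½≤1-s : ∀ {p} → 2 ℕ.≤ p → ½ ≤ 1ℚ - s p
    ½≤1-s {p} 2≤p = ℚ.+-monoʳ-≤ 1ℚ (ℚ.neg-antimono-≤ (ℚ.≤-trans (s≤recip p) (recip≤½ {p} 2≤p)))

    0<1-s : ∀ {p} → 2 ℕ.≤ p → 0ℚ < 1ℚ - s p
    0<1-s {p} 2≤p = ℚ.<-≤-trans (ℚ.positive⁻¹ ½) (½≤1-s {p} 2≤p)

    near-1-s : Near α (λ p → 1ℚ - s p)
    near-1-s .α-nonNeg    = 0≤α
    near-1-s .K           = K₀
    near-1-s .K-nonNeg    = 0≤K₀
    near-1-s .pos p 2≤p   = 0<1-s {p} 2≤p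
    near-1-s .close p 2≤p = begin
      ∣ 1ℚ - s p - 1ℚ ∣    ≡⟨ cong ∣_∣ (lem (s p)) ⟩
      ∣ - s p ∣            ≡⟨ ℚ.∣-p∣≡∣p∣ (s p) ⟩
      ∣ s p ∣              ≡⟨ ℚ.0≤p⇒∣p∣≡p (0≤s p) ⟩
      s p                  ≤⟨ s≤ p ⟩
      α * recip p + K₀ * (recip p * recip p) ∎
      where
      lem : ∀ s → 1ℚ - s - 1ℚ ≡ - s
      lem = solve-∀ ring

    -- 1/(1 − s) = 1 + s + s²/(1 − s)
    near-[1-s]⁻¹ : Near α (λ p → (1ℚ - s p) ⁻¹)
    near-[1-s]⁻¹ .α-nonNeg    = 0≤α
    near-[1-s]⁻¹ .K           = K₀ + 2ℚ
    near-[1-s]⁻¹ .K-nonNeg    = +-nonNeg {K₀} {2ℚ} 0≤K₀ 0≤2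
    near-[1-s]⁻¹ .pos p 2≤p   = ⁻¹-pos (0<1-s {p} 2≤p)
    near-[1-s]⁻¹ .close p 2≤p = begin
      ∣ i - 1ℚ ∣                    ≡⟨ cong ∣_∣ (trans (lem₁ x i) (cong (λ u → x + x * x * i + (1ℚ + x) * (u - 1ℚ)) inverse)) ⟩
      ∣ x + x * x * i + (1ℚ + x) * (1ℚ - 1ℚ) ∣   ≡⟨ cong ∣_∣ (lem₂ x i) ⟩
      ∣ x + x * x * i ∣             ≡⟨ ℚ.0≤p⇒∣p∣≡p (+-nonNeg {x} {x * x * i} (0≤s p) (*-nonNeg {x * x} {i} (*-nonNeg {x} {x} (0≤s p) (0≤s p)) 0≤i)) ⟩
      x + x * x * i                 ≤⟨ ℚ.+-mono-≤ (s≤ p) (*-mono {x * x} {t * t} {i} {2ℚ} (*-nonNeg {x} {x} (0≤s p) (0≤s p)) 0≤2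
                                         (*-mono {x} {t} {x} {t} (0≤s p) (recip-nonNeg p) (s≤recip p) (s≤recip p)) (⁻¹-antitone (ℚ.positive⁻¹ ½) (½≤1-s {p} 2≤p))) ⟩
      α * t + K₀ * (t * t) + t * t * 2ℚ   ≡⟨ lem₃ α K₀ t ⟩
      α * t + (K₀ + 2ℚ) * (t * t)   ∎
      where
      t x i : ℚ
      t = recip p
      x = s p
      i = (1ℚ - x) ⁻¹
      0≤i : 0ℚ ≤ i
      0≤i = ⁻¹-nonNeg (0<1-s {p} 2≤p)
      inverse : (1ℚ - x) * i ≡ 1ℚ
      inverse = ⁻¹-inverseʳ (0<1-s {p} 2≤p)
      lem₁ : ∀ x i → i - 1ℚ ≡ x + x * x * i + (1ℚ + x) * ((1ℚ - x) * i - 1ℚ)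
      lem₁ = solve-∀ ring
      lem₂ : ∀ x i → x + x * x * i + (1ℚ + x) * (1ℚ - 1ℚ) ≡ x + x * x * i
      lem₂ = solve-∀ ring
      lem₃ : ∀ a k t → a * t + k * (t * t) + t * t * (1ℚ + 1ℚ) ≡ a * t + (k + (1ℚ + 1ℚ)) * (t * t)
      lem₃ = solve-∀ ring

  ^ℚ-nonNeg : ∀ {p} → 0ℚ ≤ p → ∀ n → 0ℚ ≤ p ^ℚ n
  ^ℚ-nonNeg 0≤p zero    = 0≤1
  ^ℚ-nonNeg {p} 0≤p (suc n) = *-nonNeg {p} {p ^ℚ n} 0≤p (^ℚ-nonNeg 0≤p n)

  ^ℚ≤1 : ∀ {p} → 0ℚ ≤ p → p ≤ 1ℚ → ∀ n → p ^ℚ n ≤ 1ℚ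
  ^ℚ≤1 0≤p p≤1 zero    = ℚ.≤-refl
  ^ℚ≤1 {p} 0≤p p≤1 (suc n) = *-mono {p} {1ℚ} {p ^ℚ n} {1ℚ} 0≤p 0≤1 p≤1 (^ℚ≤1 0≤p p≤1 n)

  recip-^ℤ : ∀ p j → recip p ^ℚ suc j ≡ ι p ^ℤ (ℤ.- (+ suc j))
  recip-^ℤ p j = sym (⁻¹-^ℚ (ι p) (suc j))

  module _ (j : ℕ) where
    private
      s : ℕ → ℚ
      s p = ι p ^ℤ (ℤ.- (+ suc j))

    power-nonNeg : ∀ p → 0ℚ ≤ s p
    power-nonNeg p = subst (0ℚ ≤_) (recip-^ℤ p j) (^ℚ-nonNeg (recip-nonNeg p) (suc j))

    power≤recip : ∀ p → s p ≤ recip p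
    power≤recip p = begin
      s p                     ≡⟨ sym (recip-^ℤ p j) ⟩
      recip p * recip p ^ℚ j  ≤⟨ *-monoˡ {recip p} {recip p ^ℚ j} {1ℚ} (recip-nonNeg p) (^ℚ≤1 (recip-nonNeg p) (recip≤1 p) j) ⟩
      recip p * 1ℚ            ≡⟨ ℚ.*-identityʳ (recip p) ⟩
      recip p                 ∎

  power≤ : ∀ p → ι p ^ℤ (ℤ.- (+ 1)) ≤ 1ℚ * recip p + 0ℚ * (recip p * recip p)
  power≤ p = ℚ.≤-trans (power≤recip 0 p) (ℚ.≤-reflexive (lem (recip p)))
    where
    lem : ∀ t → t ≡ 1ℚ * t + 0ℚ * (t * t)
    lem = solve-∀ ring

  power≤square : ∀ j p → ι p ^ℤ (ℤ.- (+ suc (suc j))) ≤ 0ℚ * recip p + 1ℚ * (recip p * recip p)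
  power≤square j p = begin
    ι p ^ℤ (ℤ.- (+ suc (suc j)))          ≡⟨ sym (recip-^ℤ p (suc j)) ⟩
    recip p * recip p ^ℚ suc j            ≤⟨ *-monoˡ {recip p} {recip p ^ℚ suc j} {recip p} (recip-nonNeg p)
                                               (subst (_≤ recip p) (sym (recip-^ℤ p j)) (power≤recip j p)) ⟩
    recip p * recip p                     ≡⟨ lem (recip p) ⟩
    0ℚ * recip p + 1ℚ * (recip p * recip p) ∎
    where
    lem : ∀ t → t * t ≡ 0ℚ * t + 1ℚ * (t * t)
    lem = solve-∀ ring

  linearFactor : ℕ → ℕ → ℚ
  linearFactor j p = 1ℚ - ι p ^ℤ (ℤ.- (+ suc j))

  -- Only the Jordan totient of order 1 has a deviation of first order; p⁻ⁱ with i ≥ 2 is absorbed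
  -- by 1/p².
  lead : ℕ → ℚ
  lead zero    = 1ℚ
  lead (suc _) = 0ℚ

  near-linearFactor : ∀ j → Near (lead j) (linearFactor j)
  near-linearFactor zero    = near-1-s {1ℚ} {0ℚ} {λ p → ι p ^ℤ (ℤ.- (+ 1))} 0≤1 ℚ.≤-refl (power-nonNeg 0) (power≤recip 0) power≤
  near-linearFactor (suc j) = near-1-s {0ℚ} {1ℚ} {λ p → ι p ^ℤ (ℤ.- (+ suc (suc j)))} ℚ.≤-refl 0≤1 (power-nonNeg (suc j)) (power≤recip (suc j)) (power≤square j)

  near-linearFactor⁻¹ : ∀ j → Near (lead j) (λ p → linearFactor j p ⁻¹)
  near-linearFactor⁻¹ zero    = near-[1-s]⁻¹ {1ℚ} {0ℚ} {λ p → ι p ^ℤ (ℤ.- (+ 1))} 0≤1 ℚ.≤-refl (power-nonNeg 0) (power≤recip 0) power≤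
  near-linearFactor⁻¹ (suc j) = near-[1-s]⁻¹ {0ℚ} {1ℚ} {λ p → ι p ^ℤ (ℤ.- (+ suc (suc j)))} ℚ.≤-refl 0≤1 (power-nonNeg (suc j)) (power≤recip (suc j)) (power≤square j)

  near-power : ∀ j z → Near (ι ∣ z ∣ℤ * lead j) (λ p → linearFactor j p ^ℤ z)
  near-power j z = near-^ℤ {lead j} {linearFactor j} (near-linearFactor j) (near-linearFactor⁻¹ j) z

  -- Splitting off i = 1 leaves factors with leading constant 0, whose product again has leading
  -- constant 0 for any number of factors.
  near-localFactor : ∀ {r} (e : Vector ℤ (suc r)) → Near (ι ∣ head e ∣ℤ) (localFactor e)
  near-localFactor {r} e = near-cong {ι ∣ head e ∣ℤ * 1ℚ + 0ℚ} {ι ∣ head e ∣ℤ} {localFactor e} {localFactor e}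
      (lem (ι ∣ head e ∣ℤ)) (λ _ → refl)
      (near-* {ι ∣ head e ∣ℤ * 1ℚ} {0ℚ} {λ p → linearFactor 0 p ^ℤ head e} {λ p → productℚ (λ i → X i p)}
        (near-power 0 (head e)) (near-∏ {r} {X} near-X))
    where
    X : Fin r → ℕ → ℚ
    X i p = linearFactor (suc (toℕ i)) p ^ℤ e (Fin.suc i)
    near-X : ∀ i → Near 0ℚ (X i)
    near-X i = near-cong {ι ∣ e (Fin.suc i) ∣ℤ * 0ℚ} {0ℚ} {X i} {X i} (ℚ.*-zeroʳ (ι ∣ e (Fin.suc i) ∣ℤ)) (λ _ → refl)
      (near-power (suc (toℕ i)) (e (Fin.suc i)))
    lem : ∀ a → a * 1ℚ + 0ℚ ≡ a
    lem = solve-∀ ring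

  prime≥2 : ∀ {p} → Prime p → 2 ℕ.≤ p
  prime≥2 {p} pr = ℕ.nonTrivial⇒n>1 p {{prime⇒nonTrivial pr}}

  module _ (a : ℕ) (g : ℕ → ℚ) (near : Near (ι a) g) where

    -- Rounded up to a natural number because it counts convolved copies of 1/n².
    errorConstant : ℕ
    errorConstant = proj₁ (archimedean (K near))

    perturbation-bound : ∀ n → ∣ perturbation g n ∣ ≤
      ι a * onPrimes recip n + ι errorConstant * onPrimes (λ n → recip n * recip n) n
    perturbation-bound n with prime? n
    ... | no _   = ℚ.≤-reflexive (lem (ι a) (ι errorConstant))
      where
      lem : ∀ a k → 0ℚ ≡ a * 0ℚ + k * 0ℚ
      lem = solve-∀ ring
    ... | yes pr = ℚ.≤-trans (close near n (prime≥2 pr)) (ℚ.+-monoʳ-≤ (ι a * recip n)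
      (*-monoʳ {recip n * recip n} {K near} {ι errorConstant} (square-nonNeg n) (proj₂ (archimedean (K near)))))

    -- A cruder bound, enough for the Euler product: there h(n) is divided by n once more, and the
    -- deviations are O(1/n²).
    perturbation≤recip : ∀ n → ∣ perturbation g n ∣ ≤ (ι a + ι errorConstant) * recip n
    perturbation≤recip n = begin
      ∣ perturbation g n ∣        ≤⟨ perturbation-bound n ⟩
      ι a * onPrimes recip n + k * onPrimes (λ n → recip n * recip n) n
        ≤⟨ ℚ.+-mono-≤ (*-monoˡ {ι a} {onPrimes recip n} {recip n} (0≤ι a) (onPrimes≤ recip ℚ.≤-refl))
                      (*-monoˡ {k} {onPrimes (λ n → recip n * recip n) n} {recip n} (0≤ι errorConstant) (onPrimes≤ (λ n → recip n * recip n) (square≤recip n))) ⟩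
      ι a * recip n + k * recip n                 ≡⟨ sym (ℚ.*-distribʳ-+ (recip n) (ι a) k) ⟩
      (ι a + k) * recip n                         ∎
      where
      k : ℚ
      k = ι errorConstant
      onPrimes≤ : ∀ f → f n ≤ recip n → onPrimes f n ≤ recip n
      onPrimes≤ f f≤ with prime? n
      ... | yes _ = f≤
      ... | no _  = recip-nonNeg n

    -- 1 + (g − 1)/p = (1 − 1/p) + g/p
    factor-pos : ∀ n → 0ℚ < 1ℚ + perturbation g n * recip n
    factor-pos n with prime? n
    ... | no _   = subst (0ℚ <_) (sym (trans (cong (λ s → 1ℚ + s) (ℚ.*-zeroˡ (recip n))) (ℚ.+-identityʳ 1ℚ))) 0<1
    ... | yes pr = subst (0ℚ <_) (lem (g n) (recip n)) (ℚ.<-≤-trans (ℚ.positive⁻¹ ½)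
        (ℚ.≤-trans (ℚ.+-monoʳ-≤ 1ℚ (ℚ.neg-antimono-≤ (recip≤½ {n} (prime≥2 pr))))
                   (p≤p+q {1ℚ - recip n} {g n * recip n} (*-nonNeg {g n} {recip n} (ℚ.<⇒≤ (pos near n (prime≥2 pr))) (recip-nonNeg n)))))
      where
      lem : ∀ g t → 1ℚ - t + g * t ≡ 1ℚ + (g - 1ℚ) * t
      lem = solve-∀ ring

-- Convergence and positivity of the Euler product

module EulerProduct where
  open import Data.Rational.Base using (_+_; _*_; -_; _-_; _≤_; _<_; ∣_∣)
  open Rational
  open Arithmetic
  open Sieve
  open ℚ.≤-Reasoning

  module _ (h : ℕ → ℚ) (A B : ℚ) (0≤A : 0ℚ ≤ A) (h≤ : ∀ n → ∣ h n ∣ ≤ A * recip n)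
           (factor-pos : ∀ n → 0ℚ < 1ℚ + h n * recip n) (bounded : ∀ k → partialProduct h k ≤ B) where
    private
      P : ℕ → ℚ
      P = partialProduct h

    partialProduct-pos : ∀ k → 0ℚ < P k
    partialProduct-pos zero    = 0<1
    partialProduct-pos (suc k) = *-pos {P k} {1ℚ + h (suc k) * recip (suc k)} (partialProduct-pos k) (factor-pos (suc k))

    0≤B : 0ℚ ≤ B
    0≤B = ℚ.≤-trans 0≤1 (bounded 0)

    0≤BA : 0ℚ ≤ B * A
    0≤BA = *-nonNeg {B} {A} 0≤B 0≤A

    deviation : ∀ n → ∣ h n * recip n ∣ ≤ A * (recip n * recip n)
    deviation n = begin
      ∣ h n * recip n ∣          ≡⟨ ℚ.∣p*q∣≡∣p∣*∣q∣ (h n) (recip n) ⟩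
      ∣ h n ∣ * ∣ recip n ∣      ≡⟨ cong (∣ h n ∣ *_) (ℚ.0≤p⇒∣p∣≡p (recip-nonNeg n)) ⟩
      ∣ h n ∣ * recip n          ≤⟨ *-monoʳ {recip n} {∣ h n ∣} {A * recip n} (recip-nonNeg n) (h≤ n) ⟩
      A * recip n * recip n      ≡⟨ ℚ.*-assoc A (recip n) (recip n) ⟩
      A * (recip n * recip n)    ∎

    o+k≢0 : ∀ o k .{{_ : ℕ.NonZero k}} → ℕ.NonZero (o ℕ.+ k)
    o+k≢0 o k = ℕ.>-nonZero (ℕ.<-≤-trans (ℕ.>-nonZero⁻¹ k) (ℕ.m≤n+m k o))

    -- One more factor moves the product by at most B A/n², which is covered by the drop of B A/n in
    -- the second summand. Summing over all integers suffices.
    drift : ∀ o k .{{_ : ℕ.NonZero k}} → ∣ P (o ℕ.+ k) - P k ∣ + B * A * recip (o ℕ.+ k) ≤ B * A * recip k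
    drift zero    k = ℚ.≤-reflexive (trans (cong (λ z → ∣ z ∣ + B * A * recip k) (ℚ.+-inverseʳ (P k))) (ℚ.+-identityˡ (B * A * recip k)))
    drift (suc o) k = begin
        ∣ Q * (1ℚ + y) - P k ∣ + B * A * r                      ≡⟨ cong (λ z → ∣ z ∣ + B * A * r) (lem₁ Q y (P k)) ⟩
        ∣ Q * y + (Q - P k) ∣ + B * A * r                       ≤⟨ ℚ.+-monoˡ-≤ (B * A * r) (ℚ.≤-trans (ℚ.∣p+q∣≤∣p∣+∣q∣ (Q * y) (Q - P k)) (ℚ.+-monoˡ-≤ ∣ Q - P k ∣ Qy≤)) ⟩
        B * (A * (r * r)) + ∣ Q - P k ∣ + B * A * r             ≡⟨ lem₂ B A r ∣ Q - P k ∣ ⟩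
        ∣ Q - P k ∣ + B * A * (r * r + r)                       ≤⟨ ℚ.+-monoʳ-≤ ∣ Q - P k ∣ (*-monoˡ {B * A} {r * r + r} {recip (o ℕ.+ k)} 0≤BA (square-telescope (o ℕ.+ k) {{o+k≢0 o k}})) ⟩
        ∣ Q - P k ∣ + B * A * recip (o ℕ.+ k)                   ≤⟨ drift o k ⟩
        B * A * recip k                                         ∎
      where
      Q r y : ℚ
      Q = P (o ℕ.+ k)
      r = recip (suc (o ℕ.+ k))
      y = h (suc (o ℕ.+ k)) * r
      Qy≤ : ∣ Q * y ∣ ≤ B * (A * (r * r))
      Qy≤ = begin
        ∣ Q * y ∣          ≡⟨ ℚ.∣p*q∣≡∣p∣*∣q∣ Q y ⟩
        ∣ Q ∣ * ∣ y ∣      ≡⟨ cong (_* ∣ y ∣) (ℚ.0≤p⇒∣p∣≡p (ℚ.<⇒≤ (partialProduct-pos (o ℕ.+ k)))) ⟩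
        Q * ∣ y ∣          ≤⟨ *-mono {Q} {B} {∣ y ∣} {A * (r * r)} (ℚ.<⇒≤ (partialProduct-pos (o ℕ.+ k)))
                                (ℚ.≤-trans (ℚ.0≤∣p∣ y) (deviation (suc (o ℕ.+ k)))) (bounded (o ℕ.+ k)) (deviation (suc (o ℕ.+ k))) ⟩
        B * (A * (r * r))  ∎
      lem₁ : ∀ Q y p → Q * (1ℚ + y) - p ≡ Q * y + (Q - p)
      lem₁ = solve-∀ ring
      lem₂ : ∀ B A r d → B * (A * (r * r)) + d + B * A * r ≡ d + B * A * (r * r + r)
      lem₂ = solve-∀ ring

    drift≤ : ∀ {m n} .{{_ : ℕ.NonZero m}} → m ℕ.≤ n → ∣ P n - P m ∣ ≤ B * A * recip m
    drift≤ {m} m≤n with ℕ.m≤n⇒∃[o]m+o≡n m≤n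
    ... | o , refl = subst (λ n → ∣ P n - P m ∣ ≤ B * A * recip m) (ℕ.+-comm o m)
      (ℚ.≤-trans (p≤p+q {∣ P (o ℕ.+ m) - P m ∣} {B * A * recip (o ℕ.+ m)} (*-nonNeg {B * A} {recip (o ℕ.+ m)} 0≤BA (recip-nonNeg (o ℕ.+ m)))) (drift o m))

    partialProduct-cauchy : ∀ ε → 0ℚ < ε → ∃[ N ] (∀ m n → N ℕ.≤ m → N ℕ.≤ n → ∣ P m - P n ∣ ≤ ε)
    partialProduct-cauchy ε 0<ε = suc N , λ m n m≥ n≥ → [ ordered m n m≥ , flipped m n n≥ ]′ (ℕ.≤-total m n)
      where
      N : ℕ
      N = proj₁ (vanishes {B * A} {ε} 0≤BA 0<ε)
      small : ∀ n → suc N ℕ.≤ n → B * A * recip n ≤ ε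
      small (suc n) (ℕ.s≤s N≤n) = proj₂ (vanishes {B * A} {ε} 0≤BA 0<ε) n N≤n
      flipped : ∀ m n → suc N ℕ.≤ n → n ℕ.≤ m → ∣ P m - P n ∣ ≤ ε
      flipped m n n≥ n≤m = ℚ.≤-trans (drift≤ {n} {m} {{ℕ.>-nonZero (ℕ.≤-trans (ℕ.s≤s ℕ.z≤n) n≥)}} n≤m) (small n n≥)
      ordered : ∀ m n → suc N ℕ.≤ m → m ℕ.≤ n → ∣ P m - P n ∣ ≤ ε
      ordered m n m≥ m≤n = subst (_≤ ε) (∣p-q∣≡∣q-p∣ (P n) (P m)) (flipped n m m≥ m≤n)

    -- ∏ (1 − aᵢ) ≥ 1 − ∑ aᵢ
    tail-bound : ∀ o k .{{_ : ℕ.NonZero k}} → A * recip k ≤ 1ℚ →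
                 P k * (1ℚ - A * (recip k - recip (o ℕ.+ k))) ≤ P (o ℕ.+ k)
    tail-bound zero    k small = ℚ.≤-reflexive (lem (P k) A (recip k))
      where
      lem : ∀ p a r → p * (1ℚ - a * (r - r)) ≡ p
      lem = solve-∀ ring
    tail-bound (suc o) k small = begin
        P k * (1ℚ - A * (s - r))                    ≤⟨ *-monoˡ {P k} {1ℚ - A * (s - r)} {(1ℚ - A * (s - r′)) * (1ℚ - A * (r * r))} 0≤P factor-step ⟩
        P k * ((1ℚ - A * (s - r′)) * (1ℚ - A * (r * r)))   ≡⟨ sym (ℚ.*-assoc (P k) (1ℚ - A * (s - r′)) (1ℚ - A * (r * r))) ⟩
        P k * (1ℚ - A * (s - r′)) * (1ℚ - A * (r * r))     ≤⟨ *-monoʳ {1ℚ - A * (r * r)} {P k * (1ℚ - A * (s - r′))} {Q} 0≤1-Ar² (tail-bound o k small) ⟩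
        Q * (1ℚ - A * (r * r))                      ≤⟨ *-monoˡ {Q} {1ℚ - A * (r * r)} {1ℚ + y} (ℚ.<⇒≤ (partialProduct-pos (o ℕ.+ k))) (ℚ.+-monoʳ-≤ 1ℚ -Ar²≤y) ⟩
        Q * (1ℚ + y)                                ∎
      where
      Q r r′ s y : ℚ
      Q = P (o ℕ.+ k)
      r = recip (suc (o ℕ.+ k))
      r′ = recip (o ℕ.+ k)
      s = recip k
      y = h (suc (o ℕ.+ k)) * r
      0≤P : 0ℚ ≤ P k
      0≤P = ℚ.<⇒≤ (partialProduct-pos k)
      r≤s : r ≤ s
      r≤s = recip-antitone {k} (ℕ.m≤n+m k (suc o))
      r′≤s : r′ ≤ s
      r′≤s = recip-antitone {k} (ℕ.m≤n+m k o)
      r²≤s : r * r ≤ s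
      r²≤s = ℚ.≤-trans (subst (r * r ≤_) (ℚ.*-identityʳ r) (*-monoˡ {r} {r} {1ℚ} (recip-nonNeg (suc (o ℕ.+ k))) (recip≤1 (suc (o ℕ.+ k))))) r≤s
      0≤1-Ar² : 0ℚ ≤ 1ℚ - A * (r * r)
      0≤1-Ar² = 0≤-from {A * (r * r)} {1ℚ} (ℚ.≤-trans (*-monoˡ {A} {r * r} {s} 0≤A r²≤s) small)
      neg-involutive : ∀ y → - - y ≡ y
      neg-involutive = solve-∀ ring
      -Ar²≤y : - (A * (r * r)) ≤ y
      -Ar²≤y = subst (- (A * (r * r)) ≤_) (neg-involutive y)
        (ℚ.neg-antimono-≤ (ℚ.≤-trans (-p≤∣p∣ y) (deviation (suc (o ℕ.+ k)))))
      factor-step : 1ℚ - A * (s - r) ≤ (1ℚ - A * (s - r′)) * (1ℚ - A * (r * r))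
      -- The slack is the cross term of two nonnegative losses plus the telescoping gap r′ - (r² +
      -- r), both nonnegative.
      factor-step = ≤-from {1ℚ - A * (s - r)} (A * (s - r′) * (A * (r * r)) + A * (r′ - (r * r + r)))
        (+-nonNeg {A * (s - r′) * (A * (r * r))}
          (*-nonNeg {A * (s - r′)} {A * (r * r)} (*-nonNeg {A} {s - r′} 0≤A (0≤-from {r′} {s} r′≤s)) (*-nonNeg {A} {r * r} 0≤A (square-nonNeg (suc (o ℕ.+ k)))))
          (*-nonNeg {A} {r′ - (r * r + r)} 0≤A (0≤-from {r * r + r} {r′} (square-telescope (o ℕ.+ k) {{o+k≢0 o k}}))))
        (lem A s r r′)
        where
        lem : ∀ a s r q → 1ℚ - a * (s - r) + (a * (s - q) * (a * (r * r)) + a * (q - (r * r + r)))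
              ≡ (1ℚ - a * (s - q)) * (1ℚ - a * (r * r))
        lem = solve-∀ ring

    -- Once A/k ≤ ½ the whole tail costs at most a factor ½, so a fixed positive P(k) gives a lower
    -- bound for all later products.
    half-tail-bound : ∀ o k .{{_ : ℕ.NonZero k}} → A * recip k ≤ ½ → ½ * P k ≤ P (o ℕ.+ k)
    half-tail-bound o k A/k≤½ = begin
        ½ * P k                                            ≡⟨ ℚ.*-comm ½ (P k) ⟩
        P k * ½                                            ≤⟨ *-monoˡ {P k} {½} {1ℚ - A * gap} (ℚ.<⇒≤ (partialProduct-pos k))
                                                                (ℚ.+-monoʳ-≤ 1ℚ (ℚ.neg-antimono-≤ (ℚ.≤-trans (*-monoˡ {A} {gap} {recip k} 0≤A gap≤) A/k≤½))) ⟩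
        P k * (1ℚ - A * gap)                               ≤⟨ tail-bound o k (ℚ.≤-trans A/k≤½ ½≤1) ⟩
        P (o ℕ.+ k)                                        ∎
      where
      gap : ℚ
      gap = recip k - recip (o ℕ.+ k)
      ½≤1 : ½ ≤ 1ℚ
      ½≤1 = ℚ.≤ᵇ⇒≤ _
      lem : ∀ a b → a - b + b ≡ a
      lem = solve-∀ ring
      gap≤ : gap ≤ recip k
      gap≤ = ≤-from {gap} (recip (o ℕ.+ k)) (recip-nonNeg (o ℕ.+ k)) (lem (recip k) (recip (o ℕ.+ k)))

    partialProduct-away : ∃[ δ ] 0ℚ < δ × ∃[ N ] (∀ n → N ℕ.≤ n → δ ≤ P n)
    partialProduct-away = from (vanishes {A} {½} 0≤A (ℚ.positive⁻¹ ½))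
      where
      bound : ∀ k .{{_ : ℕ.NonZero k}} → A * recip k ≤ ½ → ∀ n → k ℕ.≤ n → ½ * P k ≤ P n
      bound k A/k≤½ n k≤n with ℕ.m≤n⇒∃[o]m+o≡n k≤n
      ... | o , refl = subst (λ n → ½ * P k ≤ P n) (ℕ.+-comm o k) (half-tail-bound o k A/k≤½)
      from : ∃[ M ] (∀ n → M ℕ.≤ n → A * recip (suc n) ≤ ½) → ∃[ δ ] 0ℚ < δ × ∃[ N ] (∀ n → N ℕ.≤ n → δ ≤ P n)
      from (M , small) = ½ * P (suc M) , half-pos (partialProduct-pos (suc M)) , suc M , bound (suc M) (small M ℕ.≤-refl)

-- Harmonic sums against Riemann sums for the logarithm

module LogBound where
  open import Data.Rational.Base using (_+_; _*_; -_; _-_; _≤_; _<_; ∣_∣)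
  open Rational
  open Arithmetic
  open Sums
  open Log using (1≤1+ι*; step-nonNeg; riemann-lipschitz; riemann-refine; ∑₁-const; ∑₁-+; ∑₁-*)
  open ℚ.≤-Reasoning

  -- After multiplying out the denominators the two sides differ by exactly h - g.
  riemannTerm-mono : ∀ {g h} → 0ℚ ≤ g → g ≤ h → ∀ k → riemannTerm g k ≤ riemannTerm h k
  riemannTerm-mono {g} {h} 0≤g g≤h k = begin
      g * U                             ≡⟨ sym (ℚ.*-identityʳ (g * U)) ⟩
      g * U * 1ℚ                        ≡⟨ cong (g * U *_) (sym (⁻¹-inverseʳ 0<v)) ⟩
      g * U * ((1ℚ + ι k * h) * V)      ≡⟨ lem₁ g (1ℚ + ι k * h) U V ⟩
      g * (1ℚ + ι k * h) * (U * V)      ≤⟨ *-monoʳ {U * V} {g * (1ℚ + ι k * h)} {h * (1ℚ + ι k * g)} (*-nonNeg {U} {V} (⁻¹-nonNeg 0<u) (⁻¹-nonNeg 0<v))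
                                             (≤-from {g * (1ℚ + ι k * h)} (h - g) (0≤-from g≤h) (lem₃ g h (ι k))) ⟩
      h * (1ℚ + ι k * g) * (U * V)      ≡⟨ lem₂ h (1ℚ + ι k * g) U V ⟩
      h * V * ((1ℚ + ι k * g) * U)      ≡⟨ cong (h * V *_) (⁻¹-inverseʳ 0<u) ⟩
      h * V * 1ℚ                        ≡⟨ ℚ.*-identityʳ (h * V) ⟩
      h * V                             ∎
    where
    U V : ℚ
    U = (1ℚ + ι k * g) ⁻¹
    V = (1ℚ + ι k * h) ⁻¹
    0<u : 0ℚ < 1ℚ + ι k * g
    0<u = ℚ.<-≤-trans 0<1 (1≤1+ι* k {g} 0≤g)
    0<v : 0ℚ < 1ℚ + ι k * h
    0<v = ℚ.<-≤-trans 0<1 (1≤1+ι* k {h} (ℚ.≤-trans 0≤g g≤h))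
    lem₁ : ∀ g v U V → g * U * (v * V) ≡ g * v * (U * V)
    lem₁ = solve-∀ ring
    lem₂ : ∀ h u U V → h * u * (U * V) ≡ h * V * (u * U)
    lem₂ = solve-∀ ring
    lem₃ : ∀ g h k → g * (1ℚ + k * h) + (h - g) ≡ h * (1ℚ + k * g)
    lem₃ = solve-∀ ring

  riemann-mono : ∀ n {s t} → 0ℚ ≤ s → s ≤ t → riemann (suc n) s ≤ riemann (suc n) t
  riemann-mono n {s} {t} 0≤s s≤t = ∑₁-mono (suc n) {riemannTerm (s * recip (suc n))} {riemannTerm (t * recip (suc n))}
    λ k _ → riemannTerm-mono {s * recip (suc n)} {t * recip (suc n)} (step-nonNeg n 0≤s)
      (*-monoʳ {recip (suc n)} {s} {t} (recip-nonNeg (suc n)) s≤t) (suc k)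

  -- With m parts per unit interval, the parts of [k , k + 1] contribute at least 1/(k + 2).
  harmonic≤riemann : ∀ m T .{{_ : ℕ.NonZero m}} .{{_ : ℕ.NonZero T}} → harmonic (suc T) ≤ 1ℚ + riemann (T ℕ.* m) (ι T)
  harmonic≤riemann m T = begin
      harmonic (suc T)                     ≡⟨ cong harmonic (ℕ.+-comm 1 T) ⟩
      harmonic (T ℕ.+ 1)                   ≡⟨ ∑₁-+ 1 T recip ⟩
      1ℚ + ∑₁ T (λ k → recip (k ℕ.+ 1))    ≤⟨ ℚ.+-monoʳ-≤ 1ℚ (∑₁-mono T {λ k → recip (k ℕ.+ 1)} {blocks} λ k _ → block k) ⟩
      1ℚ + ∑₁ T blocks                     ≡⟨ cong (λ s → 1ℚ + s) (sym (∑₁-* m T (riemannTerm (recip m)))) ⟩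
      1ℚ + ∑₁ (T ℕ.* m) (riemannTerm (recip m))   ≡⟨ cong (λ h → 1ℚ + ∑₁ (T ℕ.* m) (riemannTerm h)) (sym width) ⟩
      1ℚ + riemann (T ℕ.* m) (ι T)         ∎
    where
    blocks : ℕ → ℚ
    blocks k = ∑₁ m (λ i → riemannTerm (recip m) (i ℕ.+ ℕ.pred k ℕ.* m))
    width : ι T * recip (T ℕ.* m) ≡ recip m
    width = begin-equality
      ι T * recip (T ℕ.* m)         ≡⟨ cong (ι T *_) (recip-* T m) ⟩
      ι T * (recip T * recip m)     ≡⟨ sym (ℚ.*-assoc (ι T) (recip T) (recip m)) ⟩
      ι T * recip T * recip m       ≡⟨ cong (_* recip m) (recip-inverse T) ⟩
      1ℚ * recip m                  ≡⟨ ℚ.*-identityˡ (recip m) ⟩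
      recip m                       ∎
    term : ∀ k i → i ℕ.≤ m → recip m * recip (suc (suc k)) ≤ riemannTerm (recip m) (i ℕ.+ k ℕ.* m)
    term k i i≤m = *-monoˡ {recip m} {recip (suc (suc k))} {(1ℚ + ι (i ℕ.+ k ℕ.* m) * recip m) ⁻¹} (recip-nonNeg m)
      (⁻¹-antitone (ℚ.<-≤-trans 0<1 (1≤1+ι* (i ℕ.+ k ℕ.* m) {recip m} (recip-nonNeg m))) denominator≤)
      where
      denominator≤ : 1ℚ + ι (i ℕ.+ k ℕ.* m) * recip m ≤ ι (suc (suc k))
      denominator≤ = begin
        1ℚ + ι (i ℕ.+ k ℕ.* m) * recip m   ≤⟨ ℚ.+-monoʳ-≤ 1ℚ (SieveBound.ι≤⇒quotient≤ {i ℕ.+ k ℕ.* m} {suc k} m (ℕ.+-monoˡ-≤ (k ℕ.* m) i≤m)) ⟩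
        1ℚ + ι (suc k)                     ≡⟨ ℚ.+-comm 1ℚ (ι (suc k)) ⟩
        ι (suc k) + 1ℚ                     ≡⟨ sym (ι-suc (suc k)) ⟩
        ι (suc (suc k))                    ∎
    block : ∀ k → recip (suc k ℕ.+ 1) ≤ blocks (suc k)
    block k = begin
      recip (suc k ℕ.+ 1)                          ≡⟨ cong recip (ℕ.+-comm (suc k) 1) ⟩
      recip (suc (suc k))                          ≡⟨ sym (ℚ.*-identityˡ (recip (suc (suc k)))) ⟩
      1ℚ * recip (suc (suc k))                     ≡⟨ cong (_* recip (suc (suc k))) (sym (recip-inverse m)) ⟩
      ι m * recip m * recip (suc (suc k))          ≡⟨ ℚ.*-assoc (ι m) (recip m) (recip (suc (suc k))) ⟩
      ι m * (recip m * recip (suc (suc k)))        ≡⟨ sym (∑₁-const m (recip m * recip (suc (suc k)))) ⟩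
      ∑₁ m (λ _ → recip m * recip (suc (suc k)))   ≤⟨ ∑₁-mono m {λ _ → recip m * recip (suc (suc k))} {λ i → riemannTerm (recip m) (i ℕ.+ k ℕ.* m)} (λ i i<m → term k (suc i) i<m) ⟩
      blocks (suc k)                               ∎

  -- η = 1/16 is chosen so that 1 + 2η = ¾ · H₂. Three quarters of the harmonic sum pay for the 1
  -- lost against the integral and for two approximation errors η; one quarter survives.
  ¼ ¾ η : ℚ
  ¼ = ½ * ½
  ¾ = ½ + ½ * ½
  η = ¼ * ¼

  -- T ≥ 1 gives H ≥ H₂ = 3/2; the opening equality is the computation 1 + 2η = 9/8 = ¾ · 3/2.
  ¼harmonic≤ : ∀ T .{{_ : ℕ.NonZero T}} → ¼ * harmonic (suc T) + (1ℚ + (η + η)) ≤ harmonic (suc T)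
  ¼harmonic≤ (suc T) = begin
    ¼ * H + (1ℚ + (η + η))      ≡⟨⟩
    ¼ * H + ¾ * harmonic 2      ≤⟨ ℚ.+-monoʳ-≤ (¼ * H) (*-monoˡ {¾} {harmonic 2} {H} (ℚ.<⇒≤ (ℚ.positive⁻¹ ¾))
                                     (∑₁-extend {2} {suc (suc T)} {recip} (ℕ.s≤s (ℕ.s≤s ℕ.z≤n)) recip-nonNeg)) ⟩
    ¼ * H + ¾ * H               ≡⟨ sym (ℚ.*-distribʳ-+ H ¼ ¾) ⟩
    1ℚ * H                      ≡⟨ ℚ.*-identityˡ H ⟩
    H                           ∎
    where
    H : ℚ
    H = harmonic (suc (suc T))

  -- s stands for x − 1 and the Riemann sum for the k-th approximant of log x, where x ≈ T + 1.
  ¼harmonic≤riemann : ∀ T .{{_ : ℕ.NonZero T}} k {s} → ι T ≤ s + η → (ι T * ι T) * recip (suc k) ≤ η →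
                      ¼ * harmonic (suc T) ≤ riemann (suc k) s
  ¼harmonic≤riemann T@(suc T′) k {s} T≤s small = begin
      ¼ * H                                 ≤⟨ p+q≤r⇒p≤r-q {¼ * H} {1ℚ + (η + η)} {H} (¼harmonic≤ T) ⟩
      H - (1ℚ + (η + η))                    ≤⟨ ℚ.+-monoˡ-≤ (- (1ℚ + (η + η))) (harmonic≤riemann (suc k) T) ⟩
      1ℚ + R - (1ℚ + (η + η))               ≤⟨ ℚ.+-monoˡ-≤ (- (1ℚ + (η + η))) (ℚ.+-monoʳ-≤ 1ℚ R≤) ⟩
      1ℚ + (riemann (suc k) t + η + η) - (1ℚ + (η + η))   ≡⟨ lem (riemann (suc k) t) η ⟩
      riemann (suc k) t                     ≤⟨ riemann-mono k {t} {s} 0≤t t≤s ⟩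
      riemann (suc k) s                     ∎
    where
    H R t : ℚ
    H = harmonic (suc T)
    R = riemann (T ℕ.* suc k) (ι T)
    -- The approximant `s` may fall short of T by η, so the comparison goes through the smaller
    -- argument T - η.
    t = ι T - η
    p+q≤r⇒p≤r-q : ∀ {p q r} → p + q ≤ r → p ≤ r - q
    p+q≤r⇒p≤r-q {p} {q} {r} p+q≤r = subst (_≤ r - q) (lem p q) (ℚ.+-monoˡ-≤ (- q) p+q≤r)
      where
      lem : ∀ p q → p + q - q ≡ p
      lem = solve-∀ ring
    0≤t : 0ℚ ≤ t
    0≤t = 0≤-from {η} {ι T} (ℚ.≤-trans {η} {1ℚ} (ℚ.≤ᵇ⇒≤ _) (1≤ι-suc T′))
    t≤s : t ≤ s
    t≤s = p≤q+r⇒p-q≤r {ι T} {η} {s} (subst (ι T ≤_) (ℚ.+-comm s η) T≤s)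
    -- One η pays for passing between (k + 1) T and k + 1 parts, the other for moving the argument
    -- from T to T - η, Riemann sums being 1-Lipschitz.
    R≤ : R ≤ riemann (suc k) t + η + η
    R≤ = begin
      R                                     ≡⟨ cong (λ n → riemann n (ι T)) (ℕ.*-comm T (suc k)) ⟩
      riemann (suc k ℕ.* T) (ι T)           ≤⟨ p≤q+∣p-q∣ (riemann (suc k ℕ.* T) (ι T)) (riemann (suc k) (ι T)) ⟩
      riemann (suc k) (ι T) + ∣ riemann (suc k ℕ.* T) (ι T) - riemann (suc k) (ι T) ∣
        ≤⟨ ℚ.+-mono-≤ (p≤q+∣p-q∣ (riemann (suc k) (ι T)) (riemann (suc k) t)) (ℚ.≤-trans (riemann-refine T′ k {ι T} (0≤ι T)) small) ⟩
      riemann (suc k) t + ∣ riemann (suc k) (ι T) - riemann (suc k) t ∣ + η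
        ≤⟨ ℚ.+-monoˡ-≤ η (ℚ.+-monoʳ-≤ (riemann (suc k) t) (ℚ.≤-trans (riemann-lipschitz k {ι T} {t} (0≤ι T) 0≤t) (ℚ.≤-reflexive gap))) ⟩
      riemann (suc k) t + η + η             ∎
      where
      lem′ : ∀ a b → a - (a - b) ≡ b
      lem′ = solve-∀ ring
      gap : ∣ ι T - t ∣ ≡ η
      gap = cong ∣_∣ (lem′ (ι T) η)
    lem : ∀ r h → 1ℚ + (r + h + h) - (1ℚ + (h + h)) ≡ r
    lem = solve-∀ ring

-- The estimate for one approximant of x, 𝔖 and log x

module Assembly where
  open import Data.Rational.Base using (_+_; _*_; -_; _-_; _≤_; _<_; ∣_∣)
  open Rational
  open Arithmetic
  open Sums
  open Sieve
  open SieveBound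
  open Powers
  open JordanQuotient
  open LocalFactors
  open EulerProduct
  open LogBound
  open ℚ.≤-Reasoning

  ^ℚ-mono : ∀ {p q} → 0ℚ ≤ p → p ≤ q → ∀ n → p ^ℚ n ≤ q ^ℚ n
  ^ℚ-mono 0≤p p≤q zero    = ℚ.≤-refl
  ^ℚ-mono {p} {q} 0≤p p≤q (suc n) = *-mono {p} {q} {p ^ℚ n} {q ^ℚ n} 0≤p (^ℚ-nonNeg (ℚ.≤-trans 0≤p p≤q) n) p≤q (^ℚ-mono 0≤p p≤q n)

  1≤^ℚ : ∀ {p} → 1ℚ ≤ p → ∀ n → 1ℚ ≤ p ^ℚ n
  1≤^ℚ {p} 1≤p n = subst (_≤ p ^ℚ n) (1^ℚ n) (^ℚ-mono 0≤1 1≤p n)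

  module _ (g : ℕ → ℚ) (a : ℕ) (near : Near (ι a) g) where
    private
      h P : ℕ → ℚ
      h = perturbation g
      P = partialProduct h
      A D : ℚ
      A = ι a + ι (errorConstant a g near)
      D = 2ℚ ^ℚ errorConstant a g near

    sieve-error : ∀ N .{{_ : ℕ.NonZero N}} k →
                  ∣ ∑₁ N (sieve h k (λ _ → 1ℚ)) - ι N * P k ∣ ≤ (2ℚ * harmonic N) ^ℚ a * D
    sieve-error N k = subst (λ z → ∣ z ∣ ≤ (2ℚ * harmonic N) ^ℚ a * D)
      (cong₂ (λ m y → ∑₁ m (sieve h k (λ _ → 1ℚ)) - y * P k) (ℕ.n/1≡n N) (ℚ.*-identityʳ (ι N)))
      (discrepancy-bound N h a (errorConstant a g near) (perturbation-bound a g near) k)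

    0≤D : 0ℚ ≤ D
    0≤D = ^ℚ-nonNeg 0≤2 (errorConstant a g near)

    bound : ℚ
    bound = 1ℚ + (2ℚ * harmonic 1) ^ℚ a * D

    -- For N = 1 the sum is the single sieve value 1, so the sieve estimate reads |1 - P(k)| ≤ c
    -- with c independent of k.
    P≤bound : ∀ k → P k ≤ bound
    P≤bound k = begin
      P k                  ≤⟨ p≤q+∣p-q∣ (P k) 1ℚ ⟩
      1ℚ + ∣ P k - 1ℚ ∣    ≡⟨ cong (λ z → 1ℚ + z) (trans (∣p-q∣≡∣q-p∣ (P k) 1ℚ) (cong₂ (λ x y → ∣ x - y ∣)
                                (sym (trans (ℚ.+-identityˡ (sieve h k (λ _ → 1ℚ) 1)) (sieve-one g k))) (sym (ℚ.*-identityˡ (P k))))) ⟩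
      1ℚ + ∣ ∑₁ 1 (sieve h k (λ _ → 1ℚ)) - ι 1 * P k ∣   ≤⟨ ℚ.+-monoʳ-≤ 1ℚ (sieve-error 1 k) ⟩
      bound                ∎

    0≤A : 0ℚ ≤ A
    0≤A = +-nonNeg {ι a} (0≤ι a) (0≤ι (errorConstant a g near))

    product-pos : ∀ k → 0ℚ < P k
    product-pos = partialProduct-pos h A bound 0≤A (perturbation≤recip a g near) (factor-pos a g near) P≤bound

    product-cauchy : ∀ ε → 0ℚ < ε → ∃[ N ] (∀ m n → N ℕ.≤ m → N ℕ.≤ n → ∣ P m - P n ∣ ≤ ε)
    product-cauchy = partialProduct-cauchy h A bound 0≤A (perturbation≤recip a g near) (factor-pos a g near) P≤bound

    product-away : ∃[ δ ] 0ℚ < δ × ∃[ N ] (∀ n → N ℕ.≤ n → δ ≤ P n)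
    product-away = partialProduct-away h A bound 0≤A (perturbation≤recip a g near) (factor-pos a g near) P≤bound

    -- `D` comes from the sieve error and `bound` from replacing N by x; 8 appears because ¼ H_N ≤ ℓ
    -- gives 2 H_N ≤ 8 ℓ.
    constant : ℚ
    constant = (D + bound) * (ι 8) ^ℚ a

    0≤bound : 0ℚ ≤ bound
    0≤bound = ℚ.≤-trans (ℚ.<⇒≤ (product-pos 0)) (P≤bound 0)

    -- Replacing N by x costs P(k) |N - x| ≤ `bound`, which is absorbed into the main error because
    -- 2 H_N ≥ 1. Here x and ℓ are rational approximants at one index, so the argument stays within
    -- ℚ.
    real-argument-error : ∀ N .{{_ : ℕ.NonZero N}} k {x ℓ} → ∣ ι N - x ∣ ≤ 1ℚ → ¼ * harmonic N ≤ ℓ →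
                          ∣ ∑₁ N (sieve h k (λ _ → 1ℚ)) - P k * x ∣ ≤ constant * ℓ ^ℚ a
    real-argument-error N k {x} {ℓ} near-x log≥ = begin
      ∣ S - P k * x ∣                              ≡⟨ cong ∣_∣ (lem₁ S (P k) x (ι N)) ⟩
      ∣ (S - ι N * P k) + P k * (ι N - x) ∣        ≤⟨ ℚ.∣p+q∣≤∣p∣+∣q∣ (S - ι N * P k) (P k * (ι N - x)) ⟩
      ∣ S - ι N * P k ∣ + ∣ P k * (ι N - x) ∣      ≤⟨ ℚ.+-mono-≤ (sieve-error N k) product≤ ⟩
      L * D + bound * 1ℚ                           ≤⟨ ℚ.+-monoʳ-≤ (L * D) (*-monoˡ {bound} {1ℚ} {L} 0≤bound (1≤^ℚ (*-mono {1ℚ} {2ℚ} {1ℚ} {harmonic N} 0≤1 (ℚ.≤-trans 0≤1 (1≤harmonic N)) (ℚ.≤ᵇ⇒≤ _) (1≤harmonic N)) a)) ⟩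
      L * D + bound * L                            ≡⟨ lem₂ L D bound ⟩
      (D + bound) * L                              ≤⟨ *-monoˡ {D + bound} {L} {(ι 8 * ℓ) ^ℚ a} (+-nonNeg {D} {bound} 0≤D 0≤bound)
                                                        (^ℚ-mono {2ℚ * harmonic N} {ι 8 * ℓ} (*-nonNeg {2ℚ} {harmonic N} 0≤2 (ℚ.≤-trans 0≤1 (1≤harmonic N))) 2H≤8ℓ a) ⟩
      (D + bound) * (ι 8 * ℓ) ^ℚ a                 ≡⟨ cong ((D + bound) *_) (^ℚ-distrib-* (ι 8) ℓ a) ⟩
      (D + bound) * (ι 8 ^ℚ a * ℓ ^ℚ a)            ≡⟨ sym (ℚ.*-assoc (D + bound) (ι 8 ^ℚ a) (ℓ ^ℚ a)) ⟩
      constant * ℓ ^ℚ a                            ∎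
      where
      S L : ℚ
      S = ∑₁ N (sieve h k (λ _ → 1ℚ))
      L = (2ℚ * harmonic N) ^ℚ a
      product≤ : ∣ P k * (ι N - x) ∣ ≤ bound * 1ℚ
      product≤ = begin
        ∣ P k * (ι N - x) ∣        ≡⟨ ℚ.∣p*q∣≡∣p∣*∣q∣ (P k) (ι N - x) ⟩
        ∣ P k ∣ * ∣ ι N - x ∣      ≡⟨ cong (_* ∣ ι N - x ∣) (ℚ.0≤p⇒∣p∣≡p (ℚ.<⇒≤ (product-pos k))) ⟩
        P k * ∣ ι N - x ∣          ≤⟨ *-mono {P k} {bound} {∣ ι N - x ∣} {1ℚ} (ℚ.<⇒≤ (product-pos k)) 0≤1 (P≤bound k) near-x ⟩
        bound * 1ℚ                 ∎
      2H≤8ℓ : 2ℚ * harmonic N ≤ ι 8 * ℓ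
      2H≤8ℓ = begin
        ι 8 * ¼ * harmonic N       ≡⟨ ℚ.*-assoc (ι 8) ¼ (harmonic N) ⟩
        ι 8 * (¼ * harmonic N)     ≤⟨ *-monoˡ {ι 8} {¼ * harmonic N} {ℓ} (0≤ι 8) log≥ ⟩
        ι 8 * ℓ                    ∎
      lem₁ : ∀ s p x n → s - p * x ≡ (s - n * p) + p * (n - x)
      lem₁ = solve-∀ ring
      lem₂ : ∀ l d b → l * d + b * l ≡ (d + b) * l
      lem₂ = solve-∀ ring

-- From eventual rational inequalities to real ones

module RealEstimates where
  open import Data.Rational.Base using (_+_; _*_; -_; _-_; ∣_∣; _⊔_) renaming (_≤_ to _≤ℚ_; _<_ to _<ℚ_)
  open import Defs using (_≤_; _<_)
  open Rational
  open Arithmetic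
  open Sums
  open LogBound
  open ℝ
  open ℚ.≤-Reasoning

  eventually⇒≤ : ∀ {x y} → ∃[ K ] (∀ k → K ℕ.≤ k → seq x k ≤ℚ seq y k) → x ≤ y
  eventually⇒≤ {x} {y} (K , x≤y) ε 0<ε = K , λ k K≤k → ℚ.≤-trans (x≤y k K≤k) (p≤p+q {seq y k} {ε} (ℚ.<⇒≤ 0<ε))

  away⇒0< : ∀ {x} → ∃[ δ ] 0ℚ <ℚ δ × ∃[ N ] (∀ n → N ℕ.≤ n → δ ≤ℚ seq x n) → fromℕ 0 < x
  away⇒0< {x} (δ , 0<δ , N , δ≤x) = δ , 0<δ , N , λ n N≤n → subst (_≤ℚ seq x n) (sym (ℚ.+-identityˡ δ)) (δ≤x n N≤n)

  -- The Cauchy condition already compares the n-th approximant with all later ones, so its modulus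
  -- also serves for convergence to the real itself.
  approximants-converge : ∀ x (s : ℕ → ℚ) → (∀ n → s n ≡ seq x n) → ConvergesTo (λ n → fromℚ (s n)) x
  approximants-converge x s s≡x ε 0<ε with cauchy x ε 0<ε
  ... | N , close = N , λ n N≤n → eventually⇒≤ {Defs.∣_∣ (Defs._-_ (fromℚ (s n)) x)} {fromℚ ε}
    (N , λ k N≤k → subst (λ p → ∣ p - seq x k ∣ ≤ℚ ε) (sym (s≡x n)) (close n k N≤n N≤k))

  seq-^ : ∀ x n k → seq (Defs._^_ x n) k ≡ seq x k ^ℚ n
  seq-^ x zero    k = refl
  seq-^ x (suc n) k = cong (seq x k *_) (seq-^ x n k)

  -- The strict bound x < N + 1 has a margin ε. Reading 2 ≤ x with tolerance ½ε at a common index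
  -- contradicts N + 1 ≤ 2.
  floor≥2 : ∀ {x N} → fromℕ 2 ≤ x → IsFloor x N → 2 ℕ.≤ N
  floor≥2 {x} {N} 2≤x (_ , ε , 0<ε , L , x<1+N) = ℕ.≮⇒≥ λ N<2 → ℚ.<-irrefl refl (begin-strict
      seq x k + ½ * ε                  <⟨ ℚ.+-monoʳ-< (seq x k) ½ε<ε ⟩
      seq x k + ε                      ≤⟨ x<1+N k (ℕ.m≤n⊔m K L) ⟩
      ι (suc N)                        ≤⟨ ι-mono N<2 ⟩
      ι 2                              ≤⟨ proj₂ (2≤x (½ * ε) (half-pos 0<ε)) k (ℕ.m≤m⊔n K L) ⟩
      seq x k + ½ * ε                  ∎)
    where
    K k : ℕ
    K = proj₁ (2≤x (½ * ε) (half-pos 0<ε))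
    k = K ℕ.⊔ L
    ½ε<ε : ½ * ε <ℚ ε
    ½ε<ε = begin-strict
      ½ * ε             ≡⟨ sym (ℚ.+-identityʳ (½ * ε)) ⟩
      ½ * ε + 0ℚ        <⟨ ℚ.+-monoʳ-< (½ * ε) (half-pos 0<ε) ⟩
      ½ * ε + ½ * ε     ≡⟨ half ε ⟩
      ε                 ∎

  -- N ≤ x is read with tolerance 1, which is exactly the room allowed below; above, the strict
  -- margin is simply dropped.
  floor-close : ∀ {x N} → IsFloor x N → ∃[ K ] (∀ k → K ℕ.≤ k → ∣ ι N - seq x k ∣ ≤ℚ 1ℚ)
  floor-close {x} {N} (N≤x , ε , 0<ε , L , x<1+N) with N≤x 1ℚ 0<1
  ... | K , N≤x+1 = K ℕ.⊔ L , λ k k≥ → ∣p-q∣≤ {ι N} {seq x k} {1ℚ} (N≤x+1 k (ℕ.m⊔n≤o⇒m≤o K L k≥)) (begin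
      seq x k        ≤⟨ p≤p+q {seq x k} {ε} (ℚ.<⇒≤ 0<ε) ⟩
      seq x k + ε    ≤⟨ x<1+N k (ℕ.m⊔n≤o⇒n≤o K L k≥) ⟩
      ι (suc N)      ≡⟨ ι-suc N ⟩
      ι N + 1ℚ       ∎)

  -- The clamp inside `log` can only raise the argument, so T + 1 ≤ x, read with tolerance η,
  -- carries over to `excess`. The refinement error T²/(k + 1) falls below η for large k.
  log≥¼harmonic : ∀ x T .{{_ : ℕ.NonZero T}} → fromℕ (suc T) ≤ x →
                  ∃[ K ] (∀ k → K ℕ.≤ k → ¼ * harmonic (suc T) ≤ℚ seq (log x) k)
  log≥¼harmonic x T 1+T≤x = K ℕ.⊔ L , λ k k≥ →
      ¼harmonic≤riemann T k {excess (seq x k)}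
        (T≤excess k (proj₂ (1+T≤x η (ℚ.positive⁻¹ η)) k (ℕ.m⊔n≤o⇒m≤o K L k≥)))
        (proj₂ squares-small k (ℕ.m⊔n≤o⇒n≤o K L k≥))
    where
    open Log using (excess)
    squares-small : ∃[ L ] (∀ k → L ℕ.≤ k → (ι T * ι T) * recip (suc k) ≤ℚ η)
    squares-small = vanishes {ι T * ι T} {η} (*-nonNeg {ι T} {ι T} (0≤ι T) (0≤ι T)) (ℚ.positive⁻¹ η)
    K L : ℕ
    K = proj₁ (1+T≤x η (ℚ.positive⁻¹ η))
    L = proj₁ squares-small
    lem : ∀ y h → y + h - 1ℚ ≡ (y - 1ℚ) + h
    lem = solve-∀ ring
    lem′ : ∀ t → t ≡ t + 1ℚ - 1ℚ
    lem′ = solve-∀ ring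
    T≤excess : ∀ k → ι (suc T) ≤ℚ seq x k + η → ι T ≤ℚ excess (seq x k) + η
    T≤excess k 1+T≤ = begin
      ι T                          ≡⟨ lem′ (ι T) ⟩
      ι T + 1ℚ - 1ℚ                ≡⟨ cong (_- 1ℚ) (sym (ι-suc T)) ⟩
      ι (suc T) - 1ℚ               ≤⟨ ℚ.+-monoˡ-≤ (- 1ℚ) 1+T≤ ⟩
      seq x k + η - 1ℚ             ≤⟨ ℚ.+-monoˡ-≤ (- 1ℚ) (ℚ.+-monoˡ-≤ η (ℚ.p≤q⊔p 1ℚ (seq x k))) ⟩
      (1ℚ ⊔ seq x k) + η - 1ℚ      ≡⟨ lem (1ℚ ⊔ seq x k) η ⟩
      excess (seq x k) + η         ∎

  log≥¼harmonic-floor : ∀ {x N} → 2 ℕ.≤ N → IsFloor x N → ∃[ K ] (∀ k → K ℕ.≤ k → ¼ * harmonic N ≤ℚ seq (log x) k)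
  log≥¼harmonic-floor {x} {suc (suc T)} (ℕ.s≤s (ℕ.s≤s _)) (N≤x , _) = log≥¼harmonic x (suc T) N≤x

-- The real constant 𝔖 and the final estimate

open import Defs using (_≤_; _<_; _+_; _-_; _*_; -_; ∣_∣; _^_)
open ℝ using (seq)
open Sieve using (partialProduct; sieve)
open JordanQuotient
open LocalFactors using (Near; near-localFactor)
open Assembly using (product-cauchy; product-away; constant; real-argument-error)
open RealEstimates

module _ {r} (e : Vector ℤ (suc r)) (g : ℕ → ℚ) (near : Near (ι ∣ head e ∣ℤ) g) where
  private
    a : ℕ
    a = ∣ head e ∣ℤ

  -- The partial products themselves serve as approximants, so the k-th approximant of 𝔖 x is
  -- literally P(k) times that of x.
  limit : ℝ
  limit = mkℝ (partialProduct (perturbation g)) (product-cauchy g a near)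

  sum-estimate : (∀ {k n} .{{_ : ℕ.NonZero n}} → n ℕ.≤ k → J e n ≡ sieve (perturbation g) k (λ _ → 1ℚ) n) →
    ∀ (x : ℝ) (N : ℕ) → fromℕ 2 ≤ x → IsFloor x N →
    ∣ fromℚ (∑₁ N (J e)) - limit * x ∣ ≤ fromℚ (constant g a near) * log x ^ a
  sum-estimate J≡ x N 2≤x floor = eventually⇒≤ {∣ fromℚ (∑₁ N (J e)) - limit * x ∣} {fromℚ (constant g a near) * log x ^ a}
      -- From index N on, the sieve has met every prime up to N and agrees with J on the whole range
      -- of summation; K and L make the approximants of x and log x good enough.
      (N ℕ.⊔ (K ℕ.⊔ L) , λ k k≥ → bound k (ℕ.m⊔n≤o⇒m≤o N (K ℕ.⊔ L) k≥)
        (proj₂ x-close k (ℕ.m⊔n≤o⇒m≤o K L (ℕ.m⊔n≤o⇒n≤o N (K ℕ.⊔ L) k≥)))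
        (proj₂ log-large k (ℕ.m⊔n≤o⇒n≤o K L (ℕ.m⊔n≤o⇒n≤o N (K ℕ.⊔ L) k≥))))
    where
    2≤N : 2 ℕ.≤ N
    2≤N = floor≥2 {x} {N} 2≤x floor
    x-close : ∃[ K ] (∀ k → K ℕ.≤ k → ℚ.∣ ι N ℚ.- seq x k ∣ ℚ.≤ 1ℚ)
    x-close = floor-close {x} {N} floor
    log-large : ∃[ L ] (∀ k → L ℕ.≤ k → LogBound.¼ ℚ.* Sums.harmonic N ℚ.≤ seq (log x) k)
    log-large = log≥¼harmonic-floor {x} {N} 2≤N floor
    K L : ℕ
    K = proj₁ x-close
    L = proj₁ log-large
    bound : ∀ k → N ℕ.≤ k → ℚ.∣ ι N ℚ.- seq x k ∣ ℚ.≤ 1ℚ → LogBound.¼ ℚ.* Sums.harmonic N ℚ.≤ seq (log x) k →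
            ℚ.∣ ∑₁ N (J e) ℚ.- partialProduct (perturbation g) k ℚ.* seq x k ∣ ℚ.≤
            constant g a near ℚ.* seq (log x ^ a) k
    bound k N≤k close large = subst₂ ℚ._≤_
      (cong (λ s → ℚ.∣ s ℚ.- partialProduct (perturbation g) k ℚ.* seq x k ∣)
        (Sums.∑₁-ext N λ n n<N → sym (J≡ (ℕ.≤-trans n<N N≤k))))
      (cong (constant g a near ℚ.*_) (sym (seq-^ (log x) a k)))
      (real-argument-error g a near N {{ℕ.>-nonZero (ℕ.≤-trans (ℕ.s≤s ℕ.z≤n) 2≤N)}} k {seq x k} {seq (log x) k} close large)

theorem2 : ∀ {r : ℕ} (e : Vector ℤ (suc r)) → weight e ≡ 0ℤ →
    ∃[ 𝔖 ] (Is𝔖 e 𝔖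
    × fromℕ 0 < 𝔖
    × (∃[ C ] ∀ (x : ℝ) (N : ℕ) → fromℕ 2 ≤ x → IsFloor x N →
    ∣ fromℚ (∑₁ N (J e)) - 𝔖 * x ∣ ≤ C * log x ^ ∣ head e ∣ℤ))
theorem2 e w≡0 = 𝔖 , approximants-converge 𝔖 (eulerProduct e) (eulerProduct≡ e w≡0) ,
    away⇒0< {𝔖} (product-away g ∣ head e ∣ℤ near) ,
    fromℚ (constant g ∣ head e ∣ℤ near) , sum-estimate e g near (J≡sieve e w≡0)
  where
  g : ℕ → ℚ
  g = localFactor e
  near : Near (ι ∣ head e ∣ℤ) g
  near = near-localFactor e
  𝔖 : ℝ
  𝔖 = limit e g near
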